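{- Let $G$ be a linear balanceable graph with at least two vertices. Then $G$ contains at least two vertices of degree at most $2$.
   Context: A hole is a chordless cycle of length at least $4$; a $4$-hole is a hole of length $4$. A signing of a bipartite graph is an assignment of weights $+1$ or $-1$ to its edges; a signed bipartite graph is balanced if the sum of the weights of the edges of every hole is $\equiv 0 \pmod 4$. A bipartite graph is balanceable if it has a signing making it balanced. A bipartite graph is linear balanceable if it is balanceable and contains no $4$-hole as an induced subgraph. -}

module Defs where

open import Data.Bool using (Bool; true; false)
open import Data.Nat using (ℕ; suc; _+_; _≤_)
open import Data.Nat.DivMod using (_%_; m%n<n)
open import Data.Fin using (Fin; toℕ; fromℕ<)
open import Data.List using (List; foldr; length; filterᵇ; allFin)
open import Data.Integer using (ℤ; 1ℤ; -1ℤ; 0ℤ) renaming (_+_ to _+ℤ_)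
open import Data.Integer.Divisibility using () renaming (_∣_ to _∣ℤ_)
open import Data.Product using (Σ; ∃; _×_; _,_)
open import Data.Sum using (_⊎_)
open import Relation.Binary.PropositionalEquality using (_≡_; _≢_)
open import Function.Definitions using (Injective)
open import Function.Bundles using (_⇔_)
open import Relation.Nullary using (¬_)

record Graph (n : ℕ) : Set where
  field
    adj    : Fin n → Fin n → Bool
    sym    : ∀ u v → adj u v ≡ adj v u
    irrefl : ∀ u → adj u u ≡ false
open Graph public

Edge : ∀ {n} → Graph n → Fin n → Fin n → Set
Edge G u v = adj G u v ≡ true

Bipartite : ∀ {n} → Graph n → Set
Bipartite {n} G = Σ (Fin n → Bool) λ c → ∀ u v → Edge G u v → c u ≢ c v

degree : ∀ {n} → Graph n → Fin n → ℕ
degree {n} G u = length (filterᵇ (adj G u) (allFin n))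

next : ∀ {m} → Fin (4 + m) → Fin (4 + m)
next {m} i = fromℕ< (m%n<n (suc (toℕ i)) (4 + m))

CycAdj : ∀ {m} → Fin (4 + m) → Fin (4 + m) → Set
CycAdj i j = (j ≡ next i) ⊎ (i ≡ next j)

record Hole {n : ℕ} (G : Graph n) (m : ℕ) : Set where
  field
    vert    : Fin (4 + m) → Fin n
    inj     : Injective _≡_ _≡_ vert
    induced : ∀ i j → Edge G (vert i) (vert j) ⇔ CycAdj i j
open Hole public

record Signing {n : ℕ} (G : Graph n) : Set where
  field
    w      : Fin n → Fin n → ℤ
    w-sym  : ∀ u v → Edge G u v → w u v ≡ w v u
    w-pm1  : ∀ u v → Edge G u v → (w u v ≡ 1ℤ) ⊎ (w u v ≡ -1ℤ)
open Signing public

sumℤ : List ℤ → ℤ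
sumℤ = foldr _+ℤ_ 0ℤ

holeWeight : ∀ {n} {G : Graph n} {m} → Signing G → Hole G m → ℤ
holeWeight {m = m} σ H =
  sumℤ (Data.List.map (λ i → w σ (vert H i) (vert H (next i))) (allFin (4 + m)))

Balanced : ∀ {n} {G : Graph n} → Signing G → Set
Balanced {G = G} σ = ∀ m (H : Hole G m) → Data.Integer.+ 4 ∣ℤ holeWeight σ H

Balanceable : ∀ {n} → Graph n → Set
Balanceable G = Bipartite G × Σ (Signing G) Balanced

LinearBalanceable : ∀ {n} → Graph n → Set
LinearBalanceable G = Balanceable G × ¬ Hole G 0

{-# OPTIONS --safe #-}
-- Only two consequences of linear balanceability are used: there is no 4-cycle, and there is no odd theta (three
-- pairwise anticomplete induced paths joining vertices of different colours), since the three path weights would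
-- have pairwise sums divisible by 4 although each of them is odd.
--
-- Suppose that all vertices but possibly ρ have degree at least 3. Take a connected set X containing ρ, maximal such
-- that a cycle survives in the set C of vertices at distance at least 2 from X, and let D be the set of vertices at
-- distance 1. By maximality C \ N(b) is a forest for every b in D, and any two vertices of D are linked through X,
-- away from C. If some b in D has two neighbours joined by a path in C, choose b and the path as short as possible;
-- the path closes a hole through b, and the vertex g at distance 2 from an end of the path has a further neighbour w.
-- Following two branches of the forest from w until they first meet D or N(b), every possibility closes an odd theta,
-- or leads to a vertex of D with two neighbours joined by a path so poor in contacts with D that a walk leaving it
-- never stops. Hence each vertex of D has at most one neighbour in each component of C, and then every vertex of
-- a hole in C must have a neighbour in D (otherwise a walk leaving the hole never stops), which is again an odd theta.

module Submission where

open import Defs hiding (sym; w)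
open import Data.Bool using (Bool; true; false; T; T?)
import Data.Bool.Properties as Bool
open import Data.Empty using (⊥; ⊥-elim)
open import Data.Fin using (Fin; zero; suc; toℕ)
open import Data.Fin.Properties using (_≟_; any?; pigeonhole; toℕ-injective; toℕ-fromℕ<; toℕ<n)
open import Data.Integer using (ℤ; 1ℤ; 0ℤ) renaming (+_ to pos; _+_ to _+ℤ_; _*_ to _*ℤ_; _-_ to _-ℤ_)
import Data.Integer.Divisibility.Signed as ∣ₛ
import Data.Integer.Properties as ℤ
open import Data.Integer.Tactic.RingSolver using (solve-∀)
open import Data.List using (List; []; _∷_; [_]; _++_; _ʳ++_; length; lookup; reverse; tabulate; allFin; filterᵇ)
open import Data.List.Properties using (++-assoc; ʳ++-defn; ʳ++-ʳ++; unfold-reverse; reverse-++; length-++; reverse-involutive; map-tabulate)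
open import Data.List.Membership.Propositional using (_∈_)
open import Data.List.Membership.Propositional.Properties using (∈-++⁺ˡ; ∈-++⁺ʳ; ∈-++⁻; ∈-∃++; ∈-filter⁻; ∈-lookup)
import Data.List.Relation.Unary.All as All
import Data.List.Relation.Unary.AllPairs as AllPairs
open import Data.List.Relation.Unary.Any using (here; there)
open import Data.List.Relation.Unary.Any.Properties using (reverse⁺; reverse⁻)
open import Data.List.Relation.Unary.Unique.Propositional using (Unique)
import Data.List.Relation.Unary.Unique.Propositional.Properties as Unique
open import Data.Nat using (ℕ; zero; suc; _+_; _<_; _≤_; s≤s; z≤n; _≤?_)
open import Data.Nat.Divisibility using (_∣_; divides)
open import Data.Nat.DivMod using (_%_; m<n⇒m%n≡m; n%n≡0; m%n<n)
import Data.Nat.Properties as ℕ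
open import Data.Product using (Σ; ∃; ∃₂; _×_; _,_; proj₁; proj₂)
open import Data.Sum using (_⊎_; inj₁; inj₂; [_,_]′)
open import Data.Unit using (⊤; tt)
open import Function using (_∘_; id)
open import Function.Bundles using (mk⇔)
open import Relation.Binary.Definitions using (tri<; tri≈; tri>)
open import Relation.Binary.PropositionalEquality using (_≡_; _≢_; refl; sym; trans; cong; cong₂; subst; module ≡-Reasoning)
open import Relation.Nullary using (¬_; Dec; yes; no; ¬?)
open import Relation.Nullary.Decidable using (_×-dec_; _⊎-dec_)

-- The argument produces a vertex of low degree away from any prescribed one; used twice, it gives
-- the pair. The prescribed vertex is the root ρ, and since X contains it, degree at least 3 is
-- available throughout C. Every walk that never stops has the same form. In a forest a walk that
-- does not backtrack is an induced path, so it has at most n vertices. Degree at least 3 leaves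
-- room for the predecessor, one forbidden neighbour and a continuation, so each vertex may have
-- only one forbidden neighbour; two of them would usually share a second common neighbour and form
-- a 4-cycle. The obstacle is that a branch leaving a hole may soon meet D. A vertex of D that
-- misses the hole leads through X to the third path of a theta; the difficult ones see the hole as
-- well. Minimality of the path leaves each of them, apart from b, at most one neighbour on the
-- hole. The vertex g is at distance 2 from an end because it must differ in colour from b to be an
-- end of an odd theta, and so close to the end the absence of 4-cycles keeps w off the short arm.

two-colours : ∀ {a b c : Bool} → a ≢ b → a ≢ c → b ≡ c
two-colours {true} {true} a≢b _ = ⊥-elim (a≢b refl)
two-colours {true} {false} {true} _ a≢c = ⊥-elim (a≢c refl)
two-colours {true} {false} {false} _ _ = refl
two-colours {false} {false} a≢b _ = ⊥-elim (a≢b refl)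
two-colours {false} {true} {false} _ a≢c = ⊥-elim (a≢c refl)
two-colours {false} {true} {true} _ _ = refl

three-colours : ∀ {a b c : Bool} → a ≢ b → a ≢ c → b ≢ c → ⊥
three-colours p q r = r (two-colours p q)

-- The three sums give 4 | (a+b)+(a+d)-(b+d) = 2a, while oddness of a gives 4 | 2a+2, so 4 would
-- divide 2. Oddness is written as 2 | 1 + a so that parities combine by adding divisibilities.
no-odd-triple : ∀ a b d → pos 4 ∣ₛ.∣ a +ℤ b → pos 4 ∣ₛ.∣ a +ℤ d → pos 4 ∣ₛ.∣ b +ℤ d → pos 2 ∣ₛ.∣ 1ℤ +ℤ a → ⊥
no-odd-triple a b d p q r (∣ₛ.divides k eq) =
  4∤2 (∣ₛ.∣⇒∣ᵤ (∣ₛ.∣m+n∣m⇒∣n 4∣2a+2 4∣2a))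
  where
  twice : ∀ a b d → (a +ℤ b) +ℤ (a +ℤ d) -ℤ (b +ℤ d) ≡ pos 2 *ℤ a
  twice = solve-∀
  four : ∀ k → pos 2 *ℤ (k *ℤ pos 2) ≡ k *ℤ pos 4
  four = solve-∀
  expand : ∀ a → pos 2 *ℤ (1ℤ +ℤ a) ≡ pos 2 *ℤ a +ℤ pos 2
  expand = solve-∀
  4∣2a : pos 4 ∣ₛ.∣ pos 2 *ℤ a
  4∣2a = subst (pos 4 ∣ₛ.∣_) (twice a b d) (∣ₛ.∣m∣n⇒∣m-n (∣ₛ.∣m∣n⇒∣m+n p q) r)
  4∣2a+2 : pos 4 ∣ₛ.∣ pos 2 *ℤ a +ℤ pos 2
  4∣2a+2 = ∣ₛ.divides k (trans (sym (expand a)) (trans (cong (pos 2 *ℤ_) eq) (four k)))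
  4∤2 : ¬ 4 ∣ 2
  4∤2 (divides zero ())
  4∤2 (divides (suc _) ())

odd+odd : ∀ s t → pos 2 ∣ₛ.∣ 1ℤ +ℤ s → pos 2 ∣ₛ.∣ 1ℤ +ℤ t → pos 2 ∣ₛ.∣ s +ℤ t
odd+odd s t p q = ∣ₛ.∣m+n∣n⇒∣m (subst (pos 2 ∣ₛ.∣_) (shift₂ s t) (∣ₛ.∣m∣n⇒∣m+n p q)) (∣ₛ.∣-refl {pos 2})
  where
  shift₂ : ∀ s t → (1ℤ +ℤ s) +ℤ (1ℤ +ℤ t) ≡ (s +ℤ t) +ℤ pos 2
  shift₂ = solve-∀

odd+even : ∀ s t → pos 2 ∣ₛ.∣ 1ℤ +ℤ s → pos 2 ∣ₛ.∣ t → pos 2 ∣ₛ.∣ 1ℤ +ℤ (s +ℤ t)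
odd+even s t p q = subst (pos 2 ∣ₛ.∣_) (ℤ.+-assoc 1ℤ s t) (∣ₛ.∣m∣n⇒∣m+n p q)

-- Induced paths, rims and the holes they bound

module Graphs {n : ℕ} (G : Graph n) where

  V : Set
  V = Fin n

  infix 4 _~_
  _~_ : V → V → Set
  u ~ v = Edge G u v

  ~-sym : ∀ {u v} → u ~ v → v ~ u
  ~-sym {u} {v} e = trans (Graph.sym G v u) e

  ~⇒≢ : ∀ {u v} → u ~ v → u ≢ v
  ~⇒≢ {u} e refl with trans (sym e) (irrefl G u)
  ... | ()

  Non : V → V → Set
  Non u v = u ≢ v × ¬ u ~ v

  Non-sym : ∀ {u v} → Non u v → Non v u
  Non-sym (u≢v , u≁v) = u≢v ∘ sym , u≁v ∘ ~-sym

  NonAll : V → List V → Set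
  NonAll x ys = ∀ {y} → y ∈ ys → Non x y

  Anti : List V → List V → Set
  Anti xs ys = ∀ {x y} → x ∈ xs → y ∈ ys → Non x y

  Anti-sym : ∀ {xs ys} → Anti xs ys → Anti ys xs
  Anti-sym anti p q = Non-sym (anti q p)

  Induced : List V → Set
  Induced [] = ⊤
  Induced (x ∷ []) = ⊤
  Induced (x ∷ y ∷ ys) = x ~ y × NonAll x ys × Induced (y ∷ ys)

  Induced-tail : ∀ {x} xs → Induced (x ∷ xs) → Induced xs
  Induced-tail [] _ = tt
  Induced-tail (y ∷ ys) (_ , _ , ip) = ip

  Induced-++ˡ : ∀ xs {ys} → Induced (xs ++ ys) → Induced xs
  Induced-++ˡ [] _ = tt
  Induced-++ˡ (x ∷ []) _ = tt
  Induced-++ˡ (x ∷ y ∷ xs) (e , nx , ip) = e , (λ p → nx (∈-++⁺ˡ p)) , Induced-++ˡ (y ∷ xs) ip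

  -- Both arms are listed outwards from u, and `ʳ++` turns the first one round, so the result reads
  -- from the far end of A through u to the far end of B. The induction moves the centre along A.
  Induced-arms : ∀ {u} A B → Induced (u ∷ A) → Induced (u ∷ B) → Anti A B → Induced (A ʳ++ (u ∷ B))
  Induced-arms [] B _ ipB _ = ipB
  Induced-arms {u} (a ∷ A) B (e , nu , ipA) ipB anti =
    Induced-arms A (u ∷ B) ipA (~-sym e , anti (here refl) , ipB)
      λ { p (here refl) → Non-sym (nu p) ; p (there q) → anti (there p) q }

  Closes : V → List V → Set
  Closes x [] = ⊥
  Closes x (z ∷ []) = x ~ z
  Closes x (y ∷ z ∷ zs) = Non x y × Closes x (z ∷ zs)

  -- Together with `Induced` this is a chordless cycle cut open at x: the neighbours of x on the
  -- list are exactly its two ends.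
  Rim : V → List V → Set
  Rim x [] = ⊥
  Rim x (y ∷ ys) = x ~ y × Closes x ys

  Closes-last : ∀ {v} u B → Induced (u ∷ B ++ [ v ]) → ¬ u ~ v → B ≢ [] → Closes v (u ∷ B)
  Closes-last u [] _ _ B≢[] = ⊥-elim (B≢[] refl)
  Closes-last u (b ∷ B) (_ , nu , ip) _ _ = Non-sym (nu (∈-++⁺ʳ B (here refl))) , go b B ip
    where
    go : ∀ {v} b B → Induced (b ∷ B ++ [ v ]) → Closes v (b ∷ B)
    go b [] (e , _) = ~-sym e
    go b (c ∷ B) (_ , nb , ip) = Non-sym (nb (∈-++⁺ʳ B (here refl))) , go c B ip

  Rim-arm : ∀ {v} A acc → Induced (A ++ [ v ]) → A ≢ [] → Closes v acc → Rim v (A ʳ++ acc)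
  Rim-arm [] acc _ A≢[] _ = ⊥-elim (A≢[] refl)
  Rim-arm (a ∷ []) acc (e , _) _ cl = ~-sym e , cl
  Rim-arm (a ∷ b ∷ A) [] ip _ ()
  Rim-arm (a ∷ b ∷ A) acc@(_ ∷ _) (_ , na , ip) _ cl =
    Rim-arm (b ∷ A) (a ∷ acc) ip (λ ()) (Non-sym (na (∈-++⁺ʳ A (here refl))) , cl)

  Closes-lookup⁺ : ∀ {x} l → Closes x l → ∀ i → suc (toℕ i) ≡ length l → x ~ lookup l i
  Closes-lookup⁺ (z ∷ []) cl zero _ = cl
  Closes-lookup⁺ (y ∷ z ∷ l) cl zero ()
  Closes-lookup⁺ (y ∷ z ∷ l) (_ , cl) (suc i) eq = Closes-lookup⁺ (z ∷ l) cl i (ℕ.suc-injective eq)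

  Closes-lookup⁻ : ∀ {x} l → Closes x l → ∀ i → x ~ lookup l i → suc (toℕ i) ≡ length l
  Closes-lookup⁻ (z ∷ []) cl zero _ = refl
  Closes-lookup⁻ (y ∷ z ∷ l) ((_ , n) , _) zero e = ⊥-elim (n e)
  Closes-lookup⁻ (y ∷ z ∷ l) (_ , cl) (suc i) e = cong suc (Closes-lookup⁻ (z ∷ l) cl i e)

  Closes-≢ : ∀ {x} l → Closes x l → ∀ i → x ≢ lookup l i
  Closes-≢ (z ∷ []) cl zero = ~⇒≢ cl
  Closes-≢ (y ∷ z ∷ l) ((n , _) , _) zero = n
  Closes-≢ (y ∷ z ∷ l) (_ , cl) (suc i) = Closes-≢ (z ∷ l) cl i

  Induced-lookup⁺ : ∀ l → Induced l → ∀ i j → toℕ j ≡ suc (toℕ i) → lookup l i ~ lookup l j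
  Induced-lookup⁺ (x ∷ y ∷ l) (e , _) zero (suc zero) _ = e
  Induced-lookup⁺ (x ∷ y ∷ l) (_ , _ , ip) (suc i) (suc j) eq = Induced-lookup⁺ (y ∷ l) ip i j (ℕ.suc-injective eq)

  Induced-lookup⁻ : ∀ l → Induced l → ∀ i j → toℕ i < toℕ j → lookup l i ~ lookup l j → toℕ j ≡ suc (toℕ i)
  Induced-lookup⁻ (x ∷ y ∷ l) _ zero (suc zero) _ _ = refl
  Induced-lookup⁻ (x ∷ y ∷ l) (_ , nx , _) zero (suc (suc j)) _ e = ⊥-elim (proj₂ (nx (∈-lookup j)) e)
  Induced-lookup⁻ (x ∷ y ∷ l) (_ , _ , ip) (suc i) (suc j) (s≤s lt) e = cong suc (Induced-lookup⁻ (y ∷ l) ip i j lt e)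

  Induced-lookup-≢ : ∀ l → Induced l → ∀ i j → toℕ i < toℕ j → lookup l i ≢ lookup l j
  Induced-lookup-≢ (x ∷ y ∷ l) (e , _) zero (suc zero) _ = ~⇒≢ e
  Induced-lookup-≢ (x ∷ y ∷ l) (_ , nx , _) zero (suc (suc j)) _ = proj₁ (nx (∈-lookup j))
  Induced-lookup-≢ (x ∷ y ∷ l) (_ , _ , ip) (suc i) (suc j) (s≤s lt) = Induced-lookup-≢ (y ∷ l) ip i j lt

  private
    toℕ-next : ∀ {m} (i : Fin (4 + m)) → toℕ (next {m} i) ≡ suc (toℕ i) % (4 + m)
    toℕ-next {m} i = toℕ-fromℕ< (m%n<n (suc (toℕ i)) (4 + m))

    next-step : ∀ {m} (i : Fin (4 + m)) → suc (toℕ i) < 4 + m → toℕ (next {m} i) ≡ suc (toℕ i)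
    next-step {m} i lt = trans (toℕ-next i) (m<n⇒m%n≡m lt)

    next-wrap : ∀ {m} (i : Fin (4 + m)) → suc (toℕ i) ≡ 4 + m → toℕ (next {m} i) ≡ 0
    next-wrap {m} i eq = trans (toℕ-next i) (trans (cong (_% (4 + m)) eq) (n%n≡0 (4 + m)))

    next-cases : ∀ {m} (i : Fin (4 + m)) → suc (toℕ i) < 4 + m ⊎ suc (toℕ i) ≡ 4 + m
    next-cases i = ℕ.m≤n⇒m<n∨m≡n (toℕ<n i)

  module _ (x a b c : V) (l : List V) (ip : Induced (a ∷ b ∷ c ∷ l)) (rim : Rim x (a ∷ b ∷ c ∷ l)) where

    private
      m = length l
      vs = x ∷ a ∷ b ∷ c ∷ l
      vt : Fin (4 + m) → V
      vt = lookup vs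
      r = a ∷ b ∷ c ∷ l

      lt-edge⁻ : ∀ i j → toℕ i < toℕ j → vt i ~ vt j → toℕ j ≡ suc (toℕ i) ⊎ (toℕ i ≡ 0 × suc (toℕ j) ≡ 4 + m)
      lt-edge⁻ zero (suc zero) _ _ = inj₁ refl
      lt-edge⁻ zero (suc (suc j)) _ e = inj₂ (refl , cong (2 +_) (Closes-lookup⁻ (b ∷ c ∷ l) (proj₂ rim) j e))
      lt-edge⁻ (suc i) (suc j) (s≤s lt) e = inj₁ (cong suc (Induced-lookup⁻ r ip i j lt e))

      step-edge : ∀ i j → toℕ j ≡ suc (toℕ i) → vt i ~ vt j
      step-edge zero (suc zero) _ = proj₁ rim
      step-edge (suc i) (suc j) eq = Induced-lookup⁺ r ip i j (ℕ.suc-injective eq)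

      wrap-edge : ∀ i j → suc (toℕ i) ≡ 4 + m → toℕ j ≡ 0 → vt j ~ vt i
      wrap-edge (suc (suc i)) zero eq _ = Closes-lookup⁺ (b ∷ c ∷ l) (proj₂ rim) i (ℕ.suc-injective (ℕ.suc-injective eq))

      vt-≢ : ∀ i j → toℕ i < toℕ j → vt i ≢ vt j
      vt-≢ zero (suc zero) _ = ~⇒≢ (proj₁ rim)
      vt-≢ zero (suc (suc j)) _ = Closes-≢ (b ∷ c ∷ l) (proj₂ rim) j
      vt-≢ (suc i) (suc j) (s≤s lt) = Induced-lookup-≢ r ip i j lt

      next-edge : ∀ i → vt i ~ vt (next i)
      next-edge i with next-cases i
      ... | inj₁ lt = step-edge i (next i) (next-step i lt)
      ... | inj₂ eq = ~-sym (wrap-edge i (next i) eq (next-wrap i eq))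

      adj⁻ : ∀ i j → toℕ i < toℕ j → vt i ~ vt j → CycAdj i j
      adj⁻ i j lt e with lt-edge⁻ i j lt e
      ... | inj₁ eq = inj₁ (toℕ-injective (trans eq (sym (next-step i (subst (_< 4 + m) eq (toℕ<n j))))))
      ... | inj₂ (i0 , jl) = inj₂ (toℕ-injective (trans i0 (sym (next-wrap j jl))))

      swap : ∀ {i j : Fin (4 + m)} → CycAdj i j → CycAdj j i
      swap (inj₁ p) = inj₂ p
      swap (inj₂ p) = inj₁ p

    -- Naming a, b and c makes the length `4 + length l` by computation, as `Hole` demands. Edges
    -- split into steps within the list and the one that wraps around to x.
    rimHole : Hole G m
    vert rimHole = vt
    inj rimHole {i} {j} eq with ℕ.<-cmp (toℕ i) (toℕ j)
    ... | tri< lt _ _ = ⊥-elim (vt-≢ i j lt eq)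
    ... | tri≈ _ p _ = toℕ-injective p
    ... | tri> _ _ gt = ⊥-elim (vt-≢ j i gt (sym eq))
    induced rimHole i j = mk⇔ to from
      where
      to : vt i ~ vt j → CycAdj i j
      to e with ℕ.<-cmp (toℕ i) (toℕ j)
      ... | tri< lt _ _ = adj⁻ i j lt e
      ... | tri≈ _ p _ = ⊥-elim (~⇒≢ e (cong vt (toℕ-injective p)))
      ... | tri> _ _ gt = swap {j} {i} (adj⁻ j i gt (~-sym e))
      from : CycAdj i j → vt i ~ vt j
      from (inj₁ refl) = next-edge i
      from (inj₂ refl) = ~-sym (next-edge j)

  -- Weights of holes and the exclusion of odd thetas

  module Weights (σ : Signing G) where

    W : V → V → ℤ
    W = Signing.w σ

    pathWeight : List V → ℤ
    pathWeight [] = 0ℤ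
    pathWeight (_ ∷ []) = 0ℤ
    pathWeight (y ∷ z ∷ zs) = W y z +ℤ pathWeight (z ∷ zs)

    -- The final vertex v stays outside the list so that a hole read from v can end with the edge
    -- returning to v.
    weightTo : V → List V → ℤ
    weightTo v [] = 0ℤ
    weightTo v (z ∷ []) = W z v
    weightTo v (y ∷ z ∷ zs) = W y z +ℤ weightTo v (z ∷ zs)

    weightTo-path : ∀ {v} u B → weightTo v (u ∷ B) ≡ pathWeight (u ∷ B ++ [ v ])
    weightTo-path {v} u [] = sym (ℤ.+-identityʳ (W u v))
    weightTo-path u (b ∷ B) = cong (W u b +ℤ_) (weightTo-path b B)

    -- The hole runs from v back along the arm to x and then on through `acc`. The edges of the arm
    -- are traversed backwards, which is where the symmetry of the signing enters.
    weightTo-arm : ∀ {v} A x acc → Induced (x ∷ A ++ [ v ]) →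
      weightTo v (v ∷ (A ʳ++ (x ∷ acc))) ≡ pathWeight (x ∷ A ++ [ v ]) +ℤ weightTo v (x ∷ acc)
    weightTo-arm {v} [] x acc (e , _) =
      cong (_+ℤ weightTo v (x ∷ acc)) (trans (w-sym σ v x (~-sym e)) (sym (ℤ.+-identityʳ (W x v))))
    weightTo-arm {v} (a ∷ A) x acc (e , _ , ip) = begin
      weightTo v (v ∷ (A ʳ++ (a ∷ x ∷ acc)))
        ≡⟨ weightTo-arm A a (x ∷ acc) ip ⟩
      p +ℤ (W a x +ℤ q)
        ≡⟨ cong (λ t → p +ℤ (t +ℤ q)) (w-sym σ a x (~-sym e)) ⟩
      p +ℤ (W x a +ℤ q)
        ≡⟨ rearrange p (W x a) q ⟩
      (W x a +ℤ p) +ℤ q ∎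
      where
      open ≡-Reasoning
      p = pathWeight (a ∷ A ++ [ v ])
      q = weightTo v (x ∷ acc)
      rearrange : ∀ p t q → p +ℤ (t +ℤ q) ≡ (t +ℤ p) +ℤ q
      rearrange = solve-∀

    private
      sum-tabulate : ∀ x y ys (g : Fin (suc (length ys)) → ℤ) →
        (∀ i j → toℕ j ≡ suc (toℕ i) → g i ≡ W (lookup (y ∷ ys) i) (lookup (y ∷ ys) j)) →
        (∀ i → 1 + toℕ i ≡ 1 + length ys → g i ≡ W (lookup (y ∷ ys) i) x) →
        sumℤ (tabulate g) ≡ weightTo x (y ∷ ys)
      sum-tabulate x y [] g _ h = trans (ℤ.+-identityʳ (g zero)) (h zero refl)
      sum-tabulate x y (z ∷ ys) g s h =
        cong₂ _+ℤ_ (s zero (suc zero) refl)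
          (sum-tabulate x z ys (g ∘ suc) (λ i j eq → s (suc i) (suc j) (cong (1 +_) eq)) (λ i eq → h (suc i) (cong (1 +_) eq)))

    holeWeight-rim : ∀ x a b c l ip rim →
      holeWeight σ (rimHole x a b c l ip rim) ≡ weightTo x (x ∷ a ∷ b ∷ c ∷ l)
    holeWeight-rim x a b c l ip rim = trans (cong sumℤ (map-tabulate id f)) (sum-tabulate x x (a ∷ b ∷ c ∷ l) f hs hl)
      where
      m = length l
      vt : Fin (4 + m) → V
      vt = lookup (x ∷ a ∷ b ∷ c ∷ l)
      f : Fin (4 + m) → ℤ
      f i = W (vt i) (vt (next i))
      hs : ∀ i j → toℕ j ≡ suc (toℕ i) → f i ≡ W (vt i) (vt j)
      hs i j eq = cong (λ k → W (vt i) (vt k))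
        (toℕ-injective (trans (next-step i (subst (_< 4 + m) eq (toℕ<n j))) (sym eq)))
      hl : ∀ i → suc (toℕ i) ≡ 4 + m → f i ≡ W (vt i) x
      hl i eq = cong (λ k → W (vt i) (vt k)) {next i} {zero} (toℕ-injective (next-wrap i eq))

    module _ (balanced : Balanced σ) (col : V → Bool) (proper : ∀ u v → u ~ v → col u ≢ col v) where

      rim-weight : ∀ {x} r → Induced r → Rim x r → pos 4 ∣ₛ.∣ weightTo x (x ∷ r)
      rim-weight (a ∷ b ∷ []) (e , _) (xa , xb) = ⊥-elim (three-colours (proper _ _ xa) (proper _ _ xb) (proper _ _ e))
      rim-weight {x} (a ∷ b ∷ c ∷ l) ip rim =
        subst (pos 4 ∣ₛ.∣_) (holeWeight-rim x a b c l ip rim) (∣ₛ.∣ᵤ⇒∣ (balanced (length l) (rimHole x a b c l ip rim)))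

      -- As u and v are nonadjacent, the two paths bound a hole; read from v, its weight is the sum
      -- of the two path weights.
      two-arm-weight : ∀ {u v} A B → A ≢ [] → B ≢ [] → ¬ u ~ v →
        Induced (u ∷ A ++ [ v ]) → Induced (u ∷ B ++ [ v ]) → Anti A B →
        pos 4 ∣ₛ.∣ pathWeight (u ∷ A ++ [ v ]) +ℤ pathWeight (u ∷ B ++ [ v ])
      two-arm-weight {u} {v} A B A≢[] B≢[] u≁v ipA ipB anti =
        subst (pos 4 ∣ₛ.∣_)
          (trans (weightTo-arm A u B ipA) (cong (pathWeight (u ∷ A ++ [ v ]) +ℤ_) (weightTo-path u B)))
          (rim-weight (A ʳ++ (u ∷ B))
            (Induced-arms A B (Induced-++ˡ (u ∷ A) ipA) (Induced-++ˡ (u ∷ B) ipB) anti)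
            (Rim-arm A (u ∷ B) (Induced-tail _ ipA) A≢[] (Closes-last u B ipB u≁v B≢[])))

      -- Every edge has odd weight and changes the colour, so the weight of a path has the parity of
      -- its length, which the colours of the ends determine.
      path-parity : ∀ {v} u A → Induced (u ∷ A ++ [ v ]) →
        (col u ≡ col v → pos 2 ∣ₛ.∣ pathWeight (u ∷ A ++ [ v ])) ×
        (col u ≢ col v → pos 2 ∣ₛ.∣ 1ℤ +ℤ pathWeight (u ∷ A ++ [ v ]))
      path-parity {v} u A ip = go u A ip
        where
        unit : ∀ {x y} → x ~ y → pos 2 ∣ₛ.∣ 1ℤ +ℤ W x y
        unit {x} {y} e with w-pm1 σ x y e
        ... | inj₁ eq = subst (λ t → pos 2 ∣ₛ.∣ 1ℤ +ℤ t) (sym eq) (∣ₛ.divides (pos 1) refl)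
        ... | inj₂ eq = subst (λ t → pos 2 ∣ₛ.∣ 1ℤ +ℤ t) (sym eq) (∣ₛ.divides (pos 0) refl)
        go : ∀ u A → Induced (u ∷ A ++ [ v ]) →
          (col u ≡ col v → pos 2 ∣ₛ.∣ pathWeight (u ∷ A ++ [ v ])) ×
          (col u ≢ col v → pos 2 ∣ₛ.∣ 1ℤ +ℤ pathWeight (u ∷ A ++ [ v ]))
        go u [] (e , _) = (λ eq → ⊥-elim (proper _ _ e eq)) ,
          λ _ → subst (λ t → pos 2 ∣ₛ.∣ 1ℤ +ℤ t) (sym (ℤ.+-identityʳ (W u v))) (unit e)
        go u (a ∷ A) (e , _ , ip) =
          (λ eq → odd+odd (W u a) (pathWeight (a ∷ A ++ [ v ])) (unit e) (proj₂ (go a A ip) λ eq′ → proper _ _ e (trans eq (sym eq′)))) ,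
          λ ne → odd+even (W u a) (pathWeight (a ∷ A ++ [ v ])) (unit e) (proj₁ (go a A ip) (two-colours (proper _ _ e) ne))

      no-odd-theta : ∀ {u v} A B D → A ≢ [] → B ≢ [] → D ≢ [] → ¬ u ~ v → col u ≢ col v →
        Induced (u ∷ A ++ [ v ]) → Induced (u ∷ B ++ [ v ]) → Induced (u ∷ D ++ [ v ]) →
        Anti A B → Anti A D → Anti B D → ⊥
      no-odd-theta {u} {v} A B D A≢ B≢ D≢ u≁v c≢ ipA ipB ipD ab ad bd =
        no-odd-triple (pathWeight (u ∷ A ++ [ v ])) (pathWeight (u ∷ B ++ [ v ])) (pathWeight (u ∷ D ++ [ v ]))
          (two-arm-weight A B A≢ B≢ u≁v ipA ipB ab)
          (two-arm-weight A D A≢ D≢ u≁v ipA ipD ad)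
          (two-arm-weight B D B≢ D≢ u≁v ipB ipD bd)
          (proj₂ (path-parity _ A ipA) c≢)

  -- Both diagonals join vertices of equal colour, so a 4-cycle has no chord and is a hole.
  no-C4 : ¬ Hole G 0 → (col : V → Bool) → (∀ u v → u ~ v → col u ≢ col v) →
    ∀ {u v x y} → u ≢ v → x ≢ y → u ~ x → u ~ y → v ~ x → v ~ y → ⊥
  no-C4 noHole col proper {u} {v} {x} {y} u≢v x≢y ux uy vx vy =
    noHole (rimHole u x v y []
      (~-sym vx , (λ { (here refl) → x≢y , λ e → three-colours (proper _ _ ux) (proper _ _ uy) (proper _ _ e) }) , vy , (λ ()) , tt)
      (ux , (u≢v , λ e → three-colours (proper _ _ e) (proper _ _ ux) (proper _ _ vx)) , uy))

  -- Joining, cutting and reversing induced paths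

  infix 4 _~?_
  _~?_ : ∀ u v → Dec (u ~ v)
  u ~? v = adj G u v Bool.≟ true

  ∈-snoc : ∀ {x} l {y : V} → x ∈ l ++ [ y ] → x ∈ l ⊎ x ≡ y
  ∈-snoc l p with ∈-++⁻ l p
  ... | inj₁ q = inj₁ q
  ... | inj₂ (here q) = inj₂ q

  ∈-ʳ++⁻ : ∀ {x : V} A {B} → x ∈ A ʳ++ B → x ∈ A ⊎ x ∈ B
  ∈-ʳ++⁻ [] p = inj₂ p
  ∈-ʳ++⁻ (a ∷ A) p with ∈-ʳ++⁻ A p
  ... | inj₁ q = inj₁ (there q)
  ... | inj₂ (here q) = inj₁ (here q)
  ... | inj₂ (there q) = inj₂ q

  ∈-ʳ++⁺ʳ : ∀ {x : V} A {B} → x ∈ B → x ∈ A ʳ++ B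
  ∈-ʳ++⁺ʳ [] p = p
  ∈-ʳ++⁺ʳ (a ∷ A) p = ∈-ʳ++⁺ʳ A (there p)

  ∈-ʳ++⁺ˡ : ∀ {x : V} A {B} → x ∈ A → x ∈ A ʳ++ B
  ∈-ʳ++⁺ˡ (a ∷ A) (here refl) = ∈-ʳ++⁺ʳ A (here refl)
  ∈-ʳ++⁺ˡ (a ∷ A) (there p) = ∈-ʳ++⁺ˡ A p

  Anti-[] : ∀ {xs} → Anti [] xs
  Anti-[] ()

  Anti-∷ : ∀ {x xs ys} → NonAll x ys → Anti xs ys → Anti (x ∷ xs) ys
  Anti-∷ nx _ (here refl) q = nx q
  Anti-∷ _ a (there p) q = a p q

  NonAll-++ : ∀ {x} ys {zs} → NonAll x ys → NonAll x zs → NonAll x (ys ++ zs)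
  NonAll-++ ys a b p with ∈-++⁻ ys p
  ... | inj₁ p′ = a p′
  ... | inj₂ p′ = b p′

  Induced-++ : ∀ xs {z} ys → Induced (xs ++ [ z ]) → Induced (z ∷ ys) → Anti xs ys → Induced (xs ++ z ∷ ys)
  Induced-++ [] ys _ ip _ = ip
  Induced-++ (x ∷ []) ys (e , _) ip anti = e , anti (here refl) , ip
  Induced-++ (x ∷ y ∷ xs) {z} ys (e , nx , ip₁) ip anti =
    e , nx′ , Induced-++ (y ∷ xs) ys ip₁ ip (λ p → anti (there p))
    where
    nx′ : NonAll x (xs ++ z ∷ ys)
    nx′ p with ∈-++⁻ xs p
    ... | inj₁ q = nx (∈-++⁺ˡ q)
    ... | inj₂ (here refl) = nx (∈-++⁺ʳ xs (here refl))
    ... | inj₂ (there q) = anti (here refl) q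

  Induced-++ʳ : ∀ xs {ys} → Induced (xs ++ ys) → Induced ys
  Induced-++ʳ [] ip = ip
  Induced-++ʳ (x ∷ xs) ip = Induced-++ʳ xs (Induced-tail _ ip)

  Induced-++-Anti : ∀ xs {z ys} → Induced (xs ++ z ∷ ys) → Anti xs ys
  Induced-++-Anti (x ∷ []) (_ , nx , _) (here refl) q = nx q
  Induced-++-Anti (x ∷ y ∷ xs) (_ , nx , _) (here refl) q = nx (∈-++⁺ʳ xs (there q))
  Induced-++-Anti (x ∷ y ∷ xs) (_ , _ , ip) (there p) q = Induced-++-Anti (y ∷ xs) ip p q

  Induced-≢ : ∀ x l → Induced (x ∷ l) → ∀ {y} → y ∈ l → x ≢ y
  Induced-≢ x (y ∷ l) (e , nx , _) (here refl) = ~⇒≢ e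
  Induced-≢ x (y ∷ l) (e , nx , _) (there p) = proj₁ (nx p)

  Induced-ends-≢ : ∀ {x y} l → Induced (x ∷ l ++ [ y ]) → x ≢ y
  Induced-ends-≢ l ip = Induced-≢ _ _ ip (∈-++⁺ʳ l (here refl))

  Induced-unarms : ∀ {u} A B → Induced (A ʳ++ (u ∷ B)) → Induced (u ∷ A) × Induced (u ∷ B) × Anti A B
  Induced-unarms [] B ip = tt , ip , Anti-[]
  Induced-unarms {u} (a ∷ A) B ip with Induced-unarms A (u ∷ B) ip
  ... | ipA , (e , na , ipB) , anti =
    (~-sym e , (λ p → Non-sym (anti p (here refl))) , ipA) , ipB , Anti-∷ na (λ p q → anti p (there q))

  Induced-reverse : ∀ l → Induced l → Induced (reverse l)
  Induced-reverse [] _ = tt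
  Induced-reverse (x ∷ l) ip = Induced-arms l [] ip tt (λ _ ())

  reverse-ends : ∀ (x : V) l y → reverse (x ∷ l ++ [ y ]) ≡ y ∷ reverse l ++ [ x ]
  reverse-ends x l y = trans (unfold-reverse x (l ++ [ y ])) (cong (_++ [ x ]) (reverse-++ l [ y ]))

  Induced-flip : ∀ {x y} l → Induced (x ∷ l ++ [ y ]) → Induced (y ∷ reverse l ++ [ x ])
  Induced-flip {x} {y} l ip = subst Induced (reverse-ends x l y) (Induced-reverse (x ∷ l ++ [ y ]) ip)

  Induced-close : ∀ {b} l → Induced l → Closes b l → Induced (l ++ [ b ])
  Induced-close (x ∷ []) _ e = ~-sym e , (λ ()) , tt
  Induced-close (x ∷ y ∷ l) (e , nx , ip) (nb , cl) =
    e , NonAll-++ l nx (λ { (here refl) → Non-sym nb }) , Induced-close (y ∷ l) ip cl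

  Rim-unarms : ∀ {b} A acc → Rim b (A ʳ++ acc) → A ≢ [] → acc ≢ [] → Closes b A × Closes b acc
  Rim-unarms [] acc _ A≢ _ = ⊥-elim (A≢ refl)
  Rim-unarms (a ∷ A) [] _ _ acc≢ = ⊥-elim (acc≢ refl)
  Rim-unarms (a ∷ []) (_ ∷ _) (e , cl) _ _ = e , cl
  Rim-unarms (a ∷ a′ ∷ A) acc@(_ ∷ _) rim _ _ with Rim-unarms (a′ ∷ A) (a ∷ acc) rim (λ ()) (λ ())
  ... | clA , (na , cl) = (na , clA) , cl

  -- This bound is what turns an endless walk in a forest into a contradiction.
  Induced-length : ∀ l → Induced l → length l ≤ n
  Induced-length l ip with ℕ.≤-<-connex (length l) n
  ... | inj₁ le = le
  ... | inj₂ lt with pigeonhole lt (lookup l)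
  ...   | i , j , i<j , eq = ⊥-elim (Induced-lookup-≢ l ip i j i<j eq)

  -- Non-backtracking walks and forests

  NonBacktracking : List V → Set
  NonBacktracking [] = ⊤
  NonBacktracking (x ∷ []) = ⊤
  NonBacktracking (x ∷ y ∷ []) = x ~ y
  NonBacktracking (x ∷ y ∷ z ∷ l) = x ~ y × x ≢ z × NonBacktracking (y ∷ z ∷ l)

  NonBacktracking-edge : ∀ {x y} l → NonBacktracking (x ∷ y ∷ l) → x ~ y
  NonBacktracking-edge [] e = e
  NonBacktracking-edge (_ ∷ _) (e , _) = e

  NonBacktracking-tail : ∀ {x} l → NonBacktracking (x ∷ l) → NonBacktracking l
  NonBacktracking-tail [] _ = tt
  NonBacktracking-tail (y ∷ []) _ = tt
  NonBacktracking-tail (y ∷ z ∷ l) (_ , _ , nb) = nb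

  NonBacktracking-++ˡ : ∀ l {m} → NonBacktracking (l ++ m) → NonBacktracking l
  NonBacktracking-++ˡ [] _ = tt
  NonBacktracking-++ˡ (x ∷ []) _ = tt
  NonBacktracking-++ˡ (x ∷ y ∷ []) {m} nb = NonBacktracking-edge m nb
  NonBacktracking-++ˡ (x ∷ y ∷ z ∷ l) (e , ne , nb) = e , ne , NonBacktracking-++ˡ (y ∷ z ∷ l) nb

  Induced⇒NonBacktracking : ∀ l → Induced l → NonBacktracking l
  Induced⇒NonBacktracking [] _ = tt
  Induced⇒NonBacktracking (x ∷ []) _ = tt
  Induced⇒NonBacktracking (x ∷ y ∷ []) (e , _) = e
  Induced⇒NonBacktracking (x ∷ y ∷ z ∷ l) (e , nx , ip) = e , proj₁ (nx (here refl)) , Induced⇒NonBacktracking (y ∷ z ∷ l) ip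

  -- The condition under which two walks leaving a common vertex join there without backtracking.
  HeadsDiffer : List V → List V → Set
  HeadsDiffer [] _ = ⊤
  HeadsDiffer (_ ∷ _) [] = ⊤
  HeadsDiffer (a ∷ _) (b ∷ _) = a ≢ b

  NonBacktracking-arms : ∀ {u} A B → NonBacktracking (u ∷ A) → NonBacktracking (u ∷ B) → HeadsDiffer A B → NonBacktracking (A ʳ++ (u ∷ B))
  NonBacktracking-arms [] B _ nbB _ = nbB
  NonBacktracking-arms {u} (a ∷ A) B nbA nbB hd = NonBacktracking-arms A (u ∷ B) (NonBacktracking-tail _ nbA) (join B nbB hd) (hd′ A nbA)
    where
    join : ∀ B → NonBacktracking (u ∷ B) → HeadsDiffer (a ∷ A) B → NonBacktracking (a ∷ u ∷ B)
    join [] _ _ = ~-sym (NonBacktracking-edge A nbA)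
    join (b ∷ B) nb ne = ~-sym (NonBacktracking-edge A nbA) , ne , nb
    hd′ : ∀ A → NonBacktracking (u ∷ a ∷ A) → HeadsDiffer A (u ∷ B)
    hd′ [] _ = tt
    hd′ (a′ ∷ A) (_ , ne , _) = ne ∘ sym

  -- Cores stand in for cycles: they are easier to exhibit, and a region without cores is a forest.
  Core : List V → Set
  Core T = ∀ {t} → t ∈ T → ∃₂ λ a b → a ∈ T × b ∈ T × a ≢ b × t ~ a × t ~ b

  NoCore : (V → Set) → Set
  NoCore P = ∀ x T → (∀ {t} → t ∈ x ∷ T → P t) → Core (x ∷ T) → ⊥

  private
    nb-mid : ∀ p l x → NonBacktracking (p ∷ l ++ [ x ]) → ∀ {t} → t ∈ l →
      ∃₂ λ a b → a ∈ p ∷ l ++ [ x ] × b ∈ p ∷ l ++ [ x ] × a ≢ b × t ~ a × t ~ b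
    nb-mid p (t ∷ []) x (e , ne , e′) (here refl) =
      p , x , here refl , there (there (here refl)) , ne , ~-sym e , e′
    nb-mid p (t ∷ s ∷ l) x (e , ne , nb) (here refl) =
      p , s , here refl , there (there (here refl)) , ne , ~-sym e , NonBacktracking-edge (l ++ [ x ]) nb
    nb-mid p (s ∷ l) x nb (there q) with nb-mid s l x (NonBacktracking-tail (s ∷ l ++ [ x ]) nb) q
    ... | a , b , a∈ , b∈ , rest = a , b , there a∈ , there b∈ , rest

    nb-snoc : ∀ l {w x} → NonBacktracking (l ++ [ w ]) → w ~ x → ¬ x ∈ l → NonBacktracking (l ++ w ∷ x ∷ [])
    nb-snoc [] nb e _ = e
    nb-snoc (a ∷ []) nb e x∉ = nb , (λ p → x∉ (here (sym p))) , e
    nb-snoc (a ∷ b ∷ []) (e₁ , ne , nb) e x∉ = e₁ , ne , nb-snoc (b ∷ []) nb e (x∉ ∘ there)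
    nb-snoc (a ∷ b ∷ c ∷ l) (e₁ , ne , nb) e x∉ = e₁ , ne , nb-snoc (b ∷ c ∷ l) nb e (x∉ ∘ there)

  -- Going round from x and back to x is a non-backtracking walk, and each vertex inside such a walk
  -- has two distinct neighbours on it. Further neighbours of x on the path do no harm.
  cycle-core : ∀ x y l w → Induced (y ∷ l ++ [ w ]) → x ~ y → x ~ w → ¬ x ∈ (y ∷ l) → Core (x ∷ y ∷ l ++ [ w ])
  cycle-core x y l w ip xy xw x∉ (here refl) =
    y , w , there (here refl) , there (there (∈-++⁺ʳ l (here refl))) , Induced-ends-≢ l ip , xy , xw
  cycle-core x y l w ip xy xw x∉ (there q) with nb-mid x (y ∷ l ++ [ w ]) x nb q
    where
    close : ∀ l → NonBacktracking (y ∷ l ++ [ w ]) → ¬ x ∈ (y ∷ l) → NonBacktracking (x ∷ y ∷ (l ++ [ w ]) ++ [ x ])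
    close [] nb x∉ = xy , ~⇒≢ xw , nb-snoc (y ∷ []) nb (~-sym xw) x∉
    close (z ∷ l) nb x∉ = xy , (λ p → x∉ (there (here p))) ,
      subst (λ k → NonBacktracking (y ∷ z ∷ k)) (sym (++-assoc l [ w ] [ x ])) (nb-snoc (y ∷ z ∷ l) nb (~-sym xw) x∉)
    nb : NonBacktracking (x ∷ (y ∷ l ++ [ w ]) ++ [ x ])
    nb = close l (Induced⇒NonBacktracking _ ip) x∉
  ... | a , b , a∈ , b∈ , rest = a , b , fold a∈ , fold b∈ , rest
    where
    fold : ∀ {t} → t ∈ x ∷ (y ∷ l ++ [ w ]) ++ [ x ] → t ∈ x ∷ y ∷ l ++ [ w ]
    fold p with ∈-snoc (x ∷ y ∷ l ++ [ w ]) p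
    ... | inj₁ p′ = p′
    ... | inj₂ refl = here refl

  -- An edge from x to a later vertex closes a cycle, hence a core, with the path up to that vertex.
  -- Nor can x recur later, since y has no neighbour beyond z.
  Induced-extend : ∀ {P} → NoCore P → ∀ {x y z} l → (∀ {t} → t ∈ x ∷ y ∷ z ∷ l → P t) →
    x ~ y → x ≢ z → Induced (y ∷ z ∷ l) → Induced (x ∷ y ∷ z ∷ l)
  Induced-extend nc {x} {y} {z} l inP e x≢z ip = e , (λ p → distinct p , apart p) , ip
    where
    distinct : ∀ {w} → w ∈ z ∷ l → x ≢ w
    distinct (here refl) = x≢z
    distinct (there p) refl = proj₂ (proj₁ (proj₂ ip) p) (~-sym e)
    apart : ∀ {w} → w ∈ z ∷ l → ¬ x ~ w
    apart {w} p xw with ∈-∃++ p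
    ... | M , N , eq = nc x (y ∷ M ++ [ w ]) (λ q → inP (emb q))
      (cycle-core x y M w ipM e xw λ { (here refl) → ~⇒≢ e refl ; (there q) → distinct (subst (_ ∈_) (sym eq) (∈-++⁺ˡ q)) refl })
      where
      ipM : Induced (y ∷ M ++ [ w ])
      ipM = Induced-++ˡ (y ∷ M ++ [ w ]) (subst (λ k → Induced (y ∷ k)) (trans eq (sym (++-assoc M [ w ] N))) ip)
      emb : ∀ {t} → t ∈ x ∷ y ∷ M ++ [ w ] → t ∈ x ∷ y ∷ z ∷ l
      emb (here q) = here q
      emb (there (here q)) = there (here q)
      emb (there (there q)) = there (there (subst (_ ∈_) (trans (++-assoc M [ w ] N) (sym eq)) (∈-++⁺ˡ q)))

  NonBacktracking⇒Induced : ∀ {P} → NoCore P → ∀ l → (∀ {t} → t ∈ l → P t) → NonBacktracking l → Induced l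
  NonBacktracking⇒Induced nc [] _ _ = tt
  NonBacktracking⇒Induced nc (x ∷ []) _ _ = tt
  NonBacktracking⇒Induced nc (x ∷ y ∷ []) _ e = e , (λ ()) , tt
  NonBacktracking⇒Induced nc (x ∷ y ∷ z ∷ l) inP (e , x≢z , nb) =
    Induced-extend nc l inP e x≢z (NonBacktracking⇒Induced nc (y ∷ z ∷ l) (inP ∘ there) nb)

  -- Shortening walks to induced paths

  Walk : List V → Set
  Walk [] = ⊤
  Walk (x ∷ []) = ⊤
  Walk (x ∷ y ∷ l) = x ~ y × Walk (y ∷ l)

  Induced⇒Walk : ∀ l → Induced l → Walk l
  Induced⇒Walk [] _ = tt
  Induced⇒Walk (x ∷ []) _ = tt
  Induced⇒Walk (x ∷ y ∷ l) (e , _ , ip) = e , Induced⇒Walk (y ∷ l) ip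

  Walk-++ˡ : ∀ l {m} → Walk (l ++ m) → Walk l
  Walk-++ˡ [] _ = tt
  Walk-++ˡ (x ∷ []) _ = tt
  Walk-++ˡ (x ∷ y ∷ l) (e , wk) = e , Walk-++ˡ (y ∷ l) wk

  neighbour-in? : ∀ x (l : List V) → Dec (∃ λ z → z ∈ l × x ~ z)
  neighbour-in? x [] = no λ { (_ , () , _) }
  neighbour-in? x (y ∷ l) with x ~? y | neighbour-in? x l
  ... | yes e | _ = yes (y , here refl , e)
  ... | no _ | yes (z , p , e) = yes (z , there p , e)
  ... | no ne | no none = no λ { (_ , here refl , e) → ne e ; (z , there p , e) → none (z , p , e) }

  first-neighbour : ∀ x l → (∃ λ z → z ∈ l × x ~ z) →
    ∃ λ A → ∃₂ λ z B → l ≡ A ++ z ∷ B × x ~ z × (∀ {y} → y ∈ A → ¬ x ~ y)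
  first-neighbour x (y ∷ l) (z , p , e) with x ~? y
  ... | yes e′ = [] , y , l , refl , e′ , λ ()
  first-neighbour x (y ∷ l) (z , here refl , e) | no ne = ⊥-elim (ne e)
  first-neighbour x (y ∷ l) (z , there p , e) | no ne with first-neighbour x l (z , p , e)
  ... | A , z′ , B , eq , e′ , none =
    y ∷ A , z′ , B , cong (y ∷_) eq , e′ , λ { (here refl) → ne ; (there q) → none q }

  private
    successor : ∀ q {v} x → Induced (q ++ [ v ]) → x ∈ q → ∃ λ z → z ∈ q ++ [ v ] × x ~ z
    successor (y ∷ []) {v} .y (e , _) (here refl) = v , there (here refl) , e
    successor (y ∷ y′ ∷ q) .y (e , _) (here refl) = y′ , there (here refl) , e
    successor (y ∷ q) x ip (there p) with successor q x (Induced-tail _ ip) p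
    ... | z , z∈ , e = z , there z∈ , e

    -- The path is entered at the last neighbour of x, so no chord from x remains. If x already lies
    -- on the path, `successor` shows that a later neighbour exists.
    attach : ∀ x q v → Induced (q ++ [ v ]) → x ≢ v → (∃ λ z → z ∈ q ++ [ v ] × x ~ z) →
      ∃ λ l → Induced (x ∷ l ++ [ v ]) × (∀ {t} → t ∈ l → t ∈ q) × length l ≤ length q
    attach x [] v ip x≢v (z , here refl , e) = [] , (e , (λ ()) , tt) , (λ ()) , z≤n
    attach x (y ∷ m) v ip x≢v (z , z∈ , e) with neighbour-in? x (m ++ [ v ])
    ... | yes nb with attach x m v (Induced-tail _ ip) x≢v nb
    ...   | l , ip′ , sub , le = l , ip′ , there ∘ sub , ℕ.m≤n⇒m≤1+n le
    attach x (y ∷ m) v ip x≢v (z , there z∈ , e) | no none = ⊥-elim (none (z , z∈ , e))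
    attach x (y ∷ m) v ip x≢v (z , here refl , e) | no none = y ∷ m , (e , non , ip) , id , ℕ.≤-refl
      where
      non : NonAll x (m ++ [ v ])
      non {t} p = (λ { refl → [ (λ q → none (successor m x (Induced-tail _ ip) q)) , x≢v ]′ (∈-snoc m p) }) ,
        λ e → none (t , p , e)

  shortcut : ∀ {v} x l → Walk (x ∷ l ++ [ v ]) → x ≢ v →
    ∃ λ l′ → Induced (x ∷ l′ ++ [ v ]) × (∀ {t} → t ∈ l′ → t ∈ l) × length l′ ≤ length l
  shortcut x [] (e , _) _ = [] , (e , (λ ()) , tt) , (λ ()) , z≤n
  shortcut {v} x (y ∷ l) (e , wk) x≢v with y ≟ v
  ... | yes refl = [] , (e , (λ ()) , tt) , (λ ()) , z≤n
  ... | no y≢v with shortcut y l wk y≢v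
  ...   | l₁ , ip , sub , le with attach x (y ∷ l₁) v ip x≢v (y , here refl , e)
  ...     | l₂ , ip′ , sub′ , le′ = l₂ , ip′ , (λ p → lift (sub′ p)) , ℕ.≤-trans le′ (s≤s le)
    where
    lift : ∀ {t} → t ∈ y ∷ l₁ → t ∈ y ∷ l
    lift (here q) = here q
    lift (there q) = there (sub q)

  -- The two consequences of linear balanceability, and the split into X, D and C

  record OddThetaFree : Set where
    field
      col    : V → Bool
      proper : ∀ {u v} → u ~ v → col u ≢ col v
      no-4-cycle : ∀ {u v x y} → u ≢ v → x ≢ y → u ~ x → u ~ y → v ~ x → v ~ y → ⊥
      theta  : ∀ {u v} A B D → A ≢ [] → B ≢ [] → D ≢ [] → ¬ u ~ v → col u ≢ col v →
        Induced (u ∷ A ++ [ v ]) → Induced (u ∷ B ++ [ v ]) → Induced (u ∷ D ++ [ v ]) →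
        Anti A B → Anti A D → Anti B D → ⊥

  -- D is the neighbourhood of a connected set X, along which `link` runs, and C lies beyond D.
  record Split : Set₁ where
    field
      C D    : V → Set
      D?     : ∀ v → Dec (D v)
      C⇒¬D   : ∀ {v} → C v → ¬ D v
      nbr    : ∀ {v u} → C v → v ~ u → C u ⊎ D u
      deg≥3  : ∀ {v} → C v → ∀ p q → ∃ λ u → v ~ u × u ≢ p × u ≢ q
      link   : ∀ {c e} → D c → D e → c ≢ e → ¬ c ~ e →
        ∃ λ R → Induced (c ∷ R ++ [ e ]) × (∀ {r v} → r ∈ R → C v → Non r v)
      forest : ∀ {b} → D b → NoCore (λ v → C v × ¬ b ~ v)

  -- Sectors, escapes through X and endless branches

  module Sectors (free : OddThetaFree) (split : Split) where
    open OddThetaFree free public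
    open Split split public

    C≢D : ∀ {u v} → C u → D v → u ≢ v
    C≢D c d refl = C⇒¬D c d

    D≢C : ∀ {u v} → D u → C v → u ≢ v
    D≢C d c refl = C⇒¬D c d

    same-colour : ∀ {u v w} → u ~ v → u ~ w → col v ≡ col w
    same-colour e f = two-colours (proper e) (proper f)

    -- A hole through e whose other vertices lie in C, read from m in both directions; m and e are
    -- the prospective ends of an odd theta that lacks only its third path.
    record Sector (e m : V) (L R : List V) : Set where
      field
        ipL  : Induced (m ∷ L ++ [ e ])
        ipR  : Induced (m ∷ R ++ [ e ])
        L≢[] : L ≢ []
        R≢[] : R ≢ []
        anti : Anti L R
        m≁e  : ¬ m ~ e
        m≠e  : col m ≢ col e
        inC  : ∀ {t} → t ∈ m ∷ L ++ R → C t

      inL : ∀ {t} → t ∈ L → C t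
      inL = inC ∘ there ∘ ∈-++⁺ˡ

      inR : ∀ {t} → t ∈ R → C t
      inR = inC ∘ there ∘ ∈-++⁺ʳ L

    Sector-swap : ∀ {e m L R} → Sector e m L R → Sector e m R L
    Sector-swap {L = L} {R} S = record
      { ipL = ipR ; ipR = ipL ; L≢[] = R≢[] ; R≢[] = L≢[] ; anti = Anti-sym anti ; m≁e = m≁e ; m≠e = m≠e
      ; inC = λ { (here p) → inC (here p) ; (there p) → [ inR , inL ]′ (∈-++⁻ R p) } }
      where open Sector S

    third-arm : ∀ {e m L R} → Sector e m L R → ∀ Q → Q ≢ [] → Induced (e ∷ Q ++ [ m ]) → Anti L Q → Anti R Q → ⊥
    third-arm {L = L} {R} S Q Q≢ ip aL aR =
      theta L R (reverse Q) L≢[] R≢[] (Q≢ ∘ rev-[] Q) m≁e m≠e ipL ipR (Induced-flip Q ip) anti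
        (λ p q → aL p (reverse⁻ q)) (λ p q → aR p (reverse⁻ q))
      where
      open Sector S
      rev-[] : ∀ Q → reverse Q ≡ [] → Q ≡ []
      rev-[] [] _ = refl
      rev-[] (x ∷ Q) eq with reverse Q | unfold-reverse x Q
      ... | [] | eq′ = ⊥-elim (absurd (trans (sym eq) eq′))
        where absurd : ¬ [] ≡ [ x ]
              absurd ()
      ... | _ ∷ _ | eq′ = ⊥-elim (absurd (trans (sym eq) eq′))
        where absurd : ∀ {y : V} {l} → ¬ [] ≡ y ∷ l
              absurd ()

    -- A path from m to a vertex z of D continues through X to e and completes an odd theta with ends m and e.
    escape : ∀ {e m L R} → Sector e m L R → D e → ∀ K z → Induced (z ∷ K ++ [ m ]) →
      (∀ {t} → t ∈ K → C t × ¬ e ~ t) → Anti L K → Anti R K →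
      D z → z ≢ e → NonAll z L → NonAll z R → ⊥
    escape {e} {m} {L} {R} S De K z ip inK aL aR Dz z≢e zL zR with e ~? z
    ... | yes e~z = third-arm S (z ∷ K) (λ ()) (e~z , eK , ip)
        (Anti-sym (Anti-∷ zL (Anti-sym aL))) (Anti-sym (Anti-∷ zR (Anti-sym aR)))
      where
      open Sector S
      eK : NonAll e (K ++ [ m ])
      eK p with ∈-snoc K p
      ... | inj₁ q = D≢C De (proj₁ (inK q)) , proj₂ (inK q)
      ... | inj₂ refl = D≢C De (inC (here refl)) , m≁e ∘ ~-sym
    ... | no e≁z with link De Dz (z≢e ∘ sym) e≁z
    ...   | X , ipX , sep = third-arm S (X ++ z ∷ K) (nonempty X)
        (subst (λ l → Induced (e ∷ l)) (sym (++-assoc X (z ∷ K) [ m ])) (Induced-++ (e ∷ X) (K ++ [ m ]) ipX ip aX))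
        (λ p q → cross inL zL aL p q) (λ p q → cross inR zR aR p q)
      where
      open Sector S
      nonempty : ∀ X → X ++ z ∷ K ≢ []
      nonempty [] ()
      nonempty (_ ∷ _) ()
      aX : Anti (e ∷ X) (K ++ [ m ])
      aX p q with ∈-snoc K q
      aX (here refl) q | inj₁ q′ = D≢C De (proj₁ (inK q′)) , proj₂ (inK q′)
      aX (there p) q | inj₁ q′ = sep p (proj₁ (inK q′))
      aX (here refl) q | inj₂ refl = D≢C De (inC (here refl)) , m≁e ∘ ~-sym
      aX (there p) q | inj₂ refl = sep p (inC (here refl))
      cross : ∀ {A} → (∀ {t} → t ∈ A → C t) → NonAll z A → Anti A K → Anti A (X ++ z ∷ K)
      cross cA zA aA p q with ∈-++⁻ X q
      ... | inj₁ q′ = Non-sym (sep q′ (cA p))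
      ... | inj₂ (here refl) = Non-sym (zA p)
      ... | inj₂ (there q′) = aA p q′

    -- Here z lies in C and is seen by another vertex b of D. Either e sees z and closes the third
    -- path at once, or the path is prolonged to b and `escape` takes over from there.
    escape-via : ∀ {e m L R} → Sector e m L R → D e → ∀ {b} → D b → b ≢ e →
      (∀ {t} → t ∈ m ∷ L ++ R → ¬ b ~ t) →
      ∀ K z → Induced (z ∷ K ++ [ m ]) →
      (∀ {t} → t ∈ K → C t × ¬ e ~ t × ¬ b ~ t) → Anti L K → Anti R K →
      C z → b ~ z → NonAll z L → NonAll z R → ⊥
    escape-via {e} {m} {L} {R} S De {b} Db b≢e b≁ K z ip inK aL aR Cz b~z zL zR with e ~? z
    ... | yes e~z = third-arm S (z ∷ K) (λ ()) (e~z , eK , ip)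
        (Anti-sym (Anti-∷ zL (Anti-sym aL))) (Anti-sym (Anti-∷ zR (Anti-sym aR)))
      where
      open Sector S
      eK : NonAll e (K ++ [ m ])
      eK p with ∈-snoc K p
      ... | inj₁ q = D≢C De (proj₁ (inK q)) , proj₁ (proj₂ (inK q))
      ... | inj₂ refl = D≢C De (inC (here refl)) , m≁e ∘ ~-sym
    ... | no e≁z = escape S De (z ∷ K) b (b~z , bK , ip)
        (λ { (here refl) → Cz , e≁z ; (there p) → proj₁ (inK p) , proj₁ (proj₂ (inK p)) })
        (Anti-sym (Anti-∷ zL (Anti-sym aL))) (Anti-sym (Anti-∷ zR (Anti-sym aR)))
        Db b≢e
        (λ p → D≢C Db (inL p) , b≁ (there (∈-++⁺ˡ p))) (λ p → D≢C Db (inR p) , b≁ (there (∈-++⁺ʳ L p)))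
      where
      open Sector S
      bK : NonAll b (K ++ [ m ])
      bK p with ∈-snoc K p
      ... | inj₁ q = D≢C Db (proj₁ (inK q)) , proj₂ (proj₂ (inK q))
      ... | inj₂ refl = D≢C Db (inC (here refl)) , b≁ (here refl)

    -- A neighbour of a vertex of C lies outside the region C without N(b) exactly when it is a
    -- contact.
    Contact : V → V → Set
    Contact b z = D z ⊎ (C z × b ~ z)

    -- A walk starting with m, w can be continued forever inside the forest C \ N(b), because each of its vertices
    -- has at most one neighbour that is a contact or adjacent to e: such neighbours are all adjacent to r, or all to e.
    module Branch {b e m : V} {L R : List V} (Db : D b) (De : D e) (b≢e : b ≢ e) (S : Sector e m L R)
      (b≁ : ∀ {t} → t ∈ m ∷ L ++ R → ¬ b ~ t) {r : V} (r∈R : r ∈ R) (e~r : e ~ r)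
      (only : ∀ {z s} → Contact b z → z ≢ e → s ∈ m ∷ L ++ R → z ~ s → s ≡ r) where

      private
        open Sector S

        P : V → Set
        P v = C v × ¬ b ~ v

        inP : ∀ {t} → t ∈ m ∷ L ++ R → P t
        inP p = inC p , b≁ p

        record State (v : V) (K : List V) : Set where
          field
            nbL : NonBacktracking ((v ∷ K) ++ m ∷ L)
            nbR : NonBacktracking ((v ∷ K) ++ m ∷ R)
            inK : ∀ {t} → t ∈ v ∷ K → P t × ¬ e ~ t
            inv : ∀ {z d} → Contact b z → z ≢ e → d ∈ K → z ~ d → z ~ r

        module Step {v K} (st : State v K) where
          open State st

          ip-with : ∀ A → (∀ {t} → t ∈ m ∷ A → P t) → NonBacktracking ((v ∷ K) ++ m ∷ A) → Induced ((v ∷ K) ++ m ∷ A)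
          ip-with A pA = NonBacktracking⇒Induced (forest Db) ((v ∷ K) ++ m ∷ A) ([ proj₁ ∘ inK , pA ]′ ∘ ∈-++⁻ (v ∷ K))

          ipKL : Induced ((v ∷ K) ++ m ∷ L)
          ipKL = ip-with L (λ { (here p) → inP (here p) ; (there p) → inP (there (∈-++⁺ˡ p)) }) nbL

          ipKR : Induced ((v ∷ K) ++ m ∷ R)
          ipKR = ip-with R (λ { (here p) → inP (here p) ; (there p) → inP (there (∈-++⁺ʳ L p)) }) nbR

          aL : Anti L (v ∷ K)
          aL = Anti-sym (Induced-++-Anti (v ∷ K) ipKL)

          aR : Anti R (v ∷ K)
          aR = Anti-sym (Induced-++-Anti (v ∷ K) ipKR)

          ipK : Induced ((v ∷ K) ++ [ m ])
          ipK = Induced-++ˡ ((v ∷ K) ++ [ m ]) (subst Induced (sym (++-assoc (v ∷ K) [ m ] L)) ipKL)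

          bound : length (v ∷ K) ≤ n
          bound = Induced-length (v ∷ K) (Induced-++ˡ (v ∷ K) ipK)

          Cv : C v
          Cv = proj₁ (proj₁ (inK (here refl)))

          -- A contact at the tip v that sees an earlier vertex of the walk falls under the
          -- invariant, and one that sees the sector sees r by `only`. One that sees neither
          -- completes an odd theta.
          contact-r : ∀ {z} → Contact b z → z ≢ e → z ~ v → z ~ r
          contact-r {z} ct z≢e z~v with neighbour-in? z K
          ... | yes (d , p , e′) = inv ct z≢e p e′
          ... | no none with neighbour-in? z (m ∷ L ++ R)
          ...   | yes (s , p , e′) = subst (z ~_) (only ct z≢e p e′) e′
          contact-r {z} (inj₁ Dz) z≢e z~v | no none | no none′ =
            ⊥-elim (escape S De (v ∷ K) z (z~v , zK , ipK) (λ p → proj₁ (proj₁ (inK p)) , proj₂ (inK p)) aL aR Dz z≢e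
              (λ p → D≢C Dz (inL p) , λ e′ → none′ (_ , there (∈-++⁺ˡ p) , e′))
              (λ p → D≢C Dz (inR p) , λ e′ → none′ (_ , there (∈-++⁺ʳ L p) , e′)))
            where
            zK : NonAll z (K ++ [ m ])
            zK p with ∈-snoc K p
            ... | inj₁ q = D≢C Dz (proj₁ (proj₁ (inK (there q)))) , λ e′ → none (_ , q , e′)
            ... | inj₂ refl = D≢C Dz (inC (here refl)) , λ e′ → none′ (_ , here refl , e′)
          contact-r {z} (inj₂ (Cz , b~z)) z≢e z~v | no none | no none′ =
            ⊥-elim (escape-via S De Db b≢e b≁ (v ∷ K) z (z~v , zK , ipK)
              (λ p → proj₁ (proj₁ (inK p)) , proj₂ (inK p) , proj₂ (proj₁ (inK p))) aL aR Cz b~z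
              (λ p → ≢b (b≁ (there (∈-++⁺ˡ p))) , λ e′ → none′ (_ , there (∈-++⁺ˡ p) , e′))
              (λ p → ≢b (b≁ (there (∈-++⁺ʳ L p))) , λ e′ → none′ (_ , there (∈-++⁺ʳ L p) , e′)))
            where
            ≢b : ∀ {t} → ¬ b ~ t → z ≢ t
            ≢b b≁t refl = b≁t b~z
            zK : NonAll z (K ++ [ m ])
            zK p with ∈-snoc K p
            ... | inj₁ q = ≢b (proj₂ (proj₁ (inK (there q)))) , λ e′ → none (_ , q , e′)
            ... | inj₂ refl = ≢b (b≁ (here refl)) , λ e′ → none′ (_ , here refl , e′)

          Good : V → Set
          Good u = P u × ¬ e ~ u

          Bad : V → Set
          Bad u = Contact b u ⊎ e ~ u

          sort : ∀ u → v ~ u → Good u ⊎ Bad u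
          sort u v~u with nbr Cv v~u | e ~? u | b ~? u
          ... | inj₂ Du | _ | _ = inj₂ (inj₁ (inj₁ Du))
          ... | inj₁ _ | yes e~u | _ = inj₂ (inj₂ e~u)
          ... | inj₁ Cu | no _ | yes b~u = inj₂ (inj₁ (inj₂ (Cu , b~u)))
          ... | inj₁ Cu | no e≁u | no b≁u = inj₁ ((Cu , b≁u) , e≁u)

          -- Contacts at v share the colour of e, because both are adjacent to r, while neighbours
          -- of e have the other colour. So the colour of v decides which of e and r is the common
          -- neighbour.
          bad-target : ∀ {u} → v ~ u → Bad u → (col v ≡ col e → e ~ u) × (col v ≢ col e → r ~ u)
          bad-target v~u (inj₂ e~u) = (λ _ → e~u) , λ ne → ⊥-elim (three-colours ne (proper v~u) (proper e~u))
          bad-target {u} v~u (inj₁ ct) =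
            (λ eq → ⊥-elim (three-colours (proper (~-sym u~r) ∘ sym) (λ p → proper v~u (trans eq (sym p))) (proper e~r ∘ sym))) ,
            λ _ → ~-sym u~r
            where
            u~r : u ~ r
            u~r = contact-r ct (λ { refl → proj₂ (inK (here refl)) (~-sym v~u) }) (~-sym v~u)

          -- The vertex v and the common target, e or r, would form a 4-cycle with u and u′.
          two-bad : ∀ {u u′} → u ≢ u′ → v ~ u → v ~ u′ → Bad u → Bad u′ → ⊥
          two-bad ne v~u v~u′ bu bu′ with col v Bool.≟ col e
          ... | yes eq = no-4-cycle (C≢D Cv De) ne v~u v~u′ (proj₁ (bad-target v~u bu) eq) (proj₁ (bad-target v~u′ bu′) eq)
          ... | no neq = no-4-cycle (λ { refl → proj₁ (aR r∈R (here refl)) refl }) ne v~u v~u′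
            (proj₂ (bad-target v~u bu) neq) (proj₂ (bad-target v~u′ bu′) neq)

          -- Besides p there are two further neighbours, and at most one of them is bad.
          next-good : ∀ p → ∃ λ u → v ~ u × u ≢ p × Good u
          next-good p with deg≥3 Cv p p
          ... | u , v~u , u≢p , _ with sort u v~u
          ...   | inj₁ good = u , v~u , u≢p , good
          ...   | inj₂ bad with deg≥3 Cv p u
          ...     | u′ , v~u′ , u′≢p , u′≢u with sort u′ v~u′
          ...       | inj₁ good = u′ , v~u′ , u′≢p , good
          ...       | inj₂ bad′ = ⊥-elim (two-bad (u′≢u ∘ sym) v~u v~u′ bad bad′)

          previous : List V → V
          previous [] = m
          previous (d ∷ _) = d

          grow : ∀ {u} K A → v ~ u → u ≢ previous K → NonBacktracking ((v ∷ K) ++ m ∷ A) → NonBacktracking ((u ∷ v ∷ K) ++ m ∷ A)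
          grow [] A e ne nb = ~-sym e , ne , nb
          grow (d ∷ K) A e ne nb = ~-sym e , ne , nb

          advance : ∃ λ u → State u (v ∷ K)
          advance with next-good (previous K)
          ... | u , v~u , u≢p , good = u , record
            { nbL = grow K L v~u u≢p nbL
            ; nbR = grow K R v~u u≢p nbR
            ; inK = λ { (here refl) → good ; (there p) → inK p }
            ; inv = λ { ct ne (here refl) e′ → contact-r ct ne e′ ; ct ne (there p) e′ → inv ct ne p e′ } }

        -- When the fuel k is spent, K has at least n vertices, so the induced path `v ∷ K` has more
        -- than n.
        run : ∀ k v K → n ≤ k + length K → State v K → ⊥
        run zero v K le st = ℕ.<⇒≱ (Step.bound st) le
        run (suc k) v K le st with Step.advance st
        ... | u , st′ = run k u (v ∷ K) (subst (n ≤_) (sym (ℕ.+-suc k (length K))) le) st′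

      no-branch : ∀ w → m ~ w → C w → ¬ b ~ w → ¬ e ~ w → HeadsDiffer [ w ] L → HeadsDiffer [ w ] R → ⊥
      no-branch w m~w Cw b≁w e≁w hL hR = run n w [] (ℕ.m≤m+n n 0) record
        { nbL = start L (Induced-++ˡ (m ∷ L) ipL) hL
        ; nbR = start R (Induced-++ˡ (m ∷ R) ipR) hR
        ; inK = λ { (here refl) → (Cw , b≁w) , e≁w }
        ; inv = λ { _ _ () } }
        where
        start : ∀ A → Induced (m ∷ A) → HeadsDiffer [ w ] A → NonBacktracking (w ∷ m ∷ A)
        start [] _ _ = ~-sym m~w
        start (a ∷ A) ip ne = ~-sym m~w , ne , Induced⇒NonBacktracking (m ∷ a ∷ A) ip

    sector-at : ∀ {e m} A B → Induced (A ʳ++ (m ∷ B)) → Rim e (A ʳ++ (m ∷ B)) → A ≢ [] → B ≢ [] → col m ≢ col e →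
      (∀ {t} → t ∈ A ʳ++ (m ∷ B) → C t) → Sector e m A B
    sector-at [] B _ _ A≢ _ _ _ = ⊥-elim (A≢ refl)
    sector-at A [] _ _ _ B≢ _ _ = ⊥-elim (B≢ refl)
    sector-at {e} {m} A@(a ∷ A′) B@(b ∷ B′) ip rim A≢ B≢ m≠e inC
      with Induced-unarms A B ip | Rim-unarms A (m ∷ B) rim A≢ (λ ())
    ... | ipA , ipB , anti | clA , (nm , clB) = record
      { ipL = Induced-close (m ∷ A) ipA (nm , clA)
      ; ipR = Induced-close (m ∷ B) ipB (nm , clB)
      ; L≢[] = A≢ ; R≢[] = B≢ ; anti = anti ; m≁e = proj₂ nm ∘ ~-sym ; m≠e = m≠e
      ; inC = λ { (here refl) → inC (∈-ʳ++⁺ʳ A (here refl))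
                ; (there p) → [ inC ∘ ∈-ʳ++⁺ˡ A , inC ∘ ∈-ʳ++⁺ʳ A ∘ there ]′ (∈-++⁻ A p) } }

    -- The same hole read from another vertex t of the colour of m, so that a vertex of D adjacent
    -- to t can be reached from the centre in one step.
    recentre : ∀ {e m L} A t B → Sector e m L (A ++ t ∷ B) → B ≢ [] → col t ≢ col e →
      Sector e t (A ʳ++ (m ∷ L)) B
    recentre {e} {m} {L} A t B S B≢ t≠e =
      sector-at (A ʳ++ (m ∷ L)) B (subst Induced shape ip) (subst (Rim e) shape rim) (nonempty A) B≢ t≠e
        (λ p → inAll (subst (_ ∈_) (sym shape) p))
      where
      open Sector S
      ws = L ʳ++ (m ∷ A ++ t ∷ B)
      shape : ws ≡ (A ʳ++ (m ∷ L)) ʳ++ (t ∷ B)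
      shape = sym (ʳ++-ʳ++ A)
      ip : Induced ws
      ip = Induced-arms L (A ++ t ∷ B) (Induced-++ˡ (m ∷ L) ipL) (Induced-++ˡ (m ∷ A ++ t ∷ B) ipR) anti
      rim : Rim e ws
      rim = Rim-arm L (m ∷ A ++ t ∷ B) (Induced-tail _ ipL) L≢[] (Closes-last m (A ++ t ∷ B) ipR m≁e R≢[])
      nonempty : ∀ A → A ʳ++ (m ∷ L) ≢ []
      nonempty A eq = absurd (subst (m ∈_) eq (∈-ʳ++⁺ʳ A (here refl)))
        where absurd : ¬ m ∈ []
              absurd ()
      inAll : ∀ {x} → x ∈ ws → C x
      inAll p = [ inL , (λ { (here q) → inC (here q) ; (there q) → inR q }) ]′ (∈-ʳ++⁻ L p)

    -- Rings: the hole of a shortest path, and the branches leaving it at w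

    -- The hole b, pL, Li, g, Ri, pR (both lists are read starting from g), and a neighbour w of g outside it.
    record Ring (b : V) : Set where
      field
        Db : D b
        {g w pL pR} : V
        {Li Ri} : List V

      L : List V
      L = Li ++ [ pL ]
      R : List V
      R = Ri ++ [ pR ]
      Y : List V
      Y = g ∷ L ++ R

      field
        S : Sector b g L R
        b~pL : b ~ pL
        b~pR : b ~ pR
        b≁Li : ∀ {t} → t ∈ Li → ¬ b ~ t
        b≁Ri : ∀ {t} → t ∈ Ri → ¬ b ~ t
        unique : ∀ {c s t} → D c → c ≢ b → s ∈ Y → t ∈ Y → s ≢ t → c ~ s → c ~ t → ⊥
        unmarked : ∀ {c s} → D c → s ∈ Y → ¬ b ~ s → col s ≢ col b → c ~ s → ⊥
        outer : ∀ {q s} → C q → b ~ q → ¬ q ∈ Y → s ∈ Y → ¬ b ~ s → q ~ s → ⊥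
        g~w : g ~ w
        Cw : C w
        b≁w : ¬ b ~ w
        wL : NonAll w L
        wR : NonAll w R
        cw : ∀ {c s} → D c → c ~ w → s ∈ Y → c ~ s → ⊥

      on-L : ∀ {t} → t ∈ L → t ∈ Y
      on-L = there ∘ ∈-++⁺ˡ

      on-R : ∀ {t} → t ∈ R → t ∈ Y
      on-R = there ∘ ∈-++⁺ʳ L

      on-g : g ∈ Y
      on-g = here refl

    Ring-swap : ∀ {b} → Ring b → Ring b
    Ring-swap Y = record
      { Db = Db ; S = Sector-swap S ; b~pL = b~pR ; b~pR = b~pL
      ; b≁Li = b≁Ri ; b≁Ri = b≁Li
      ; unique = λ Dc ne s∈ t∈ → unique Dc ne (turn s∈) (turn t∈)
      ; unmarked = λ Dc s∈ → unmarked Dc (turn s∈)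
      ; outer = λ Cq bq q∉ s∈ → outer Cq bq (q∉ ∘ turn′) (turn s∈)
      ; g~w = g~w ; Cw = Cw ; b≁w = b≁w ; wL = wR ; wR = wL
      ; cw = λ Dc e s∈ → cw Dc e (turn s∈) }
      where
      open Ring Y
      turn : ∀ {t} → t ∈ g ∷ R ++ L → t ∈ g ∷ L ++ R
      turn (here p) = here p
      turn (there p) = [ on-R , on-L ]′ (∈-++⁻ R p)
      turn′ : ∀ {t} → t ∈ g ∷ L ++ R → t ∈ g ∷ R ++ L
      turn′ (here p) = here p
      turn′ (there p) = [ there ∘ ∈-++⁺ʳ R , there ∘ ∈-++⁺ˡ ]′ (∈-++⁻ L p)

    module Contacts {b : V} (ring : Ring b) where
      open Ring ring public
      open Sector S public

      P : V → Set
      P v = C v × ¬ b ~ v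

      Cg : C g
      Cg = inC on-g

      inY : ∀ {t} → t ∈ Y → C t
      inY (here p) = inC (here p)
      inY (there p) = inC (there p)

      b≁g : ¬ b ~ g
      b≁g = m≁e ∘ ~-sym

      col-pL : col pL ≡ col g
      col-pL = two-colours (proper b~pL) (m≠e ∘ sym)

      col-pR : col pR ≡ col g
      col-pR = two-colours (proper b~pR) (m≠e ∘ sym)

      col-w : col w ≡ col b
      col-w = two-colours (proper g~w) m≠e

      g-unmarked : ∀ {z} → Contact b z → ¬ z ~ g
      g-unmarked (inj₁ Dz) e = unmarked Dz on-g b≁g m≠e e
      g-unmarked (inj₂ (_ , b~z)) e = three-colours (proper b~z) (m≠e ∘ sym) (proper e)

      off-ring : ∀ {q} → C q → b ~ q → ¬ q ∈ Y → ∀ {s} → s ∈ Y → Non q s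
      off-ring {q} Cq b~q q∉ {s} s∈ = (λ { refl → q∉ s∈ }) , nonadjacent
        where
        nonadjacent : ¬ q ~ s
        nonadjacent e with b ~? s
        ... | yes b~s = three-colours (proper b~q) (proper b~s) (proper e)
        ... | no b≁s = outer Cq b~q q∉ s∈ b≁s e

      -- The path from g through K to z goes on to b and is a third path between g and b, because
      -- `off-ring` keeps z away from both arms.
      no-direct-exit : ∀ K z → Induced (z ∷ K ++ [ g ]) → (∀ {t} → t ∈ K → P t) → Anti L K → Anti R K →
        C z → b ~ z → ¬ z ∈ Y → ⊥
      no-direct-exit K z ip inK aL aR Cz b~z z∉ =
        third-arm S (z ∷ K) (λ ()) (b~z , bK , ip)
          (Anti-sym (Anti-∷ (λ p → off-ring Cz b~z z∉ (on-L p)) (Anti-sym aL)))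
          (Anti-sym (Anti-∷ (λ p → off-ring Cz b~z z∉ (on-R p)) (Anti-sym aR)))
        where
        bK : NonAll b (K ++ [ g ])
        bK p with ∈-snoc K p
        ... | inj₁ q = D≢C Db (proj₁ (inK q)) , proj₂ (inK q)
        ... | inj₂ refl = D≢C Db Cg , b≁g

      -- If z saw neither arm, the path from g to z could be continued to b, if necessary through X,
      -- and would complete an odd theta.
      mark-on-ring : ∀ K z → Induced (z ∷ K ++ [ g ]) → (∀ {t} → t ∈ K → P t) → Anti L K → Anti R K →
        D z → z ≢ b → ∃ λ s → s ∈ L ++ R × z ~ s
      mark-on-ring K z ip inK aL aR Dz z≢b with neighbour-in? z (L ++ R)
      ... | yes found = found
      ... | no none = ⊥-elim (escape S Db K z ip inK aL aR Dz z≢b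
        (λ p → D≢C Dz (inL p) , λ e → none (_ , ∈-++⁺ˡ p , e))
        (λ p → D≢C Dz (inR p) , λ e → none (_ , ∈-++⁺ʳ L p , e)))

      -- A contact at w is reached from g through w alone. In D it would have to see an arm, against
      -- `cw`; in N(b) it would be a direct exit.
      w-free : ∀ {z} → Contact b z → ¬ z ~ w
      w-free (inj₁ Dz) e =
        let z≢b = λ { refl → b≁w e }
            s , s∈ , e′ = mark-on-ring [ w ] _ (e , (λ { (here refl) → D≢C Dz Cg , g-unmarked (inj₁ Dz) }) , (~-sym g~w , (λ ()) , tt))
              (λ { (here refl) → Cw , b≁w }) (λ { p (here refl) → Non-sym (wL p) }) (λ { p (here refl) → Non-sym (wR p) }) Dz z≢b
        in cw Dz e (there s∈) e′
      w-free {z} (inj₂ (Cz , b~z)) e =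
        no-direct-exit [ w ] _ (e , (λ { (here refl) → (λ { refl → b≁g b~z }) , g-unmarked (inj₂ (Cz , b~z)) }) , (~-sym g~w , (λ ()) , tt))
          (λ { (here refl) → Cw , b≁w }) (λ { p (here refl) → Non-sym (wL p) }) (λ { p (here refl) → Non-sym (wR p) }) Cz b~z off
        where
        off : ¬ z ∈ Y
        off (here refl) = b≁g b~z
        off (there p) = [ (λ q → proj₂ (wL q) (~-sym e)) , (λ q → proj₂ (wR q) (~-sym e)) ]′ (∈-++⁻ L p)

      contact? : ∀ v → Dec (∃ λ z → (D z ⊎ b ~ z) × z ~ v)
      contact? v = any? λ z → (D? z ⊎-dec (b ~? z)) ×-dec (z ~? v)

      -- A branch from w through x, listed backwards and stopped at the first vertex v that has a
      -- contact as neighbour. It is recorded together with `Li` and `Ri` but without pL and pR,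
      -- because these are neighbours of b and lie outside the forest.
      record FirstContact (x : V) : Set where
        field
          {v} : V
          {K} : List V
          start : ∃ λ K₀ → v ∷ K ≡ K₀ ++ [ x ]
          nbL : NonBacktracking ((v ∷ K) ++ w ∷ g ∷ Li)
          nbR : NonBacktracking ((v ∷ K) ++ w ∷ g ∷ Ri)
          inP : ∀ {t} → t ∈ v ∷ K → P t
          clear : ∀ {z d} → Contact b z → d ∈ K → ¬ z ~ d
          contact : ∃ λ z → Contact b z × z ~ v

      private
        Li-in : ∀ {t} → t ∈ w ∷ g ∷ Li → P t
        Li-in (here refl) = Cw , b≁w
        Li-in (there (here refl)) = Cg , b≁g
        Li-in (there (there p)) = inL (∈-++⁺ˡ p) , b≁Li p

        Ri-in : ∀ {t} → t ∈ w ∷ g ∷ Ri → P t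
        Ri-in (here refl) = Cw , b≁w
        Ri-in (there (here refl)) = Cg , b≁g
        Ri-in (there (there p)) = inR (∈-++⁺ˡ p) , b≁Ri p

        forest-Induced : ∀ K A → (∀ {t} → t ∈ K → P t) → (∀ {t} → t ∈ A → P t) → NonBacktracking (K ++ A) → Induced (K ++ A)
        forest-Induced K A inK inA = NonBacktracking⇒Induced (forest Db) (K ++ A) ([ inK , inA ]′ ∘ ∈-++⁻ K)

        previous : List V → V
        previous [] = w
        previous (d ∷ _) = d

        grow : ∀ {u v} K A → v ~ u → u ≢ previous K → NonBacktracking ((v ∷ K) ++ w ∷ A) → NonBacktracking ((u ∷ v ∷ K) ++ w ∷ A)
        grow [] A e ne nb = ~-sym e , ne , nb
        grow (d ∷ K) A e ne nb = ~-sym e , ne , nb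

      -- As long as no contact is adjacent, every continuation remains in the forest C without N(b),
      -- so a contact must appear before the path exceeds n vertices.
      first-contact : ∀ x → w ~ x → x ≢ g → P x → FirstContact x
      first-contact x w~x x≢g Px = go n x [] (ℕ.m≤m+n n 0) ([] , refl)
        (~-sym w~x , x≢g , nbw Li (Induced-++ˡ (g ∷ Li) (subst Induced (cong (g ∷_) (++-assoc Li [ pL ] [ b ])) ipL)) (λ p → wL (∈-++⁺ˡ p)))
        (~-sym w~x , x≢g , nbw Ri (Induced-++ˡ (g ∷ Ri) (subst Induced (cong (g ∷_) (++-assoc Ri [ pR ] [ b ])) ipR)) (λ p → wR (∈-++⁺ˡ p)))
        (λ { (here refl) → Px }) (λ _ ())
        where
        nbw : ∀ A → Induced (g ∷ A) → NonAll w A → NonBacktracking (w ∷ g ∷ A)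
        nbw [] _ _ = ~-sym g~w
        nbw (a ∷ A) ip non = ~-sym g~w , proj₁ (non (here refl)) , Induced⇒NonBacktracking (g ∷ a ∷ A) ip
        go : ∀ k v K → n ≤ k + length K → (∃ λ K₀ → v ∷ K ≡ K₀ ++ [ x ]) →
          NonBacktracking ((v ∷ K) ++ w ∷ g ∷ Li) → NonBacktracking ((v ∷ K) ++ w ∷ g ∷ Ri) → (∀ {t} → t ∈ v ∷ K → P t) →
          (∀ {z d} → Contact b z → d ∈ K → ¬ z ~ d) → FirstContact x
        go k v K le st nl nr inP clear with contact? v
        ... | yes (z , ct , e) = record { start = st ; nbL = nl ; nbR = nr ; inP = inP ; clear = clear ; contact = z , ct′ ct , e }
          where
          ct′ : D z ⊎ b ~ z → Contact b z
          ct′ (inj₁ Dz) = inj₁ Dz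
          ct′ (inj₂ b~z) with nbr (proj₁ (inP (here refl))) (~-sym e)
          ... | inj₁ Cz = inj₂ (Cz , b~z)
          ... | inj₂ Dz = inj₁ Dz
        go zero v K le st nl nr inP clear | no none =
          ⊥-elim (ℕ.<⇒≱ (Induced-length (v ∷ K) (Induced-++ˡ (v ∷ K) (forest-Induced (v ∷ K) (w ∷ g ∷ Li) inP Li-in nl))) le)
        go (suc k) v K le (K₀ , eq) nl nr inP clear | no none with deg≥3 (proj₁ (inP (here refl))) (previous K) (previous K)
        ... | u , v~u , u≢p , _ = go k u (v ∷ K) (subst (n ≤_) (sym (ℕ.+-suc k (length K))) le) (u ∷ K₀ , cong (u ∷_) eq)
            (grow K (g ∷ Li) v~u u≢p nl) (grow K (g ∷ Ri) v~u u≢p nr)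
            (λ { (here refl) → Cu (nbr (proj₁ (inP (here refl))) v~u) , (λ e → none (u , inj₂ e , ~-sym v~u)) ; (there p) → inP p })
            (λ { ct (here refl) e → none (_ , weaken ct , e) ; ct (there p) e → clear ct p e })
          where
          Cu : C u ⊎ D u → C u
          Cu (inj₁ c) = c
          Cu (inj₂ d) = ⊥-elim (none (u , inj₁ d , ~-sym v~u))
          weaken : ∀ {z} → Contact b z → D z ⊎ b ~ z
          weaken (inj₁ d) = inj₁ d
          weaken (inj₂ (_ , e)) = inj₂ e

      module Tip {x : V} (F : FirstContact x) where
        open FirstContact F public

        Cv : C v
        Cv = proj₁ (inP (here refl))

        b≁v : ¬ b ~ v
        b≁v = proj₂ (inP (here refl))

        ip-Li : Induced ((v ∷ K) ++ w ∷ g ∷ Li)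
        ip-Li = forest-Induced (v ∷ K) (w ∷ g ∷ Li) inP Li-in nbL

        ip-Ri : Induced ((v ∷ K) ++ w ∷ g ∷ Ri)
        ip-Ri = forest-Induced (v ∷ K) (w ∷ g ∷ Ri) inP Ri-in nbR

        ip-w : Induced ((v ∷ K) ++ [ w ])
        ip-w = Induced-++ˡ ((v ∷ K) ++ [ w ]) (subst Induced (sym (++-assoc (v ∷ K) [ w ] (g ∷ Li))) ip-Li)

        ip-g : Induced ((v ∷ K) ++ w ∷ [ g ])
        ip-g = Induced-++ˡ ((v ∷ K) ++ w ∷ [ g ]) (subst Induced (sym (++-assoc (v ∷ K) (w ∷ [ g ]) Li)) ip-Li)

        K-gLi : Anti (v ∷ K) (g ∷ Li)
        K-gLi = Induced-++-Anti (v ∷ K) ip-Li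

        K-gRi : Anti (v ∷ K) (g ∷ Ri)
        K-gRi = Induced-++-Anti (v ∷ K) ip-Ri

        ip-mark : ∀ {z} → Contact b z → z ~ v → ¬ z ∈ v ∷ K → Induced (z ∷ (v ∷ K) ++ [ w ])
        ip-mark ct e z∉ = e , non , ip-w
          where
          non : NonAll _ (K ++ [ w ])
          non p with ∈-snoc K p
          ... | inj₁ q = (λ { refl → z∉ (there q) }) , clear ct q
          ... | inj₂ refl = (λ { refl → [ (λ Dw → C⇒¬D Cw Dw) , (λ { (_ , b~w) → b≁w b~w }) ]′ ct }) , w-free ct

        off-path : ∀ {z} → Contact b z → ¬ z ∈ v ∷ K
        off-path (inj₁ Dz) p = C⇒¬D (proj₁ (inP p)) Dz
        off-path (inj₂ (_ , b~z)) p = proj₂ (inP p) b~z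

        ip-mark-g : ∀ {z} → Contact b z → z ~ v → Induced (z ∷ ((v ∷ K) ++ [ w ]) ++ [ g ])
        ip-mark-g {z} ct e = subst (λ l → Induced (z ∷ l)) (sym (++-assoc (v ∷ K) [ w ] [ g ]))
          (e , non , ip-g)
          where
          non : NonAll z (K ++ w ∷ [ g ])
          non p with ∈-++⁻ K p
          ... | inj₁ q = (λ { refl → off-path ct (there q) }) , clear ct q
          ... | inj₂ (here refl) = (λ { refl → [ (λ Dw → C⇒¬D Cw Dw) , (λ { (_ , b~w) → b≁w b~w }) ]′ ct }) , w-free ct
          ... | inj₂ (there (here refl)) = (λ { refl → [ (λ Dw → C⇒¬D Cg Dw) , (λ { (_ , b~w) → b≁g b~w }) ]′ ct }) , g-unmarked ct

        end-L : Contact b pL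
        end-L = inj₂ (inL (∈-++⁺ʳ Li (here refl)) , b~pL)

        end-R : Contact b pR
        end-R = inj₂ (inR (∈-++⁺ʳ Ri (here refl)) , b~pR)

        inPw : ∀ {t} → t ∈ (v ∷ K) ++ [ w ] → P t
        inPw p with ∈-snoc (v ∷ K) p
        ... | inj₁ q = inP q
        ... | inj₂ refl = Cw , b≁w

        module Clean (v≁pL : ¬ v ~ pL) (v≁pR : ¬ v ~ pR) where

          -- The forest separates the branch from `Li`. The end pL is itself a contact, so it sees
          -- no vertex before the tip, and it does not see the tip by assumption.
          aL : Anti L ((v ∷ K) ++ [ w ])
          aL p q with ∈-snoc (v ∷ K) q | ∈-snoc Li p
          ... | inj₂ refl | _ = Non-sym (wL p)
          ... | inj₁ q′ | inj₁ p′ = Non-sym (K-gLi q′ (there p′))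
          ... | inj₁ q′ | inj₂ refl = (λ { refl → off-path end-L q′ }) , apart q′
            where
            apart : ∀ {t} → t ∈ v ∷ K → ¬ pL ~ t
            apart (here refl) = v≁pL ∘ ~-sym
            apart (there q) = clear end-L q

          aR : Anti R ((v ∷ K) ++ [ w ])
          aR p q with ∈-snoc (v ∷ K) q | ∈-snoc Ri p
          ... | inj₂ refl | _ = Non-sym (wR p)
          ... | inj₁ q′ | inj₁ p′ = Non-sym (K-gRi q′ (there p′))
          ... | inj₁ q′ | inj₂ refl = (λ { refl → off-path end-R q′ }) , apart q′
            where
            apart : ∀ {t} → t ∈ v ∷ K → ¬ pR ~ t
            apart (here refl) = v≁pR ∘ ~-sym
            apart (there q) = clear end-R q

          mark-of : ∀ {z} → D z → z ~ v → ∃ λ s → s ∈ L ++ R × z ~ s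
          mark-of {z} Dz e = mark-on-ring ((v ∷ K) ++ [ w ]) z (ip-mark-g (inj₁ Dz) e) inPw aL aR Dz (λ { refl → b≁v e })

          no-direct : ∀ {z} → C z → b ~ z → ¬ z ~ v
          no-direct {z} Cz b~z e = no-direct-exit ((v ∷ K) ++ [ w ]) z (ip-mark-g (inj₂ (Cz , b~z)) e) inPw aL aR Cz b~z off
            where
            off : ¬ z ∈ Y
            off (here refl) = b≁g b~z
            off (there p) with ∈-++⁻ L p
            ... | inj₁ q = proj₂ (aL q (here refl)) e
            ... | inj₂ q = proj₂ (aR q (here refl)) e

    FirstContact-swap : ∀ {b} (ring : Ring b) {x} → Contacts.FirstContact ring x → Contacts.FirstContact (Ring-swap ring) x
    FirstContact-swap ring F = record
      { start = start ; nbL = nbR ; nbR = nbL ; inP = inP ; clear = clear ; contact = contact }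
      where open Contacts.FirstContact F

    reverse-∷ʳ : ∀ (l : List V) x → reverse (l ++ [ x ]) ≡ x ∷ reverse l
    reverse-∷ʳ l x = reverse-++ l [ x ]

    unrev : ∀ (l : List V) {x} → x ∈ reverse l → x ∈ l
    unrev l = reverse⁻

    Induced-distinct : ∀ l {s} → Induced (l ++ [ s ]) → ¬ s ∈ l
    Induced-distinct (x ∷ l) ip (here refl) = Induced-ends-≢ l ip refl
    Induced-distinct (x ∷ l) ip (there p) = Induced-distinct l (Induced-tail _ ip) p

    reverse-≢[] : ∀ {x : V} l → x ∈ l → reverse l ≢ []
    reverse-≢[] {x} l p eq with subst (x ∈_) eq (reverse⁺ p)
    ... | ()

    -- Tips of the colour of b: where their neighbours in D can attach

    module Half {b : V} (ring : Ring b) where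
      open Contacts ring public

      module Cut (R₁ : List V) (s : V) (R₂ : List V) (eq : R ≡ R₁ ++ s ∷ R₂) where

        s∈R : s ∈ R
        s∈R = subst (s ∈_) (sym eq) (∈-++⁺ʳ R₁ (here refl))

        R₁⊆R : ∀ {t} → t ∈ R₁ → t ∈ R
        R₁⊆R p = subst (_ ∈_) (sym eq) (∈-++⁺ˡ p)

        R₂⊆R : ∀ {t} → t ∈ R₂ → t ∈ R
        R₂⊆R p = subst (_ ∈_) (sym eq) (∈-++⁺ʳ R₁ (there p))

        ip-cut : Induced ((g ∷ R₁) ++ s ∷ R₂ ++ [ b ])
        ip-cut = subst (λ l → Induced (g ∷ l)) (trans (cong (_++ [ b ]) eq) (++-assoc R₁ (s ∷ R₂) [ b ])) ipR

        ip-s : Induced ((g ∷ R₁) ++ [ s ])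
        ip-s = Induced-++ˡ ((g ∷ R₁) ++ [ s ]) (subst (λ l → Induced (g ∷ l)) (sym (++-assoc R₁ [ s ] (R₂ ++ [ b ]))) ip-cut)

        before-after : Anti (g ∷ R₁) (R₂ ++ [ b ])
        before-after = Induced-++-Anti (g ∷ R₁) ip-cut

        R₁≁b : ∀ {t} → t ∈ R₁ → Non t b
        R₁≁b p = before-after (there p) (∈-++⁺ʳ R₂ (here refl))

      module _ {x : V} (F : FirstContact x) where
        open Tip F

        module Foot (v≁pL : ¬ v ~ pL) (v≁pR : ¬ v ~ pR) (v≡b : col v ≡ col b) where
          open Clean v≁pL v≁pR

          private
            Q : V → List V
            Q z = z ∷ (v ∷ K) ++ [ w ]

          -- Otherwise g and s are the ends of an odd theta: one path is `R₁`, one goes the other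
          -- way round the ring through b, and one goes through w, v and z. The colours differ
          -- because s and v, both adjacent to z, have the colour of b.
          foot : ∀ {z} → D z → z ~ v → ¬ b ~ z → ∀ {s} R₁ R₂ → R ≡ R₁ ++ s ∷ R₂ → z ~ s → R₁ ≡ []
          foot Dz z~v b≁z [] R₂ eq z~s = refl
          foot {z} Dz z~v b≁z {s} R₁@(_ ∷ _) R₂ eq z~s = ⊥-elim
            (theta R₁ arm (reverse (Q z)) (λ ()) (nonempty L) (reverse-≢[] (Q z) (here refl))
              (proj₂ g-s) g≠s ip-s ip-arm (Induced-flip (Q z) ip-Q)
              (λ p q → R₁-arm p (∈-++⁻ L q)) (λ p q → R₁-Q p (reverse⁻ q)) (λ p q → arm-Q (∈-++⁻ L p) (reverse⁻ q)))
            where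
            open Cut R₁ s R₂ eq
            z≢b : z ≢ b
            z≢b refl = b≁v z~v
            arm = L ++ b ∷ reverse R₂
            nonempty : ∀ A → A ++ b ∷ reverse R₂ ≢ []
            nonempty [] ()
            nonempty (_ ∷ _) ()
            g-s : Non g s
            g-s = head-non _ ip-s
              where
              head-non : ∀ {y} A → Induced (g ∷ (y ∷ A) ++ [ s ]) → Non g s
              head-non A (_ , ng , _) = ng (∈-++⁺ʳ A (here refl))
            g≠s : col g ≢ col s
            g≠s eq′ = m≠e (trans eq′ (trans (same-colour z~s z~v) v≡b))
            z-only : ∀ {t} → t ∈ Y → t ≢ s → Non z t
            z-only t∈ t≢s = D≢C Dz (inY t∈) , λ e → unique Dz z≢b t∈ (on-R s∈R) t≢s e z~s
            L≢s : ∀ {t} → t ∈ L → t ≢ s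
            L≢s p refl = proj₁ (anti p s∈R) refl
            ip-arm : Induced (g ∷ arm ++ [ s ])
            ip-arm = subst (λ l → Induced (g ∷ l)) (sym (++-assoc L (b ∷ reverse R₂) [ s ]))
              (Induced-++ (g ∷ L) (reverse R₂ ++ [ s ]) ipL (Induced-flip R₂ (Induced-++ʳ (g ∷ R₁) ip-cut)) sep)
              where
              sep : Anti (g ∷ L) (reverse R₂ ++ [ s ])
              sep p q with ∈-snoc (reverse R₂) q
              sep (here refl) q | inj₁ q′ = before-after (here refl) (∈-++⁺ˡ (unrev R₂ q′))
              sep (there p) q | inj₁ q′ = anti p (R₂⊆R (unrev R₂ q′))
              sep (here refl) q | inj₂ refl = g-s
              sep (there p) q | inj₂ refl = anti p s∈R
            ip-Q : Induced (s ∷ Q z ++ [ g ])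
            ip-Q = ~-sym z~s , non , ip-mark-g (inj₁ Dz) z~v
              where
              non : NonAll s (((v ∷ K) ++ [ w ]) ++ [ g ])
              non p with ∈-snoc ((v ∷ K) ++ [ w ]) p
              ... | inj₁ q = aR s∈R q
              ... | inj₂ refl = Non-sym g-s
            R₁-arm : ∀ {p q} → p ∈ R₁ → q ∈ L ⊎ q ∈ b ∷ reverse R₂ → Non p q
            R₁-arm p (inj₁ q) = Non-sym (anti q (R₁⊆R p))
            R₁-arm p (inj₂ (here refl)) = R₁≁b p
            R₁-arm p (inj₂ (there q)) = before-after (there p) (∈-++⁺ˡ (unrev R₂ q))
            R₁≢s : ∀ {t} → t ∈ R₁ → t ≢ s
            R₁≢s p refl = Induced-distinct (g ∷ R₁) ip-s (there p)
            R₁-Q : ∀ {p q} → p ∈ R₁ → q ∈ Q z → Non p q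
            R₁-Q p (here refl) = Non-sym (z-only (on-R (R₁⊆R p)) (R₁≢s p))
            R₁-Q p (there q) = aR (R₁⊆R p) q
            arm-Q : ∀ {p q} → p ∈ L ⊎ p ∈ b ∷ reverse R₂ → q ∈ Q z → Non p q
            arm-Q (inj₁ p) (here refl) = Non-sym (z-only (on-L p) (L≢s p))
            arm-Q (inj₁ p) (there q) = aL p q
            arm-Q (inj₂ (here refl)) (here refl) = z≢b ∘ sym , b≁z
            arm-Q (inj₂ (here refl)) (there q) = D≢C Db (proj₁ (inPw q)) , proj₂ (inPw q)
            arm-Q (inj₂ (there p)) (here refl) = Non-sym (z-only (on-R (R₂⊆R (unrev R₂ p))) R₂≢s)
              where
              R₂≢s : _ ≢ s
              R₂≢s refl = Induced-≢ s (R₂ ++ [ b ]) (Induced-++ʳ (g ∷ R₁) ip-cut) (∈-++⁺ˡ (unrev R₂ p)) refl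
            arm-Q (inj₂ (there p)) (there q) = aR (R₂⊆R (unrev R₂ p)) q

          private
            z≢b′ : ∀ {z} → z ~ v → z ≢ b
            z≢b′ e refl = b≁v e

            g-v : Non g v
            g-v = Non-sym (K-gLi (here refl) (here refl))

          -- If z′ also saw l₁, there would be a 4-cycle. Otherwise an odd theta has ends g and v:
          -- one path is l₁, z, one is the branch through w, and one follows R to the first
          -- neighbour of z′, or on to b if z′ misses R and b sees it.
          eta-pair : ∀ {z z′ l₁ L′} → L ≡ l₁ ∷ L′ → D z → z ~ v → ¬ b ~ z → z ~ l₁ →
            D z′ → z′ ~ v → z ≢ z′ → (∀ {s} → s ∈ L → z′ ~ s → ¬ b ~ z′ → s ≡ l₁) → ⊥
          eta-pair {z} {z′} {l₁} {L′} eq Dz z~v b≁z z~l Dz′ z′~v z≢z′ foot-L with z′ ~? l₁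
          ... | yes z′~l = no-4-cycle v≢l z≢z′ (~-sym z~v) (~-sym z′~v) (~-sym z~l) (~-sym z′~l)
            where
            l∈L : l₁ ∈ L
            l∈L = subst (l₁ ∈_) (sym eq) (here refl)
            v≢l : v ≢ l₁
            v≢l refl = proj₁ (aL l∈L (here refl)) refl
          ... | no z′≁l = third (neighbour-in? z′ R)
            where
            l∈L : l₁ ∈ L
            l∈L = subst (l₁ ∈_) (sym eq) (here refl)
            g~l : g ~ l₁
            g~l = edge L eq ipL
              where
              edge : ∀ A → A ≡ l₁ ∷ L′ → Induced (g ∷ A ++ [ b ]) → g ~ l₁
              edge (_ ∷ _) refl (e , _) = e
            z-only : ∀ {t} → t ∈ Y → t ≢ l₁ → Non z t
            z-only t∈ t≢ = D≢C Dz (inY t∈) , λ e → unique Dz (z≢b′ z~v) t∈ (on-L l∈L) t≢ e z~l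
            R≢l : ∀ {t} → t ∈ R → t ≢ l₁
            R≢l p refl = proj₁ (anti l∈L p) refl
            Beside : V → Set
            Beside t = Non l₁ t × Non z t × (∀ {q} → q ∈ (v ∷ K) ++ [ w ] → Non q t)
            beside-R : ∀ {t} → t ∈ R → Beside t
            beside-R p = anti l∈L p , z-only (on-R p) (R≢l p) , λ q → Non-sym (aR p q)
            beside-b : Beside b
            beside-b = (C≢D (inL l∈L) Db , λ e → proper e (trans (same-colour z~l z~v) v≡b)) ,
              (z≢b′ z~v , b≁z ∘ ~-sym) , λ q → C≢D (proj₁ (inPw q)) Db , proj₂ (inPw q) ∘ ~-sym
            z-z′ : Non z z′
            z-z′ = z≢z′ , λ e → proper e (same-colour (~-sym z~v) (~-sym z′~v))
            finish : ∀ X → Induced (g ∷ X ++ z′ ∷ [ v ]) → (∀ {t} → t ∈ X → Beside t) → ⊥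
            finish X ip beside = theta (l₁ ∷ [ z ]) (reverse (K ++ [ w ])) (X ++ [ z′ ]) (λ ()) (reverse-≢[] (K ++ [ w ]) (∈-++⁺ʳ K (here refl))) (nonempty X)
              (proj₂ g-v) (λ e → m≠e (trans e v≡b))
              (g~l , (λ { (here refl) → C≢D Cg Dz , g-unmarked (inj₁ Dz) ∘ ~-sym ; (there (here refl)) → g-v }) ,
                ~-sym z~l , (λ { (here refl) → aL l∈L (here refl) }) , z~v , (λ ()) , tt)
              (Induced-flip (K ++ [ w ]) (subst (λ l → Induced (v ∷ l)) (sym (++-assoc K [ w ] [ g ])) ip-g))
              (subst (λ l → Induced (g ∷ l)) (sym (++-assoc X [ z′ ] [ v ])) ip)
              (λ p q → stem p (unrev (K ++ [ w ]) q))
              (λ p q → side p (∈-snoc X q))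
              (λ p q → tree (unrev (K ++ [ w ]) p) (∈-snoc X q))
              where
              nonempty : ∀ X → X ++ [ z′ ] ≢ []
              nonempty [] ()
              nonempty (_ ∷ _) ()
              mark-K : ∀ {y q} → D y → q ∈ K ++ [ w ] → Non y q
              mark-K Dy q with ∈-snoc K q
              ... | inj₁ q′ = D≢C Dy (proj₁ (inP (there q′))) , clear (inj₁ Dy) q′
              ... | inj₂ refl = D≢C Dy Cw , w-free (inj₁ Dy)
              stem : ∀ {p q} → p ∈ l₁ ∷ [ z ] → q ∈ K ++ [ w ] → Non p q
              stem (here refl) q = aL l∈L (there q)
              stem (there (here refl)) q = mark-K Dz q
              side : ∀ {p q} → p ∈ l₁ ∷ [ z ] → q ∈ X ⊎ q ≡ z′ → Non p q
              side (here refl) (inj₁ q) = proj₁ (beside q)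
              side (there (here refl)) (inj₁ q) = proj₁ (proj₂ (beside q))
              side (here refl) (inj₂ refl) = C≢D (inL l∈L) Dz′ , z′≁l ∘ ~-sym
              side (there (here refl)) (inj₂ refl) = z-z′
              tree : ∀ {p q} → p ∈ K ++ [ w ] → q ∈ X ⊎ q ≡ z′ → Non p q
              tree p (inj₁ q) = proj₂ (proj₂ (beside q)) (there p)
              tree p (inj₂ refl) = Non-sym (mark-K Dz′ p)
            g-z′ : Non g z′
            g-z′ = C≢D Cg Dz′ , g-unmarked (inj₁ Dz′) ∘ ~-sym
            third : Dec (∃ λ y → y ∈ R × z′ ~ y) → ⊥
            third (yes found) with first-neighbour z′ R found
            ... | A , y , B , eqR , z′~y , none = finish (A ++ [ y ])
              (subst (λ l → Induced (g ∷ l)) (sym (++-assoc A [ y ] (z′ ∷ [ v ])))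
                (Induced-++ (g ∷ A) (z′ ∷ [ v ]) ip-s (~-sym z′~y , (λ { (here refl) → aR s∈R (here refl) }) , z′~v , (λ ()) , tt) sep))
              λ p → beside-R ([ R₁⊆R , (λ { refl → s∈R }) ]′ (∈-snoc A p))
              where
              open Cut A y B eqR
              sep : Anti (g ∷ A) (z′ ∷ [ v ])
              sep (here refl) (here refl) = g-z′
              sep (here refl) (there (here refl)) = g-v
              sep (there p) (here refl) = C≢D (inR (R₁⊆R p)) Dz′ , none p ∘ ~-sym
              sep (there p) (there (here refl)) = aR (R₁⊆R p) (here refl)
            -- With R missed, either b leads to z′, or z′ sees an arm by `mark-of`; that must be L
            -- at l₁, which has been excluded.
            third (no none) with b ~? z′
            ... | yes b~z′ = finish (R ++ [ b ])
              (subst (λ l → Induced (g ∷ l)) (sym (++-assoc R [ b ] (z′ ∷ [ v ])))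
                (Induced-++ (g ∷ R) (z′ ∷ [ v ]) ipR (b~z′ , (λ { (here refl) → D≢C Db Cv , b≁v }) , z′~v , (λ ()) , tt) sep))
              λ p → [ beside-R , (λ { refl → beside-b }) ]′ (∈-snoc R p)
              where
              sep : Anti (g ∷ R) (z′ ∷ [ v ])
              sep (here refl) (here refl) = g-z′
              sep (here refl) (there (here refl)) = g-v
              sep (there p) (here refl) = C≢D (inR p) Dz′ , λ e → none (_ , p , ~-sym e)
              sep (there p) (there (here refl)) = aR p (here refl)
            ... | no b≁z′ with mark-of Dz′ z′~v
            ...   | s , s∈ , z′~s with ∈-++⁻ L s∈
            ...     | inj₁ s∈L = z′≁l (subst (z′ ~_) (foot-L s∈L z′~s b≁z′) z′~s)
            ...     | inj₂ s∈R = none (s , s∈R , z′~s)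

          -- The vertex e, the branch from v down to w, then g, `R₁` and s form a hole. With w as
          -- centre, contacts other than e see it only at s, so the second branch, starting at x₂,
          -- falls to `no-branch`.
          single-mark : ∀ {e s} R₁ R₂ → R ≡ R₁ ++ s ∷ R₂ → D e → e ~ v → e ~ s →
            (∀ {z} → D z → z ~ v → z ≡ e) →
            ∀ x₂ → w ~ x₂ → x₂ ≢ x → x₂ ≢ g → P x₂ → ⊥
          single-mark {e} {s} R₁ R₂ eq De e~v e~s sole x₂ w~x₂ x₂≢x x₂≢g (Cx₂ , b≁x₂) =
            Branch.no-branch Db De b≢e sector b≁ {s} (there (∈-++⁺ʳ R₁ (here refl))) e~s only
              x₂ w~x₂ Cx₂ b≁x₂ (λ e~x₂ → proper e~x₂ (two-colours w≠e (proper w~x₂)))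
              (heads (proj₂ start)) x₂≢g
            where
            open Cut R₁ s R₂ eq
            O = reverse (v ∷ K)
            b≢e : b ≢ e
            b≢e refl = b≁v e~v
            col-s : col s ≡ col b
            col-s = trans (same-colour e~s e~v) v≡b
            b≁s : ¬ b ~ s
            b≁s e′ = proper e′ (sym col-s)
            w≠e : col w ≢ col e
            w≠e e′ = proper e~v (trans (sym e′) (trans col-w (sym v≡b)))
            heads : ∀ {K₀} → v ∷ K ≡ K₀ ++ [ x ] → HeadsDiffer [ x₂ ] O
            heads {K₀} eq′ = subst (HeadsDiffer [ x₂ ]) (sym (trans (cong reverse eq′) (reverse-∷ʳ K₀ x))) x₂≢x
            O⊆ : ∀ {t} → t ∈ O → t ∈ v ∷ K
            O⊆ = unrev (v ∷ K)
            R₁≢s : ∀ {t} → t ∈ R₁ → t ≢ s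
            R₁≢s p refl = Induced-distinct (g ∷ R₁) ip-s (there p)
            e-R₁ : ∀ {t} → t ∈ R₁ → Non e t
            e-R₁ p = D≢C De (inR (R₁⊆R p)) , λ e′ → unique De (b≢e ∘ sym) (on-R (R₁⊆R p)) (on-R s∈R) (R₁≢s p) e′ e~s
            path-R : ∀ {t y} → t ∈ O → y ∈ R₁ ++ [ s ] → Non t y
            path-R p q = Non-sym (aR ([ R₁⊆R , (λ { refl → s∈R }) ]′ (∈-snoc R₁ q)) (∈-++⁺ˡ (O⊆ p)))
            sector : Sector e w O (g ∷ R₁ ++ [ s ])
            sector = record
              { ipL = Induced-flip (v ∷ K) (ip-mark (inj₁ De) e~v (off-path (inj₁ De)))
              ; ipR = subst (λ l → Induced (w ∷ g ∷ l)) (sym (++-assoc R₁ [ s ] [ e ])) (Induced-++ (w ∷ g ∷ R₁) [ e ] ip-wgs (~-sym e~s , (λ ()) , tt) sep)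
              ; L≢[] = reverse-≢[] (v ∷ K) (here refl)
              ; R≢[] = λ ()
              ; anti = λ { p (here refl) → K-gLi (O⊆ p) (here refl) ; p (there q) → path-R p q }
              ; m≁e = w-free (inj₁ De) ∘ ~-sym
              ; m≠e = w≠e
              ; inC = λ { (here refl) → Cw ; (there p) → [ (λ q → proj₁ (inP (O⊆ q))) , (λ { (here refl) → Cg ; (there q) → [ (λ q′ → inR (R₁⊆R q′)) , (λ { refl → inR s∈R }) ]′ (∈-snoc R₁ q) }) ]′ (∈-++⁻ O p) } }
              where
              w-R : ∀ {t} → t ∈ R₁ ++ [ s ] → t ∈ R
              w-R q = [ R₁⊆R , (λ { refl → s∈R }) ]′ (∈-snoc R₁ q)
              ip-wgs : Induced ((w ∷ g ∷ R₁) ++ [ s ])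
              ip-wgs = ~-sym g~w , (λ q → wR (w-R q)) , ip-s
              sep : Anti (w ∷ g ∷ R₁) [ e ]
              sep (here refl) (here refl) = C≢D Cw De , w-free (inj₁ De) ∘ ~-sym
              sep (there (here refl)) (here refl) = C≢D Cg De , g-unmarked (inj₁ De) ∘ ~-sym
              sep (there (there p)) (here refl) = Non-sym (e-R₁ p)
            b≁ : ∀ {t} → t ∈ w ∷ O ++ (g ∷ R₁ ++ [ s ]) → ¬ b ~ t
            b≁ (here refl) = b≁w
            b≁ (there p) with ∈-++⁻ O p
            ... | inj₁ q = proj₂ (inP (O⊆ q))
            ... | inj₂ (here refl) = b≁g
            ... | inj₂ (there q) with ∈-snoc R₁ q
            ...   | inj₁ q′ = proj₂ (R₁≁b q′) ∘ ~-sym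
            ...   | inj₂ refl = b≁s
            tip-only : ∀ {z} → Contact b z → z ≢ e → ¬ z ~ v
            tip-only (inj₁ Dz) z≢e z~v = z≢e (sole Dz z~v)
            tip-only (inj₂ (Cz , b~z)) _ z~v = no-direct Cz b~z z~v
            path-only : ∀ {z t} → Contact b z → z ≢ e → t ∈ O → ¬ z ~ t
            path-only ct z≢e p with O⊆ p
            ... | here refl = tip-only ct z≢e
            ... | there q = clear ct q
            -- If t has the colour of b, then no odd theta has ends t and b; the contradiction comes from the hole through e instead.
            inner : ∀ {z t} → D z → z ≢ e → t ∈ R₁ → ¬ z ~ t
            inner {z} {t} Dz z≢e p z~t with col t Bool.≟ col b
            ... | no t≠b = unmarked Dz (on-R (R₁⊆R p)) (proj₂ (R₁≁b p) ∘ ~-sym) t≠b z~t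
            ... | yes t≡b with ∈-∃++ p
            ...   | A , B , eq₁ = escape (recentre (g ∷ A) t (B ++ [ s ]) (subst (λ l → Sector e w O (g ∷ l)) eq₂ sector) nonempty t≠e)
                    De [] z (z~t , (λ ()) , tt) (λ ()) (λ _ ()) (λ _ ()) Dz z≢e
                    (λ q → clash (left q)) (λ q → clash (inj₂ (inj₂ (B⊆R q))))
              where
              eq₂ : R₁ ++ [ s ] ≡ A ++ t ∷ B ++ [ s ]
              eq₂ = trans (cong (_++ [ s ]) eq₁) (++-assoc A (t ∷ B) [ s ])
              t≠e : col t ≢ col e
              t≠e e′ = proper e~v (trans (sym e′) (trans t≡b (sym v≡b)))
              nonempty : B ++ [ s ] ≢ []
              nonempty e′ with subst (s ∈_) e′ (∈-++⁺ʳ B (here refl))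
              ... | ()
              z≢b : z ≢ b
              z≢b refl = proj₂ (R₁≁b p) (~-sym z~t)
              ip-R₁ : Induced (A ++ t ∷ B ++ [ s ])
              ip-R₁ = subst Induced eq₂ (Induced-tail _ ip-s)
              A⊆R : ∀ {y} → y ∈ A → y ∈ R × y ≢ t
              A⊆R q = R₁⊆R (subst (_ ∈_) (sym eq₁) (∈-++⁺ˡ q)) ,
                λ { refl → Induced-distinct A (Induced-++ˡ (A ++ [ t ]) (subst Induced (sym (++-assoc A [ t ] (B ++ [ s ]))) ip-R₁)) q }
              B⊆R : ∀ {y} → y ∈ B ++ [ s ] → y ∈ R × y ≢ t
              B⊆R q = [ (λ q′ → R₁⊆R (subst (_ ∈_) (sym eq₁) (∈-++⁺ʳ A (there q′)))) , (λ { refl → s∈R }) ]′ (∈-snoc B q) ,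
                λ { refl → Induced-≢ t (B ++ [ s ]) (Induced-++ʳ A ip-R₁) q refl }
              left : ∀ {y} → y ∈ (g ∷ A) ʳ++ (w ∷ O) → (y ∈ w ∷ O) ⊎ (y ≡ g ⊎ (y ∈ R × y ≢ t))
              left q with ∈-ʳ++⁻ (g ∷ A) q
              ... | inj₂ q′ = inj₁ q′
              ... | inj₁ (here q′) = inj₂ (inj₁ q′)
              ... | inj₁ (there q′) = inj₂ (inj₂ (A⊆R q′))
              clash : ∀ {y} → (y ∈ w ∷ O) ⊎ (y ≡ g ⊎ (y ∈ R × y ≢ t)) → Non z y
              clash (inj₁ (here refl)) = D≢C Dz Cw , w-free (inj₁ Dz)
              clash (inj₁ (there q)) = D≢C Dz (proj₁ (inP (O⊆ q))) , path-only (inj₁ Dz) z≢e q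
              clash (inj₂ (inj₁ refl)) = D≢C Dz Cg , g-unmarked (inj₁ Dz)
              clash (inj₂ (inj₂ (q , y≢t))) = D≢C Dz (inR q) , λ e′ → unique Dz z≢b (on-R q) (on-R (R₁⊆R p)) y≢t e′ z~t
            only : ∀ {z t} → Contact b z → z ≢ e → t ∈ w ∷ O ++ (g ∷ R₁ ++ [ s ]) → z ~ t → t ≡ s
            only ct z≢e (here refl) z~t = ⊥-elim (w-free ct z~t)
            only ct z≢e (there p) z~t with ∈-++⁻ O p
            ... | inj₁ q = ⊥-elim (path-only ct z≢e q z~t)
            ... | inj₂ (here refl) = ⊥-elim (g-unmarked ct z~t)
            ... | inj₂ (there q) with ∈-snoc R₁ q
            ...   | inj₂ eq′ = eq′
            only (inj₁ Dz) z≢e _ z~t | inj₂ (there q) | inj₁ q′ = ⊥-elim (inner Dz z≢e q′ z~t)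
            only {z} (inj₂ (Cz , b~z)) z≢e _ z~t | inj₂ (there q) | inj₁ q′ = ⊥-elim (outer Cz b~z off (on-R (R₁⊆R q′)) (proj₂ (R₁≁b q′) ∘ ~-sym) z~t)
              where
              -- The neighbours on Y of a vertex of `R₁` are g, s or again in `R₁`, and b sees none
              -- of these.
              off : ¬ z ∈ Y
              off (here refl) = b≁g b~z
              off (there r) with ∈-++⁻ L r
              ... | inj₁ r′ = proj₂ (anti r′ (R₁⊆R q′)) z~t
              ... | inj₂ r′ = beyond (∈-++⁻ R₁ (subst (z ∈_) eq r′))
                where
                beyond : ¬ (z ∈ R₁ ⊎ z ∈ s ∷ R₂)
                beyond (inj₁ r₁) = proj₂ (R₁≁b r₁) (~-sym b~z)
                beyond (inj₂ (here refl)) = b≁s b~z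
                beyond (inj₂ (there r₂)) = proj₂ (before-after (there q′) (∈-++⁺ˡ r₂)) (~-sym z~t)

    -- Legs: paths from an end of the ring to w

    record Leg {b : V} (ring : Ring b) (A : List V) : Set where
      open Ring ring
      field
        ip   : Induced (pL ∷ A ++ [ w ])
        A≢[] : A ≢ []
        A-b  : ∀ {t} → t ∈ A → Non t b
        A-pR : ∀ {t} → t ∈ A → Non t pR
        A-Li : Anti A (g ∷ Li)
        A-Ri : Anti A (g ∷ Ri)

    module Legs {b : V} (ring : Ring b) where
      open Half ring public

      pL≢pR : pL ≢ pR
      pL≢pR = proj₁ (anti (∈-++⁺ʳ Li (here refl)) (∈-++⁺ʳ Ri (here refl)))

      private
        third : Induced (pL ∷ reverse (g ∷ Li) ++ [ w ])
        third = Induced-flip (g ∷ Li) (~-sym g~w , wL , Induced-++ˡ (g ∷ L) ipL)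

        pL≁w : ¬ pL ~ w
        pL≁w = proj₂ (wL (∈-++⁺ʳ Li (here refl))) ∘ ~-sym

        pL≠w : col pL ≢ col w
        pL≠w eq = proper g~w (trans (sym col-pL) eq)

      -- An odd theta with ends pL and w, the third path running along `Li` to g. The colours differ
      -- because pL has the colour of g, a neighbour of w.
      same-end : ∀ {A₁ A₂} → Leg ring A₁ → Leg ring A₂ → Anti A₁ A₂ → ⊥
      same-end {A₁} {A₂} l₁ l₂ a = theta A₁ A₂ (reverse (g ∷ Li)) (Leg.A≢[] l₁) (Leg.A≢[] l₂) (reverse-≢[] (g ∷ Li) (here refl))
        pL≁w pL≠w (Leg.ip l₁) (Leg.ip l₂) third a
        (λ p q → Leg.A-Li l₁ p (unrev (g ∷ Li) q)) (λ p q → Leg.A-Li l₂ p (unrev (g ∷ Li) q))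

      -- The ends of the theta are again pL and w; the second path crosses from pL through b to pR
      -- and follows the leg from there.
      opposite-ends : ∀ {A₁ A₂} → Leg ring A₁ → Leg (Ring-swap ring) A₂ → Anti A₁ A₂ → ⊥
      opposite-ends {A₁} {A₂} l₁ l₂ a = theta A₁ (b ∷ pR ∷ A₂) (reverse (g ∷ Li)) (Leg.A≢[] l₁) (λ ()) (reverse-≢[] (g ∷ Li) (here refl))
        pL≁w pL≠w (Leg.ip l₁)
        (~-sym b~pL , far , b~pR , near , Leg.ip l₂) third
        (λ { p (here refl) → Leg.A-b l₁ p ; p (there (here refl)) → Leg.A-pR l₁ p ; p (there (there q)) → a p q })
        (λ p q → Leg.A-Li l₁ p (unrev (g ∷ Li) q))
        (λ { (here refl) q → b-Li (unrev (g ∷ Li) q) ; (there (here refl)) q → pR-Li (unrev (g ∷ Li) q)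
           ; (there (there p)) q → Leg.A-Ri l₂ p (unrev (g ∷ Li) q) })
        where
        far : NonAll pL (pR ∷ A₂ ++ [ w ])
        far (here refl) = anti (∈-++⁺ʳ Li (here refl)) (∈-++⁺ʳ Ri (here refl))
        far (there p) with ∈-snoc A₂ p
        ... | inj₁ q = Non-sym (Leg.A-pR l₂ q)
        ... | inj₂ refl = Non-sym (wL (∈-++⁺ʳ Li (here refl)))
        near : NonAll b (A₂ ++ [ w ])
        near p with ∈-snoc A₂ p
        ... | inj₁ q = Non-sym (Leg.A-b l₂ q)
        ... | inj₂ refl = D≢C Db Cw , b≁w
        b-Li : NonAll b (g ∷ Li)
        b-Li (here refl) = D≢C Db Cg , b≁g
        b-Li (there p) = D≢C Db (inL (∈-++⁺ˡ p)) , b≁Li p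
        pR-Li : NonAll pR (g ∷ Li)
        pR-Li (here refl) = (λ { refl → b≁g b~pR }) , (λ e → proper e col-pR)
        pR-Li (there p) = Non-sym (anti (∈-++⁺ˡ p) (∈-++⁺ʳ Ri (here refl)))

      module _ {x : V} (F : FirstContact x) where
        open Tip F

        direct-leg : v ~ pL → Leg ring (v ∷ K)
        direct-leg v~p = record
          { ip = ip-mark end-L (~-sym v~p) (off-path end-L)
          ; A≢[] = λ ()
          ; A-b = λ p → C≢D (proj₁ (inP p)) Db , proj₂ (inP p) ∘ ~-sym
          -- If v saw both ends of the ring, v and b would have two common neighbours.
          ; A-pR = λ { (here refl) → (λ { refl → b≁v b~pR }) , (λ e → no-4-cycle (C≢D Cv Db) pL≢pR v~p e b~pL b~pR)
                     ; (there p) → (λ { refl → proj₂ (inP (there p)) b~pR }) , clear end-R p ∘ ~-sym }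
          ; A-Li = K-gLi ; A-Ri = K-gRi }

        -- Having the colour of g, the tip v is adjacent to neither pL nor pR, and `unique` leaves c
        -- no neighbour on the ring but pL.
        mark-leg : col v ≡ col g → ∀ {c} → D c → c ~ v → c ~ pL → Leg ring (c ∷ v ∷ K)
        mark-leg v≡g {c} Dc c~v c~p = record
          { ip = ~-sym c~p , far , ip-mark (inj₁ Dc) c~v (off-path (inj₁ Dc))
          ; A≢[] = λ ()
          ; A-b = λ { (here refl) → c≢b , (λ e → proper e (same-colour (~-sym c~p) (~-sym b~pL)))
                    ; (there p) → C≢D (proj₁ (inP p)) Db , proj₂ (inP p) ∘ ~-sym }
          ; A-pR = λ { (here refl) → c-Y (on-R (∈-++⁺ʳ Ri (here refl))) (pL≢pR ∘ sym)
                     ; (there (here refl)) → (λ { refl → b≁v b~pR }) , (λ e → proper e (trans v≡g (sym col-pR)))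
                     ; (there (there p)) → (λ { refl → proj₂ (inP (there p)) b~pR }) , clear end-R p ∘ ~-sym }
          ; A-Li = λ { (here refl) (here refl) → c-g ; (here refl) (there q) → c-Y (on-L (∈-++⁺ˡ q)) (λ { refl → b≁Li q b~pL }) ; (there p) q → K-gLi p q }
          ; A-Ri = λ { (here refl) (here refl) → c-g ; (here refl) (there q) → c-Y (on-R (∈-++⁺ˡ q)) (λ { refl → b≁Ri q b~pL }) ; (there p) q → K-gRi p q } }
          where
          c≢b : c ≢ b
          c≢b refl = b≁v c~v
          c-g : Non c g
          c-g = D≢C Dc Cg , g-unmarked (inj₁ Dc)
          c-Y : ∀ {t} → t ∈ Y → t ≢ pL → Non c t
          c-Y t∈ t≢ = D≢C Dc (inY t∈) , λ e → unique Dc c≢b t∈ (on-L (∈-++⁺ʳ Li (here refl))) t≢ e c~p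
          far : NonAll pL ((v ∷ K) ++ [ w ])
          far p with ∈-snoc (v ∷ K) p
          ... | inj₁ (here refl) = (λ { refl → b≁v b~pL }) , (λ e → proper e (trans col-pL (sym v≡g)))
          ... | inj₁ (there q) = (λ { refl → proj₂ (inP (there q)) b~pL }) , clear end-L q
          ... | inj₂ refl = Non-sym (wL (∈-++⁺ʳ Li (here refl)))

    Leg′ : ∀ {b} → Ring b → List V → Set
    Leg′ ring A = Leg ring A ⊎ Leg (Ring-swap ring) A

    no-two-legs : ∀ {b} (ring : Ring b) {A₁ A₂} → Leg′ ring A₁ → Leg′ ring A₂ → Anti A₁ A₂ → ⊥
    no-two-legs ring (inj₁ l₁) (inj₁ l₂) a = Legs.same-end ring l₁ l₂ a
    no-two-legs ring (inj₁ l₁) (inj₂ l₂) a = Legs.opposite-ends ring l₁ l₂ a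
    no-two-legs ring (inj₂ l₁) (inj₁ l₂) a = Legs.opposite-ends ring l₂ l₁ (Anti-sym a)
    no-two-legs ring (inj₂ l₁) (inj₂ l₂) a = Legs.same-end (Ring-swap ring) l₁ l₂ a

    -- Comparing two branches from w

    module Pair {b : V} (ring : Ring b) {x₁ x₂ : V} (x₁≢x₂ : x₁ ≢ x₂)
      (F₁ : Contacts.FirstContact ring x₁) (F₂ : Contacts.FirstContact ring x₂) where
      open Contacts ring
      private
        module T₁ = Tip F₁
        module T₂ = Tip F₂
        A₁ = T₁.v ∷ T₁.K
        A₂ = T₂.v ∷ T₂.K
        O₁ = reverse A₁
        O₂ = reverse A₂

        outward : ∀ l → Induced (l ++ [ w ]) → NonBacktracking (w ∷ reverse l)
        outward l ip = Induced⇒NonBacktracking _ (subst Induced (reverse-∷ʳ l w) (Induced-reverse (l ++ [ w ]) ip))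

        heads : ∀ {l₁ l₂ K₁ K₂} → l₁ ≡ K₁ ++ [ x₁ ] → l₂ ≡ K₂ ++ [ x₂ ] → HeadsDiffer (reverse l₁) (reverse l₂)
        heads {K₁ = K₁} {K₂} refl refl = cases (reverse-∷ʳ K₁ x₁) (reverse-∷ʳ K₂ x₂)
          where
          cases : ∀ {l₁ l₂ m₁ m₂} → l₁ ≡ x₁ ∷ m₁ → l₂ ≡ x₂ ∷ m₂ → HeadsDiffer l₁ l₂
          cases refl refl = x₁≢x₂

        ip-joined : Induced (O₁ ʳ++ (w ∷ O₂))
        ip-joined = NonBacktracking⇒Induced (forest Db) (O₁ ʳ++ (w ∷ O₂))
          ([ T₁.inP ∘ unrev A₁ , (λ { (here refl) → Cw , b≁w ; (there q) → T₂.inP (unrev A₂ q) }) ]′ ∘ ∈-ʳ++⁻ O₁)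
          (NonBacktracking-arms O₁ O₂ (outward A₁ T₁.ip-w) (outward A₂ T₂.ip-w) (heads (proj₂ T₁.start) (proj₂ T₂.start)))

      -- Joined at w, the branches form a non-backtracking walk in the forest, hence an induced
      -- path.
      branches-apart : Anti A₁ A₂
      branches-apart p q = proj₂ (proj₂ (Induced-unarms O₁ O₂ ip-joined)) (reverse⁺ p) (reverse⁺ q)

      -- The vertex e closes the joined branches to a hole. Its centre m is two steps from the tip
      -- v₁ and so has its colour; contacts other than e see the hole only at v₂, and a third
      -- neighbour of m starts an endless walk.
      shared-mark : col T₁.v ≡ col g → col T₂.v ≡ col g → ∀ {e} → D e → e ~ T₁.v → e ~ T₂.v →
        (∀ {z} → D z → z ~ T₁.v → z ≡ e) → ⊥
      shared-mark v₁≡g v₂≡g {e} De e~v₁ e~v₂ sole = shape (T₁.K ++ w ∷ reverse T₂.K) refl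
        where
        b≢e : b ≢ e
        b≢e refl = T₁.b≁v e~v₁
        mid = T₁.K ++ w ∷ reverse T₂.K
        path-eq : O₁ ʳ++ (w ∷ O₂) ≡ T₁.v ∷ mid ++ [ T₂.v ]
        path-eq = trans (ʳ++-defn O₁) (trans (cong (_++ w ∷ O₂) (reverse-involutive A₁))
          (cong (T₁.v ∷_) (trans (cong (λ l → T₁.K ++ w ∷ l) (unfold-reverse T₂.v T₂.K)) (sym (++-assoc T₁.K (w ∷ reverse T₂.K) [ T₂.v ])))))
        ip : Induced (T₁.v ∷ mid ++ [ T₂.v ])
        ip = subst Induced path-eq ip-joined
        mid-free : ∀ {z t} → Contact b z → t ∈ mid → ¬ z ~ t
        mid-free ct p with ∈-++⁻ T₁.K p
        ... | inj₁ q = T₁.clear ct q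
        ... | inj₂ (here refl) = w-free ct
        ... | inj₂ (there q) = T₂.clear ct (unrev T₂.K q)
        mid-P : ∀ {t} → t ∈ mid → P t
        mid-P p with ∈-++⁻ T₁.K p
        ... | inj₁ q = T₁.inP (there q)
        ... | inj₂ (here refl) = Cw , b≁w
        ... | inj₂ (there q) = T₂.inP (there (unrev T₂.K q))
        v₁≢v₂ : T₁.v ≢ T₂.v
        v₁≢v₂ = Induced-ends-≢ mid ip
        shape : ∀ l → l ≡ mid → ⊥
        shape [] eq with subst (w ∈_) (sym eq) (∈-++⁺ʳ T₁.K (here refl))
        ... | ()
        -- A single vertex q between the tips forms a 4-cycle with them and e.
        shape (q ∷ []) eq = no-4-cycle v₁≢v₂ (D≢C De (proj₁ (mid-P (subst (q ∈_) eq (here refl)))))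
          (~-sym e~v₁) (proj₁ ip′) (~-sym e~v₂) (~-sym (proj₁ (proj₂ (proj₂ ip′))))
          where
          ip′ : Induced (T₁.v ∷ q ∷ [ T₂.v ])
          ip′ = subst (λ l → Induced (T₁.v ∷ l ++ [ T₂.v ])) (sym eq) ip
        shape (q ∷ m ∷ rest) eq = third-neighbour (deg≥3 (proj₁ (mid-P m∈mid)) q (headOr rest))
          where
          m∈mid : m ∈ mid
          m∈mid = subst (m ∈_) eq (there (here refl))
          ip′ : Induced ((q ∷ [ T₁.v ]) ʳ++ (m ∷ rest ++ [ T₂.v ]))
          ip′ = subst (λ l → Induced (T₁.v ∷ l ++ [ T₂.v ])) (sym eq) ip
          mid∈ : ∀ {t} → t ∈ q ∷ m ∷ rest → t ∈ mid
          mid∈ = subst (_ ∈_) eq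
          nonE : ∀ {t} → t ∈ q ∷ m ∷ rest → Non e t
          nonE p = D≢C De (proj₁ (mid-P (mid∈ p))) , mid-free (inj₁ De) (mid∈ p)
          closes : ∀ l → (∀ {t} → t ∈ l → Non e t) → Closes e (l ++ [ T₂.v ])
          closes [] _ = e~v₂
          closes (a ∷ []) non = non (here refl) , e~v₂
          closes (a ∷ c ∷ l) non = non (here refl) , closes (c ∷ l) (non ∘ there)
          -- The neighbour of m away from q, which is the second tip when nothing lies between.
          headOr : List V → V
          headOr [] = T₂.v
          headOr (a ∷ _) = a
          col-m : col m ≡ col T₁.v
          col-m = same-colour (proj₁ (proj₂ (proj₂ ip′))) (~-sym (proj₁ ip′))
          m≠e′ : col m ≢ col e
          m≠e′ eq′ = proper e~v₁ (sym (trans (sym col-m) eq′))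
          ends : ∀ {t} → t ∈ T₁.v ∷ (q ∷ m ∷ rest) ++ [ T₂.v ] → t ≡ T₁.v ⊎ (t ∈ q ∷ m ∷ rest ⊎ t ≡ T₂.v)
          ends (here p) = inj₁ p
          ends (there p) = inj₂ (∈-snoc (q ∷ m ∷ rest) p)
          all-P : ∀ {t} → t ∈ T₁.v ∷ (q ∷ m ∷ rest) ++ [ T₂.v ] → P t
          all-P p with ends p
          ... | inj₁ refl = T₁.inP (here refl)
          ... | inj₂ (inj₁ r) = mid-P (mid∈ r)
          ... | inj₂ (inj₂ refl) = T₂.inP (here refl)
          S′ : Sector e m (q ∷ [ T₁.v ]) (rest ++ [ T₂.v ])
          S′ = sector-at (q ∷ [ T₁.v ]) (rest ++ [ T₂.v ]) ip′ (e~v₁ , closes (q ∷ m ∷ rest) nonE) (λ ()) (nonempty rest) m≠e′ (proj₁ ∘ all-P)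
            where
            nonempty : ∀ l → l ++ [ T₂.v ] ≢ []
            nonempty [] ()
            nonempty (_ ∷ _) ()
          flat : ∀ {t} → t ∈ m ∷ (q ∷ [ T₁.v ]) ++ (rest ++ [ T₂.v ]) → t ∈ T₁.v ∷ (q ∷ m ∷ rest) ++ [ T₂.v ]
          flat (here p) = there (there (here p))
          flat (there (here p)) = there (here p)
          flat (there (there (here p))) = here p
          flat (there (there (there p))) = there (there (there p))
          only : ∀ {z t} → Contact b z → z ≢ e → t ∈ m ∷ (q ∷ [ T₁.v ]) ++ (rest ++ [ T₂.v ]) → z ~ t → t ≡ T₂.v
          only ct z≢e p z~t with ends (flat p)
          ... | inj₂ (inj₂ eq′) = eq′
          ... | inj₂ (inj₁ r) = ⊥-elim (mid-free ct (mid∈ r) z~t)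
          only (inj₁ Dz) z≢e p z~t | inj₁ refl = ⊥-elim (z≢e (sole Dz z~t))
          -- A vertex of N(b) at the first tip would give that tip the colour of b.
          only (inj₂ (_ , b~z)) z≢e p z~t | inj₁ refl = ⊥-elim (three-colours (proper b~z) (λ eq′ → Sector.m≠e S (sym (trans eq′ v₁≡g))) (proper z~t))
          third-neighbour : (∃ λ u → m ~ u × u ≢ q × u ≢ headOr rest) → ⊥
          third-neighbour (u , m~u , u≢q , u≢h) with nbr (proj₁ (mid-P m∈mid)) m~u
          ... | inj₂ Du = mid-free (inj₁ Du) m∈mid (~-sym m~u)
          ... | inj₁ Cu = Branch.no-branch Db De b≢e S′ (λ p → proj₂ (all-P (flat p))) {T₂.v} (∈-++⁺ʳ rest (here refl)) e~v₂ only
              u m~u Cu (λ b~u → mid-free (inj₂ (Cu , b~u)) m∈mid (~-sym m~u))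
              (λ e~u → three-colours (proper m~u) m≠e′ (proper e~u ∘ sym)) u≢q (right rest u≢h)
            where
            right : ∀ l → u ≢ headOr l → HeadsDiffer [ u ] (l ++ [ T₂.v ])
            right [] ne = ne
            right (_ ∷ _) ne = ne

    module Lone {b : V} (ring : Ring b) {x : V} (F : Contacts.FirstContact ring x) where
      open Contacts ring
      open Tip F

      module _ (v≁pL : ¬ v ~ pL) (v≁pR : ¬ v ~ pR) (v≡b : col v ≡ col b) where

        private
          module Here = Half.Foot ring F v≁pL v≁pR v≡b
          module Mirror = Half.Foot (Ring-swap ring) (FirstContact-swap ring F) v≁pR v≁pL v≡b

          left-end : ∀ {z s} → D z → z ~ v → ¬ b ~ z → s ∈ L → z ~ s → ∃ λ L′ → L ≡ s ∷ L′
          left-end {s = s} Dz z~v b≁z s∈ z~s with ∈-∃++ s∈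
          ... | L₁ , L₂ , eq with Mirror.foot Dz z~v b≁z L₁ L₂ eq z~s
          ...   | refl = L₂ , eq

          same-head : ∀ {s t : V} {A B l} → l ≡ s ∷ A → l ≡ t ∷ B → s ≡ t
          same-head refl refl = refl

        left-eta : ∀ {z z′ s} → D z → z ~ v → ¬ b ~ z → s ∈ L → z ~ s → D z′ → z′ ~ v → z ≢ z′ → ⊥
        left-eta Dz z~v b≁z s∈ z~s Dz′ z′~v z≢z′ with left-end Dz z~v b≁z s∈ z~s
        ... | L′ , eq = Here.eta-pair eq Dz z~v b≁z z~s Dz′ z′~v z≢z′
          λ t∈ z′~t b≁z′ → same-head (proj₂ (left-end Dz′ z′~v b≁z′ t∈ z′~t)) eq

        right-single : ∀ {e s} → D e → e ~ v → s ∈ R → e ~ s → (∀ {z} → D z → z ~ v → z ≡ e) →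
          ∀ x₂ → w ~ x₂ → x₂ ≢ x → x₂ ≢ g → P x₂ → ⊥
        right-single De e~v s∈ e~s sole with ∈-∃++ s∈
        ... | R₁ , R₂ , eq = Here.single-mark R₁ R₂ eq De e~v e~s sole

    -- Every tip yields a leg, and no ring exists

    module _ {b : V} (ring : Ring b) where
      open Contacts ring

      -- Either v sees an end of the ring itself, or each vertex of D at v does. In the second case
      -- all of them are kept, because the other branch decides which one to use.
      data Kind {x : V} (F : FirstContact x) : Set where
        direct : let open FirstContact F in col v ≡ col b → Leg′ ring (v ∷ K) → Kind F
        marked : let open FirstContact F in col v ≡ col g → (∃ λ c → D c × c ~ v) →
          (∀ {c} → D c → c ~ v → Leg′ ring (c ∷ v ∷ K)) → Kind F

      -- A tip of the colour of b that sees neither end of the ring is refuted, by `eta-pair` if it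
      -- has two neighbours in D and by `single-mark`, with x₂ as second branch, if it has one. At a
      -- tip of the colour of g, `unmarked` forces each neighbour in D to attach to the ring at pL
      -- or pR.
      kind : ∀ {x} (F : FirstContact x) x₂ → w ~ x₂ → x₂ ≢ x → x₂ ≢ g → P x₂ → Kind F
      kind {x} F x₂ w~x₂ x₂≢x x₂≢g Px₂ = by-ends (v ~? pL) (v ~? pR)
        where
        open Tip F
        F′ = FirstContact-swap ring F
        near-b : ∀ {p} → b ~ p → v ~ p → col v ≡ col b
        near-b b~p v~p = same-colour (~-sym v~p) (~-sym b~p)
        by-ends : Dec (v ~ pL) → Dec (v ~ pR) → Kind F
        by-ends (yes e) _ = direct (near-b b~pL e) (inj₁ (Legs.direct-leg ring F e))
        by-ends (no _) (yes e) = direct (near-b b~pR e) (inj₂ (Legs.direct-leg (Ring-swap ring) F′ e))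
        by-ends (no v≁pL) (no v≁pR) = by-colour (col v Bool.≟ col b)
          where
          open Clean v≁pL v≁pR
          mark : ∃ λ z → D z × z ~ v
          mark with contact
          ... | z , inj₁ Dz , e = z , Dz , e
          ... | z , inj₂ (Cz , b~z) , e = ⊥-elim (no-direct Cz b~z e)
          by-colour : Dec (col v ≡ col b) → Kind F
          by-colour (yes v≡b) = ⊥-elim (lone (proj₁ mark) (proj₁ (proj₂ mark)) (proj₂ (proj₂ mark)))
            where
            module M = Lone ring F
            module M′ = Lone (Ring-swap ring) F′
            eta : ∀ {z z′} → D z → z ~ v → ¬ b ~ z → D z′ → z′ ~ v → z ≢ z′ → ⊥
            eta Dz z~v b≁z Dz′ z′~v z≢z′ with mark-of Dz z~v
            ... | s , s∈ , z~s with ∈-++⁻ L s∈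
            ...   | inj₁ s∈L = M.left-eta v≁pL v≁pR v≡b Dz z~v b≁z s∈L z~s Dz′ z′~v z≢z′
            ...   | inj₂ s∈R = M′.left-eta v≁pR v≁pL v≡b Dz z~v b≁z s∈R z~s Dz′ z′~v z≢z′
            lone : ∀ z → D z → z ~ v → ⊥
            lone z Dz z~v with any? (λ z′ → D? z′ ×-dec (z′ ~? v) ×-dec ¬? (z ≟ z′))
            ... | yes (z′ , Dz′ , z′~v , z≢z′) with b ~? z | b ~? z′
            ...   | no b≁z | _ = eta Dz z~v b≁z Dz′ z′~v z≢z′
            ...   | yes _ | no b≁z′ = eta Dz′ z′~v b≁z′ Dz z~v (z≢z′ ∘ sym)
            ...   | yes b~z | yes b~z′ = no-4-cycle (C≢D Cv Db) z≢z′ (~-sym z~v) (~-sym z′~v) b~z b~z′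
            lone z Dz z~v | no none with mark-of Dz z~v
            ...   | s , s∈ , z~s with ∈-++⁻ L s∈
            ...     | inj₂ s∈R = M.right-single v≁pL v≁pR v≡b Dz z~v s∈R z~s sole x₂ w~x₂ x₂≢x x₂≢g Px₂
              where
              sole : ∀ {y} → D y → y ~ v → y ≡ z
              sole {y} Dy e with z ≟ y
              ... | yes p = sym p
              ... | no ne = ⊥-elim (none (y , Dy , e , ne))
            ...     | inj₁ s∈L = M′.right-single v≁pR v≁pL v≡b Dz z~v s∈L z~s sole x₂ w~x₂ x₂≢x x₂≢g Px₂
              where
              sole : ∀ {y} → D y → y ~ v → y ≡ z
              sole {y} Dy e with z ≟ y
              ... | yes p = sym p
              ... | no ne = ⊥-elim (none (y , Dy , e , ne))
          by-colour (no v≠b) = marked v≡g mark leg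
            where
            v≡g : col v ≡ col g
            v≡g = two-colours (v≠b ∘ sym) (m≠e ∘ sym)
            leg : ∀ {c} → D c → c ~ v → Leg′ ring (c ∷ v ∷ K)
            leg {c} Dc c~v with mark-of Dc c~v
            ... | s , s∈ , c~s with b ~? s
            ...   | no b≁s = ⊥-elim (unmarked Dc (there s∈) b≁s (λ e → v≠b (trans (same-colour c~v c~s) e)) c~s)
            ...   | yes b~s with ∈-++⁻ L s∈
            ...     | inj₁ p with ∈-snoc Li p
            ...       | inj₁ q = ⊥-elim (b≁Li q b~s)
            ...       | inj₂ refl = inj₁ (Legs.mark-leg ring F v≡g Dc c~v c~s)
            leg {c} Dc c~v | s , s∈ , c~s | yes b~s | inj₂ p with ∈-snoc Ri p
            ...       | inj₁ q = ⊥-elim (b≁Ri q b~s)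
            ...       | inj₂ refl = inj₂ (Legs.mark-leg (Ring-swap ring) F′ v≡g Dc c~v c~s)

      private
        module _ {x₁ x₂ : V} (F₁ : FirstContact x₁) (F₂ : FirstContact x₂) where
          module T₁ = Tip F₁
          module T₂ = Tip F₂

          mark-apart : ∀ {c} → D c → ¬ c ~ T₂.v → NonAll c (T₂.v ∷ T₂.K)
          mark-apart Dc c≁v (here refl) = D≢C Dc T₂.Cv , c≁v
          mark-apart Dc c≁v (there p) = D≢C Dc (proj₁ (T₂.inP (there p))) , T₂.clear (inj₁ Dc) p

          -- The vertex c has the colour of the direct tip, so it cannot see that tip and the legs
          -- are anticomplete.
          direct-marked : Anti (T₁.v ∷ T₁.K) (T₂.v ∷ T₂.K) →
            col T₁.v ≡ col b → Leg′ ring (T₁.v ∷ T₁.K) →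
            col T₂.v ≡ col g → (∃ λ c → D c × c ~ T₂.v) → (∀ {c} → D c → c ~ T₂.v → Leg′ ring (c ∷ T₂.v ∷ T₂.K)) → ⊥
          direct-marked apart v₁≡b l₁ v₂≡g (c , Dc , c~v₂) legs =
            no-two-legs ring l₁ (legs Dc c~v₂) (Anti-sym (Anti-∷ c-apart (Anti-sym apart)))
            where
            c-apart : NonAll c (T₁.v ∷ T₁.K)
            c-apart (here refl) = D≢C Dc T₁.Cv , λ e → three-colours (proper c~v₂) (proper e)
              (λ q → m≠e (trans (sym v₂≡g) (trans q v₁≡b)))
            c-apart (there p) = D≢C Dc (proj₁ (T₁.inP (there p))) , T₁.clear (inj₁ Dc) p

      -- Two further neighbours of w start two branches, and anticomplete legs are contradictory.
      -- Legs can be chosen so unless every vertex of D at one marked tip also sees the other; then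
      -- there is only one such vertex and `shared-mark` applies.
      no-ring : ⊥
      no-ring with deg≥3 Cw g g
      ... | x₁ , w~x₁ , x₁≢g , _ with deg≥3 Cw g x₁
      ...   | x₂ , w~x₂ , x₂≢g , x₂≢x₁ = resolve (kind F₁ x₂ w~x₂ x₂≢x₁ x₂≢g (child w~x₂)) (kind F₂ x₁ w~x₁ (x₂≢x₁ ∘ sym) x₁≢g (child w~x₁))
        where
        child : ∀ {y} → w ~ y → P y
        child {y} e with nbr Cw e
        ... | inj₂ Dy = ⊥-elim (w-free (inj₁ Dy) (~-sym e))
        ... | inj₁ Cy = Cy , λ b~y → w-free (inj₂ (Cy , b~y)) (~-sym e)
        F₁ = first-contact x₁ w~x₁ x₁≢g (child w~x₁)
        F₂ = first-contact x₂ w~x₂ x₂≢g (child w~x₂)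
        module T₁′ = Tip F₁
        module T₂′ = Tip F₂
        apart : Anti (T₁′.v ∷ T₁′.K) (T₂′.v ∷ T₂′.K)
        apart = Pair.branches-apart ring (x₂≢x₁ ∘ sym) F₁ F₂
        -- Two vertices of D seen by both tips would form a 4-cycle with them.
        sole-mark : ∀ {v v′ e} → v ≢ v′ → D e → e ~ v → (∀ {c} → D c → c ~ v → c ~ v′) → ∀ {z} → D z → z ~ v → z ≡ e
        sole-mark {e = e} v≢v′ De e~v all {z} Dz z~v with z ≟ e
        ... | yes p = p
        ... | no z≢e = ⊥-elim (no-4-cycle v≢v′ z≢e (~-sym z~v) (~-sym e~v) (~-sym (all Dz z~v)) (~-sym (all De e~v)))
        separating? : ∀ v v′ → (∃ λ c → D c × c ~ v × ¬ c ~ v′) ⊎ (∀ {c} → D c → c ~ v → c ~ v′)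
        separating? v v′ with any? (λ c → D? c ×-dec (c ~? v) ×-dec ¬? (c ~? v′))
        ... | yes found = inj₁ found
        ... | no none = inj₂ every
          where
          every : ∀ {c} → D c → c ~ v → c ~ v′
          every {c} Dc e with c ~? v′
          ... | yes e′ = e′
          ... | no ne = ⊥-elim (none (c , Dc , e , ne))
        v₁≢v₂ : T₁′.v ≢ T₂′.v
        v₁≢v₂ = proj₁ (apart (here refl) (here refl))
        resolve : Kind F₁ → Kind F₂ → ⊥
        resolve (direct _ l₁) (direct _ l₂) = no-two-legs ring l₁ l₂ apart
        resolve (direct c₁ l₁) (marked c₂ m₂ l₂) = direct-marked F₁ F₂ apart c₁ l₁ c₂ m₂ l₂
        resolve (marked c₁ m₁ l₁) (direct c₂ l₂) = direct-marked F₂ F₁ (Anti-sym apart) c₂ l₂ c₁ m₁ l₁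
        resolve (marked v₁≡g (e₁ , De₁ , e₁~v₁) l₁) (marked v₂≡g (e₂ , De₂ , e₂~v₂) l₂)
          with separating? T₁′.v T₂′.v | separating? T₂′.v T₁′.v
        ... | inj₂ all | _ = Pair.shared-mark ring (x₂≢x₁ ∘ sym) F₁ F₂ v₁≡g v₂≡g De₁ e₁~v₁ (all De₁ e₁~v₁) (sole-mark v₁≢v₂ De₁ e₁~v₁ all)
        ... | inj₁ _ | inj₂ all = Pair.shared-mark ring x₂≢x₁ F₂ F₁ v₂≡g v₁≡g De₂ e₂~v₂ (all De₂ e₂~v₂) (sole-mark (v₁≢v₂ ∘ sym) De₂ e₂~v₂ all)
        ... | inj₁ (c₁ , Dc₁ , c₁~v₁ , c₁≁v₂) | inj₁ (c₂ , Dc₂ , c₂~v₂ , c₂≁v₁) =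
          no-two-legs ring (l₁ Dc₁ c₁~v₁) (l₂ Dc₂ c₂~v₂)
            (Anti-∷ (λ { (here refl) → c₁-c₂ ; (there p) → mark-apart F₁ F₂ Dc₁ c₁≁v₂ p })
              (Anti-sym (Anti-∷ (mark-apart F₂ F₁ Dc₂ c₂≁v₁) (Anti-sym apart))))
          where
          c₁-c₂ : Non c₁ c₂
          c₁-c₂ = (λ { refl → c₁≁v₂ c₂~v₂ }) ,
            λ e → three-colours (proper e) (proper c₁~v₁) (λ q → proper c₂~v₂ (trans q (trans v₁≡g (sym v₂≡g))))

    -- A shortest path between two neighbours of a vertex of D gives a ring

    NoShortSector : ℕ → Set
    NoShortSector N = ∀ {c} x l y → D c → Walk (x ∷ l ++ [ y ]) → (∀ {t} → t ∈ x ∷ l ++ [ y ] → C t) →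
      c ~ x → c ~ y → x ≢ y → length l < N → ⊥

    private
      length-split : ∀ {l : List V} A s B → l ≡ A ++ s ∷ B → length l ≡ suc (length A + length B)
      length-split A s B refl = trans (length-++ A) (ℕ.+-suc (length A) (length B))

    -- The bound N counts interior vertices: on a walk of at most N + 1 vertices, fewer than N lie
    -- between two neighbours of c.
    no-two-marks : ∀ {N c} → NoShortSector N → D c → ∀ ws → Walk ws → (∀ {t} → t ∈ ws → C t) → length ws ≤ suc N →
      ∀ {s t} → s ∈ ws → t ∈ ws → s ≢ t → c ~ s → c ~ t → ⊥
    no-two-marks {N} {c} short Dc (a ∷ ws) wk inC (s≤s le) = λ where
        (here refl) (here refl) s≢t c~s c~t → s≢t refl
        (here refl) (there q) s≢t c~s c~t → from-head q s≢t c~s c~t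
        (there p) (here refl) s≢t c~s c~t → from-head p (s≢t ∘ sym) c~t c~s
        (there p) (there q) → no-two-marks short Dc ws (Walk-tail ws wk) (inC ∘ there) (ℕ.m≤n⇒m≤1+n le) p q
      where
      Walk-tail : ∀ ws → Walk (a ∷ ws) → Walk ws
      Walk-tail [] _ = tt
      Walk-tail (_ ∷ _) (_ , wk) = wk
      from-head : ∀ {t} → t ∈ ws → a ≢ t → c ~ a → c ~ t → ⊥
      from-head {t} p a≢t c~a c~t with ∈-∃++ p
      ... | A , B , eq = short a A t Dc
          (Walk-++ˡ (a ∷ A ++ [ t ]) (subst (λ l → Walk (a ∷ l)) eq′ wk))
          (λ q → inC (subst (λ l → _ ∈ a ∷ l) (sym eq′) (∈-++⁺ˡ q))) c~a c~t a≢t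
          (ℕ.≤-trans (s≤s (ℕ.m≤m+n (length A) (length B))) (subst (_≤ N) (length-split A t B eq) le))
        where
        eq′ : ws ≡ (A ++ [ t ]) ++ B
        eq′ = trans eq (sym (++-assoc A [ t ] B))

    -- The path has exactly `3 + length q` interior vertices, the bound below which `short` excludes
    -- paths for all vertices of D, not only b. Each condition of `Ring` is checked by exhibiting a
    -- shorter path, a 4-cycle or an odd theta.
    module Minimal {b : V} (Db : D b) (p₀ p₁ g r₁ : V) (q : List V) (pₖ : V)
      (ip : Induced (p₀ ∷ p₁ ∷ g ∷ r₁ ∷ q ++ [ pₖ ])) (inC : ∀ {t} → t ∈ p₀ ∷ p₁ ∷ g ∷ r₁ ∷ q ++ [ pₖ ] → C t)
      (b~p₀ : b ~ p₀) (b~pₖ : b ~ pₖ) (short : NoShortSector (3 + length q)) where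

      private
        inner ps R Y : List V
        inner = p₁ ∷ g ∷ r₁ ∷ q
        ps = p₀ ∷ inner ++ [ pₖ ]
        R = (r₁ ∷ q) ++ [ pₖ ]
        Y = g ∷ (p₁ ∷ [ p₀ ]) ++ R

        Y⊆ps : ∀ {t} → t ∈ Y → t ∈ ps
        Y⊆ps (here e) = there (there (here e))
        Y⊆ps (there (here e)) = there (here e)
        Y⊆ps (there (there (here e))) = here e
        Y⊆ps (there (there (there p))) = there (there (there p))

        ps⊆Y : ∀ {t} → t ∈ ps → t ∈ Y
        ps⊆Y (here e) = there (there (here e))
        ps⊆Y (there (here e)) = there (here e)
        ps⊆Y (there (there (here e))) = here e
        ps⊆Y (there (there (there p))) = there (there (there p))

        inner-cut : ∀ {t} → t ∈ inner → ∃₂ λ A B → inner ≡ A ++ t ∷ B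
        inner-cut = ∈-∃++

        -- An interior neighbour of b would cut off a shorter path starting at p₀.
        b≁inner : ∀ {t} → t ∈ inner → ¬ b ~ t
        b≁inner {t} p b~t with inner-cut p
        ... | A , B , eq = short p₀ A t Db (Induced⇒Walk _ ipA) (λ r → inC (subst (λ l → _ ∈ p₀ ∷ l) (sym eq′) (∈-++⁺ˡ r))) b~p₀ b~t
            (Induced-ends-≢ A ipA) (subst (suc (length A) ≤_) (sym (length-split A t B eq)) (s≤s (ℕ.m≤m+n (length A) (length B))))
          where
          eq′ : inner ++ [ pₖ ] ≡ (A ++ [ t ]) ++ B ++ [ pₖ ]
          eq′ = trans (cong (_++ [ pₖ ]) eq) (trans (++-assoc A (t ∷ B) [ pₖ ]) (sym (++-assoc A [ t ] (B ++ [ pₖ ]))))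
          ipA : Induced (p₀ ∷ A ++ [ t ])
          ipA = Induced-++ˡ (p₀ ∷ A ++ [ t ]) (subst (λ l → Induced (p₀ ∷ l)) eq′ ip)

        b-inner : ∀ {t} → t ∈ inner → Non b t
        b-inner p = D≢C Db (inC (there (∈-++⁺ˡ p))) , b≁inner p

        closes : ∀ l → (∀ {t} → t ∈ l → Non b t) → Closes b (l ++ [ pₖ ])
        closes [] _ = b~pₖ
        closes (a ∷ []) non = non (here refl) , b~pₖ
        closes (a ∷ c ∷ l) non = non (here refl) , closes (c ∷ l) (non ∘ there)

        rim : Rim b ps
        rim = b~p₀ , closes inner b-inner

        g≠b : col g ≢ col b
        g≠b e = proper b~p₀ (trans (sym e) (same-colour (proj₁ (proj₂ (proj₂ ip))) (~-sym (proj₁ ip))))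

        S : Sector b g (p₁ ∷ [ p₀ ]) R
        S = sector-at (p₁ ∷ [ p₀ ]) R ip rim (λ ()) (λ ()) g≠b inC

        interior : ∀ {t} → t ∈ ps → ¬ b ~ t → t ∈ inner
        interior (here refl) b≁t = ⊥-elim (b≁t b~p₀)
        interior (there p) b≁t with ∈-snoc inner p
        ... | inj₁ q′ = q′
        ... | inj₂ refl = ⊥-elim (b≁t b~pₖ)

        p₀≢pₖ : p₀ ≢ pₖ
        p₀≢pₖ = Induced-ends-≢ inner ip

        unique : ∀ {c s t} → D c → c ≢ b → s ∈ ps → t ∈ ps → s ≢ t → c ~ s → c ~ t → ⊥
        unique {c} Dc c≢b s∈ t∈ s≢t c~s c~t with c ~? p₀ | c ~? pₖ
        ... | yes e | yes e′ = no-4-cycle c≢b p₀≢pₖ e e′ b~p₀ b~pₖ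
        ... | no ne | _ = no-two-marks short Dc (inner ++ [ pₖ ]) (Induced⇒Walk _ (Induced-tail _ ip)) (inC ∘ there)
                (ℕ.≤-reflexive (trans (length-++ inner) (ℕ.+-comm (length inner) 1))) (drop s∈ c~s) (drop t∈ c~t) s≢t c~s c~t
          where
          drop : ∀ {u} → u ∈ ps → c ~ u → u ∈ inner ++ [ pₖ ]
          drop (here refl) e = ⊥-elim (ne e)
          drop (there p) _ = p
        ... | yes _ | no ne = no-two-marks short Dc (p₀ ∷ inner) (Induced⇒Walk _ (Induced-++ˡ (p₀ ∷ inner) ip)) (inC ∘ ∈-++⁺ˡ)
                ℕ.≤-refl (drop s∈ c~s) (drop t∈ c~t) s≢t c~s c~t
          where
          drop : ∀ {u} → u ∈ ps → c ~ u → u ∈ p₀ ∷ inner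
          drop p e with ∈-snoc (p₀ ∷ inner) p
          ... | inj₁ r = r
          ... | inj₂ refl = ⊥-elim (ne e)

        -- With s as centre, c is reached in one step and sees nothing else of the path, so `escape`
        -- completes an odd theta with ends s and b.
        unmarked : ∀ {c s} → D c → s ∈ ps → ¬ b ~ s → col s ≢ col b → c ~ s → ⊥
        unmarked {c} {s} Dc s∈ b≁s s≠b c~s with inner-cut (interior s∈ b≁s)
        ... | A , B , eq = escape S′ Db [] c (c~s , (λ ()) , tt) (λ ()) (λ _ ()) (λ _ ()) Dc c≢b
            (λ p → away (left p)) (λ p → away (right p))
          where
          c≢b : c ≢ b
          c≢b refl = b≁s c~s
          shape : reverse (p₀ ∷ A) ʳ++ (s ∷ B ++ [ pₖ ]) ≡ ps
          shape = trans (ʳ++-defn (reverse (p₀ ∷ A))) (trans (cong (_++ s ∷ B ++ [ pₖ ]) (reverse-involutive (p₀ ∷ A)))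
            (cong (p₀ ∷_) (sym (trans (cong (_++ [ pₖ ]) eq) (++-assoc A (s ∷ B) [ pₖ ])))))
          ip′ : Induced ((p₀ ∷ A) ++ s ∷ B ++ [ pₖ ])
          ip′ = subst Induced (cong (p₀ ∷_) (trans (cong (_++ [ pₖ ]) eq) (++-assoc A (s ∷ B) [ pₖ ]))) ip
          nonempty : B ++ [ pₖ ] ≢ []
          nonempty e with subst (pₖ ∈_) e (∈-++⁺ʳ B (here refl))
          ... | ()
          S′ : Sector b s (reverse (p₀ ∷ A)) (B ++ [ pₖ ])
          S′ = sector-at (reverse (p₀ ∷ A)) (B ++ [ pₖ ]) (subst Induced (sym shape) ip) (subst (Rim b) (sym shape) rim)
            (reverse-≢[] (p₀ ∷ A) (here refl)) nonempty s≠b (λ p → inC (subst (_ ∈_) shape p))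
          away : ∀ {t} → t ∈ ps × t ≢ s → Non c t
          away (t∈ , t≢s) = D≢C Dc (inC t∈) , λ e → unique Dc c≢b t∈ s∈ t≢s e c~s
          left : ∀ {t} → t ∈ reverse (p₀ ∷ A) → t ∈ ps × t ≢ s
          left p = subst (_ ∈_) shape (∈-ʳ++⁺ˡ (reverse (p₀ ∷ A)) p) ,
            λ { refl → Induced-distinct (p₀ ∷ A) (Induced-++ˡ ((p₀ ∷ A) ++ [ s ]) (subst Induced (sym (++-assoc (p₀ ∷ A) [ s ] (B ++ [ pₖ ]))) ip′)) (unrev (p₀ ∷ A) p) }
          right : ∀ {t} → t ∈ B ++ [ pₖ ] → t ∈ ps × t ≢ s
          right p = subst (_ ∈_) shape (∈-ʳ++⁺ʳ (reverse (p₀ ∷ A)) (there p)) ,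
            λ { refl → Induced-≢ s (B ++ [ pₖ ]) (Induced-++ʳ (p₀ ∷ A) ip′) p refl }

        -- From z through s the path leads to pₖ with fewer interior vertices, unless s is p₁; in
        -- that case b, p₀, p₁ and z form a 4-cycle.
        outer : ∀ {z s} → C z → b ~ z → ¬ z ∈ Y → s ∈ Y → ¬ b ~ s → z ~ s → ⊥
        outer {z} {s} Cz b~z z∉ s∈ b≁s z~s with inner-cut (interior (Y⊆ps s∈) b≁s)
        ... | [] , B , refl = no-4-cycle (D≢C Db (inC (Y⊆ps s∈))) (λ { refl → z∉ (ps⊆Y (here refl)) }) b~z b~p₀ (~-sym z~s) (~-sym (proj₁ ip))
        ... | A@(a ∷ A′) , B , eq = short z (s ∷ B) pₖ Db (z~s , Induced⇒Walk _ suffix)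
            (λ { (here refl) → Cz ; (there p) → inC (there (tail⊆ p)) }) b~z b~pₖ
            (λ { refl → z∉ (ps⊆Y (there (∈-++⁺ʳ inner (here refl)))) })
            (subst (suc (suc (length B)) ≤_) (sym (length-split A s B eq)) (s≤s (s≤s (ℕ.m≤n+m (length B) (length A′)))))
          where
          eq′ : inner ++ [ pₖ ] ≡ A ++ s ∷ B ++ [ pₖ ]
          eq′ = trans (cong (_++ [ pₖ ]) eq) (++-assoc A (s ∷ B) [ pₖ ])
          tail⊆ : ∀ {t} → t ∈ s ∷ B ++ [ pₖ ] → t ∈ inner ++ [ pₖ ]
          tail⊆ {t} p = subst (t ∈_) (sym eq′) (∈-++⁺ʳ A p)
          suffix : Induced (s ∷ B ++ [ pₖ ])
          suffix = Induced-++ʳ A (subst Induced eq′ (Induced-tail _ ip))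

      module _ {w : V} (g~w : g ~ w) (w≢p₁ : w ≢ p₁) (w≢r₁ : w ≢ r₁) where
        private
          p₀~p₁ : p₀ ~ p₁
          p₀~p₁ = proj₁ ip
          p₁~g : p₁ ~ g
          p₁~g = proj₁ (proj₂ (proj₂ ip))
          p₀≁g : Non p₀ g
          p₀≁g = proj₁ (proj₂ ip) (here refl)
          ip-g : Induced (g ∷ R)
          ip-g = proj₂ (proj₂ (proj₂ (proj₂ ip)))
          g~r₁ : g ~ r₁
          g~r₁ = proj₁ ip-g
          ip-R : Induced R
          ip-R = proj₂ (proj₂ ip-g)

          b≁g : ¬ b ~ g
          b≁g = b≁inner (there (here refl))

          Cw : C w
          Cw with nbr (inC (Y⊆ps (here refl))) g~w
          ... | inj₁ c = c
          ... | inj₂ d = ⊥-elim (unmarked d (Y⊆ps (here refl)) b≁g g≠b (~-sym g~w))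

          b≁w : ¬ b ~ w
          b≁w e = three-colours (proper g~w) g≠b (proper e ∘ sym)

          wL : NonAll w (p₁ ∷ [ p₀ ])
          wL (here refl) = w≢p₁ , λ e → proper e (same-colour g~w (~-sym p₁~g))
          wL (there (here refl)) = (λ { refl → proj₂ p₀≁g (~-sym g~w) }) ,
            λ e → no-4-cycle (proj₁ p₀≁g) (w≢p₁ ∘ sym) p₀~p₁ (~-sym e) (~-sym p₁~g) g~w

          r₁-C4 : ∀ {t} → t ∈ q ++ [ pₖ ] → r₁ ~ t → ¬ w ~ t
          r₁-C4 p e e′ = no-4-cycle (proj₁ (proj₁ (proj₂ ip-g) p)) (w≢r₁ ∘ sym) g~r₁ g~w (~-sym e) (~-sym e′)

          -- An edge from w to t replaces the stretch between g and t by w alone and shortens the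
          -- path, unless t follows r₁; then g, r₁, t and w form a 4-cycle.
          far : ∀ {t} → t ∈ q ++ [ pₖ ] → t ∈ q ⊎ t ≡ pₖ → ¬ w ~ t
          far p (inj₂ refl) e = last q refl
            where
            last : ∀ l → l ≡ q → ⊥
            last [] eq = r₁-C4 p (proj₁ (subst (λ l → Induced (r₁ ∷ l ++ [ pₖ ])) (sym eq) ip-R)) e
            last (_ ∷ l) eq = short p₀ (p₁ ∷ g ∷ [ w ]) pₖ Db (p₀~p₁ , p₁~g , g~w , e , tt)
              (λ { (here refl) → inC (here refl) ; (there (here refl)) → inC (there (here refl)) ; (there (there (here refl))) → inC (there (there (here refl)))
                 ; (there (there (there (here refl)))) → Cw ; (there (there (there (there (here refl))))) → inC (there (∈-++⁺ʳ inner (here refl))) })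
              b~p₀ b~pₖ p₀≢pₖ (subst (λ l → 4 ≤ 3 + length l) eq (s≤s (s≤s (s≤s (s≤s z≤n)))))
          far {t} p (inj₁ p′) e with ∈-∃++ p′
          ... | [] , B , eq = r₁-C4 p (proj₁ (subst (λ l → Induced (r₁ ∷ l ++ [ pₖ ])) eq ip-R)) e
          ... | A@(_ ∷ A′) , B , eq = short p₀ (p₁ ∷ g ∷ w ∷ t ∷ B) pₖ Db (p₀~p₁ , p₁~g , g~w , e , Induced⇒Walk _ suffix)
              (λ { (here refl) → inC (here refl) ; (there (here refl)) → inC (there (here refl)) ; (there (there (here refl))) → inC (there (there (here refl)))
                 ; (there (there (there (here refl)))) → Cw
                 ; (there (there (there (there r)))) → inC (there (there (there (there (subst (_ ∈_) (sym eq′) (∈-++⁺ʳ A r)))))) })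
              b~p₀ b~pₖ p₀≢pₖ
              (subst (λ k → 5 + length B ≤ 3 + k) (sym (length-split A t B eq)) (s≤s (s≤s (s≤s (s≤s (s≤s (ℕ.m≤n+m (length B) (length A′))))))))
            where
            eq′ : q ++ [ pₖ ] ≡ A ++ t ∷ B ++ [ pₖ ]
            eq′ = trans (cong (_++ [ pₖ ]) eq) (++-assoc A (t ∷ B) [ pₖ ])
            suffix : Induced (t ∷ B ++ [ pₖ ])
            suffix = Induced-++ʳ A (subst Induced eq′ (Induced-tail _ ip-R))

          wR : NonAll w R
          wR (here refl) = w≢r₁ , λ e → proper e (same-colour g~w g~r₁)
          wR (there p) = (λ { refl → proj₂ (proj₁ (proj₂ ip-g) p) g~w }) , far p (∈-snoc q p)

          -- The path from w through g to s has fewer interior vertices than the minimal one; at g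
          -- itself `unmarked` applies.
          cw : ∀ {c s} → D c → c ~ w → s ∈ Y → c ~ s → ⊥
          cw Dc c~w (here refl) c~s = unmarked Dc (Y⊆ps (here refl)) b≁g g≠b c~s
          cw Dc c~w (there (here refl)) c~s = short w [ g ] p₁ Dc (~-sym g~w , ~-sym p₁~g , tt)
            (λ { (here refl) → Cw ; (there (here refl)) → inC (Y⊆ps (here refl)) ; (there (there (here refl))) → inC (there (here refl)) })
            c~w c~s w≢p₁ (s≤s (s≤s z≤n))
          cw Dc c~w (there (there (here refl))) c~s = short w (g ∷ [ p₁ ]) p₀ Dc (~-sym g~w , ~-sym p₁~g , ~-sym p₀~p₁ , tt)
            (λ { (here refl) → Cw ; (there (here refl)) → inC (Y⊆ps (here refl)) ; (there (there (here refl))) → inC (there (here refl))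
               ; (there (there (there (here refl)))) → inC (here refl) })
            c~w c~s (proj₁ (wL (there (here refl)))) (s≤s (s≤s (s≤s z≤n)))
          cw {c} {s} Dc c~w (there (there (there p))) c~s with ∈-∃++ p
          ... | A , B , eq = short w (g ∷ A) s Dc (~-sym g~w , Induced⇒Walk _ ip-gA)
              (λ { (here refl) → Cw ; (there r) → inC (there (there (subst (λ l → _ ∈ g ∷ l) (sym eq′) (∈-++⁺ˡ r)))) })
              c~w c~s (proj₁ (wR p)) bound
            where
            eq′ : R ≡ (A ++ [ s ]) ++ B
            eq′ = trans eq (sym (++-assoc A [ s ] B))
            ip-gA : Induced (g ∷ A ++ [ s ])
            ip-gA = Induced-++ˡ (g ∷ A ++ [ s ]) (subst (λ l → Induced (g ∷ l)) eq′ ip-g)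
            lengths : suc (length A + length B) ≡ suc (suc (length q))
            lengths = trans (sym (length-split A s B eq)) (trans (length-++ (r₁ ∷ q)) (ℕ.+-comm (length (r₁ ∷ q)) 1))
            bound : suc (suc (length A)) ≤ 3 + length q
            bound = s≤s (ℕ.≤-trans (s≤s (ℕ.m≤m+n (length A) (length B))) (ℕ.≤-reflexive lengths))

        ring : Ring b
        ring = record
          { Db = Db ; g = g ; w = w ; pL = p₀ ; pR = pₖ ; Li = [ p₁ ] ; Ri = r₁ ∷ q ; S = S ; b~pL = b~p₀ ; b~pR = b~pₖ
          ; b≁Li = λ { (here refl) → b≁inner (here refl) } ; b≁Ri = λ p → b≁inner (there (there p))
          ; unique = λ Dc ne s∈ t∈ → unique Dc ne (Y⊆ps s∈) (Y⊆ps t∈)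
          ; unmarked = λ Dc s∈ → unmarked Dc (Y⊆ps s∈)
          ; outer = outer ; g~w = g~w ; Cw = Cw ; b≁w = b≁w ; wL = wL ; wR = wR ; cw = cw }

      impossible : ⊥
      impossible with deg≥3 (inC (Y⊆ps (here refl))) p₁ r₁
      ... | w , g~w , w≢p₁ , w≢r₁ = no-ring (ring g~w w≢p₁ w≢r₁)

    private
      -- With at most two interior vertices the cycle through b has length 3, 4 or 5. From three on,
      -- the vertices p₁, g and r₁ exist.
      no-induced-sector : ∀ {b} → D b → ∀ x l y → Induced (x ∷ l ++ [ y ]) → (∀ {t} → t ∈ x ∷ l ++ [ y ] → C t) →
        b ~ x → b ~ y → NoShortSector (length l) → ⊥
      no-induced-sector Db x [] y (e , _) inC b~x b~y _ = three-colours (proper b~x) (proper b~y) (proper e)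
      no-induced-sector Db x (p ∷ []) y ip@(e , nx , e′ , _) inC b~x b~y _ =
        no-4-cycle (D≢C Db (inC (there (here refl)))) (Induced-ends-≢ [ p ] ip) b~x b~y (~-sym e) e′
      no-induced-sector Db x (p ∷ g ∷ []) y (e , _ , e′ , _ , e″ , _) inC b~x b~y _ =
        proper e′ (two-colours (proper e) (λ q → proper e″ (trans (sym q) (same-colour b~x b~y))))
      no-induced-sector Db x (p ∷ g ∷ r ∷ q) y ip inC b~x b~y short =
        Minimal.impossible Db x p g r q y ip inC b~x b~y short

      -- Induction on the bound takes the place of choosing b and the path minimal: after
      -- shortening, the hypothesis excludes all shorter paths for all vertices of D.
      no-sector-below : ∀ N → NoShortSector N
      no-sector-below (suc N) x l y Dc wk inC c~x c~y x≢y (s≤s le) with shortcut x l wk x≢y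
      ... | l′ , ip , sub , le′ = no-induced-sector Dc x l′ y ip inside c~x c~y
          λ x₁ l₁ y₁ Dc₁ wk₁ inC₁ e₁ e₂ ne lt → no-sector-below N x₁ l₁ y₁ Dc₁ wk₁ inC₁ e₁ e₂ ne (ℕ.≤-trans lt (ℕ.≤-trans le′ le))
        where
        inside : ∀ {t} → t ∈ x ∷ l′ ++ [ y ] → C t
        inside (here refl) = inC (here refl)
        inside (there p) with ∈-snoc l′ p
        ... | inj₁ q = inC (there (∈-++⁺ˡ (sub q)))
        ... | inj₂ refl = inC (there (∈-++⁺ʳ l (here refl)))

    no-sector : ∀ {c} x l y → D c → Walk (x ∷ l ++ [ y ]) → (∀ {t} → t ∈ x ∷ l ++ [ y ] → C t) → c ~ x → c ~ y → x ≢ y → ⊥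
    no-sector x l y Dc wk inC c~x c~y x≢y = no-sector-below (suc (length l)) x l y Dc wk inC c~x c~y x≢y ℕ.≤-refl

    -- Components of C

    data Reach : V → V → Set where
      stop : ∀ {u} → C u → Reach u u
      step : ∀ {u v w} → C u → u ~ v → Reach v w → Reach u w

    reach-trans : ∀ {u v w} → Reach u v → Reach v w → Reach u w
    reach-trans (stop _) r = r
    reach-trans (step c e r) r′ = step c e (reach-trans r r′)

    reach-start : ∀ {u v} → Reach u v → C u
    reach-start (stop c) = c
    reach-start (step c _ _) = c

    reach-sym : ∀ {u v} → Reach u v → Reach v u
    reach-sym (stop c) = stop c
    reach-sym (step c e r) = reach-trans (reach-sym r) (step (reach-start r) (~-sym e) (stop c))

    reach-walk : ∀ {x y} → Reach x y → x ≢ y → ∃ λ l → Walk (x ∷ l ++ [ y ]) × (∀ {t} → t ∈ x ∷ l ++ [ y ] → C t)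
    reach-walk (stop _) x≢y = ⊥-elim (x≢y refl)
    reach-walk {y = y} (step {v = v} c e r) _ with v ≟ y
    ... | yes refl = [] , (e , tt) , λ { (here refl) → c ; (there (here refl)) → reach-start r }
    ... | no v≢y with reach-walk r v≢y
    ...   | l , wk , inC = v ∷ l , (e , wk) , λ { (here refl) → c ; (there p) → inC p }

    reach-list : ∀ x l → Walk (x ∷ l) → (∀ {t} → t ∈ x ∷ l → C t) → ∀ {t} → t ∈ x ∷ l → Reach x t
    reach-list x l wk inC (here refl) = stop (inC (here refl))
    reach-list x (y ∷ l) (e , wk) inC (there p) = step (inC (here refl)) e (reach-list y l wk (inC ∘ there) p)

    at-most-one : ∀ {c x y} → D c → c ~ x → c ~ y → Reach x y → x ≡ y
    at-most-one {x = x} {y} Dc c~x c~y r with x ≟ y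
    ... | yes eq = eq
    ... | no ne with reach-walk r ne
    ...   | l , wk , inC = ⊥-elim (no-sector x l y Dc wk inC c~x c~y ne)

    -- A core in C contradicts having one neighbour per component

    module _ {b f : V} (Db : D b) (b~f : b ~ f) where
      private
        P : V → Set
        P v = C v × ¬ b ~ v

      -- In its component f is the only neighbour of b, so after leaving f a walk in the core stays
      -- in the forest C without N(b). It is an induced path there and must end, which happens when
      -- it meets a neighbour of f again.
      first-return : ∀ x T → (∀ {t} → t ∈ x ∷ T → C t) → Core (x ∷ T) → f ∈ x ∷ T →
        ∃ λ R → Induced R × Rim f R × (∀ {t} → t ∈ R → C t)
      first-return x T inC core f∈ = begin-walk (core f∈)
        where
        T′ = x ∷ T
        record State (v : V) (K : List V) : Set where
          field
            nb : NonBacktracking ((v ∷ K) ++ [ f ])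
            inT : ∀ {t} → t ∈ v ∷ K → t ∈ T′
            off : ∀ {t} → t ∈ v ∷ K → ¬ b ~ t
            closes : Closes f (v ∷ K)
            reach : Reach f v
        previous : List V → V
        previous [] = f
        previous (d ∷ _) = d
        not-f : ∀ {u v} K → Closes f (v ∷ K) → v ~ u → u ≢ previous K → f ≢ u
        not-f [] _ _ ne eq = ne (sym eq)
        not-f (_ ∷ _) ((_ , f≁v) , _) e _ refl = f≁v (~-sym e)
        grow : ∀ {u v} K → v ~ u → u ≢ previous K → NonBacktracking ((v ∷ K) ++ [ f ]) → NonBacktracking ((u ∷ v ∷ K) ++ [ f ])
        grow [] e ne nb = ~-sym e , ne , nb
        grow (d ∷ K) e ne nb = ~-sym e , ne , nb
        onward : ∀ {v} p → v ∈ T′ → ∃ λ u → u ∈ T′ × v ~ u × u ≢ p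
        onward p v∈ with core v∈
        ... | a , c , a∈ , c∈ , a≢c , e , e′ with a ≟ p
        ...   | no a≢p = a , a∈ , e , a≢p
        ...   | yes refl = c , c∈ , e′ , a≢c ∘ sym
        go : ∀ k v K → n ≤ k + length K → State v K → ∃ λ R → Induced R × Rim f R × (∀ {t} → t ∈ R → C t)
        go k v K le st with onward (previous K) (State.inT st (here refl))
        ... | u , u∈ , v~u , u≢p = continue k le (f ~? u)
          where
          open State st
          f≢u : f ≢ u
          f≢u = not-f K closes v~u u≢p
          reach-u : Reach f u
          reach-u = reach-trans reach (step (inC (inT (here refl))) v~u (stop (inC u∈)))
          b≁u : ¬ b ~ u
          b≁u e = f≢u (at-most-one Db b~f e reach-u)
          inT′ : ∀ {t} → t ∈ u ∷ v ∷ K → t ∈ T′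
          inT′ (here refl) = u∈
          inT′ (there p) = inT p
          off′ : ∀ {t} → t ∈ u ∷ v ∷ K → ¬ b ~ t
          off′ (here refl) = b≁u
          off′ (there p) = off p
          nb′ : NonBacktracking ((u ∷ v ∷ K) ++ [ f ])
          nb′ = grow K v~u u≢p nb
          ip : Induced (u ∷ v ∷ K)
          ip = NonBacktracking⇒Induced (forest Db) (u ∷ v ∷ K) (λ p → inC (inT′ p) , off′ p) (NonBacktracking-++ˡ (u ∷ v ∷ K) nb′)
          continue : ∀ k → n ≤ k + length K → Dec (f ~ u) → ∃ λ R → Induced R × Rim f R × (∀ {t} → t ∈ R → C t)
          continue k le (yes e) = u ∷ v ∷ K , ip , (e , closes) , inC ∘ inT′
          continue zero le (no _) = ⊥-elim (ℕ.<⇒≱ (ℕ.≤-trans (ℕ.n≤1+n _) (Induced-length (u ∷ v ∷ K) ip)) le)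
          continue (suc k) le (no f≁u) = go k u (v ∷ K) (subst (n ≤_) (sym (ℕ.+-suc k (length K))) le)
            record { nb = nb′ ; inT = inT′ ; off = off′ ; closes = (f≢u , f≁u) , closes ; reach = reach-u }
        begin-walk : (∃₂ λ a c → a ∈ T′ × c ∈ T′ × a ≢ c × f ~ a × f ~ c) → ∃ λ R → Induced R × Rim f R × (∀ {t} → t ∈ R → C t)
        begin-walk (a , _ , a∈ , _ , _ , f~a , _) = go n a [] (ℕ.m≤m+n n 0) record
          { nb = ~-sym f~a ; inT = λ { (here refl) → a∈ }
          ; off = λ { (here refl) e → ~⇒≢ f~a (at-most-one Db b~f e reach-a) }
          ; closes = f~a ; reach = reach-a }
          where
          reach-a : Reach f a
          reach-a = step (inC f∈) f~a (stop (inC a∈))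

      -- Apart from f the hole has at least five vertices, so y₃, three steps from f, is nonadjacent
      -- to f and of the other colour, and can be the centre of a sector with f in the role of e.
      module Hole′ (Cf : C f) (y₁ y₂ y₃ y₄ y₅ : V) (rest : List V)
        (ip : Induced (y₁ ∷ y₂ ∷ y₃ ∷ y₄ ∷ y₅ ∷ rest)) (rim : Rim f (y₁ ∷ y₂ ∷ y₃ ∷ y₄ ∷ y₅ ∷ rest))
        (inC : ∀ {t} → t ∈ y₁ ∷ y₂ ∷ y₃ ∷ y₄ ∷ y₅ ∷ rest → C t) where

        private
          R B : List V
          R = y₁ ∷ y₂ ∷ y₃ ∷ y₄ ∷ y₅ ∷ rest
          B = y₄ ∷ y₅ ∷ rest

          y₃∈ : y₃ ∈ R
          y₃∈ = there (there (here refl))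

          col-y₃ : col y₃ ≢ col f
          col-y₃ e = proper (proj₁ rim) (trans (sym e) (same-colour (proj₁ (proj₂ (proj₂ ip))) (~-sym (proj₁ ip))))

          S : Sector f y₃ (y₂ ∷ [ y₁ ]) B
          S = sector-at (y₂ ∷ [ y₁ ]) B ip rim (λ ()) (λ ()) col-y₃ inC

          reach-R : ∀ {t} → t ∈ f ∷ R → Reach f t
          reach-R = reach-list f R (proj₁ rim , Induced⇒Walk R ip) (λ { (here refl) → Cf ; (there p) → inC p })

          reach₂ : ∀ {s t} → s ∈ f ∷ R → t ∈ f ∷ R → Reach s t
          reach₂ p q = reach-trans (reach-sym (reach-R p)) (reach-R q)

          closes-∉ : ∀ l → Closes f l → ∀ {t} → t ∈ l → f ≢ t
          closes-∉ (z ∷ []) e (here refl) = ~⇒≢ e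
          closes-∉ (z ∷ y ∷ l) ((ne , _) , _) (here refl) = ne
          closes-∉ (z ∷ y ∷ l) (_ , cl) (there p) = closes-∉ (y ∷ l) cl p

          f≢ : ∀ {t} → t ∈ R → f ≢ t
          f≢ (here refl) = ~⇒≢ (proj₁ rim)
          f≢ (there p) = closes-∉ _ (proj₂ rim) p

          b≁R : ∀ {t} → t ∈ R → ¬ b ~ t
          b≁R p e = f≢ p (at-most-one Db b~f e (reach-R (there p)))

          unsnoc : ∀ {f} y l → Closes f (y ∷ l) → ∃₂ λ M z → y ∷ l ≡ M ++ [ z ] × f ~ z
          unsnoc y [] e = [] , y , refl , e
          unsnoc y (x ∷ l) (_ , cl) with unsnoc x l cl
          ... | M , z , eq , e = y ∷ M , z , cong (y ∷_) eq , e

          core : Core (f ∷ R)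
          core with unsnoc y₂ (y₃ ∷ B) (proj₂ rim)
          ... | M , z , eq , f~z = subst (λ l → Core (f ∷ y₁ ∷ l)) (sym eq)
            (cycle-core f y₁ M z (subst (λ l → Induced (y₁ ∷ l)) eq ip) (proj₁ rim) f~z
              λ p → f≢ (subst (λ l → f ∈ y₁ ∷ l) (sym eq) (∈-++⁺ˡ p)) refl)

          -- By maximality of X every vertex of D sees the hole, so a second neighbour in C would give a sector.
          marks-on-hole : ∀ {c v} → D c → c ~ v → Reach f v → v ∈ f ∷ R
          marks-on-hole {c} Dc c~v r with neighbour-in? c (f ∷ R)
          ... | yes (z , z∈ , e) = subst (_∈ f ∷ R) (sym (at-most-one Dc c~v e (reach-trans (reach-sym r) (reach-R z∈)))) z∈
          ... | no none = ⊥-elim (forest Dc f R (λ { (here refl) → Cf , (λ e → none (f , here refl , e)) ; (there p) → inC p , λ e → none (_ , there p , e) }) core)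

          record State (v : V) (K : List V) : Set where
            field
              nbL : NonBacktracking ((v ∷ K) ++ y₃ ∷ y₂ ∷ [ y₁ ])
              nbR : NonBacktracking ((v ∷ K) ++ y₃ ∷ B)
              inP : ∀ {t} → t ∈ v ∷ K → P t
              reach : Reach f v
              v≢f : v ≢ f

          previous : List V → V
          previous [] = y₃
          previous (d ∷ _) = d

          grow : ∀ {u v} K A → v ~ u → u ≢ previous K → NonBacktracking ((v ∷ K) ++ y₃ ∷ A) → NonBacktracking ((u ∷ v ∷ K) ++ y₃ ∷ A)
          grow [] A e ne nb = ~-sym e , ne , nb
          grow (d ∷ K) A e ne nb = ~-sym e , ne , nb

          ip-with : ∀ {v K} A → (∀ {t} → t ∈ y₃ ∷ A → t ∈ R) → (∀ {t} → t ∈ v ∷ K → P t) → NonBacktracking ((v ∷ K) ++ y₃ ∷ A) → Induced ((v ∷ K) ++ y₃ ∷ A)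
          ip-with {v} {K} A sub inP = NonBacktracking⇒Induced (forest Db) ((v ∷ K) ++ y₃ ∷ A) ([ inP , (λ p → inC (sub p) , b≁R (sub p)) ]′ ∘ ∈-++⁻ (v ∷ K))

          left⊆ : ∀ {t} → t ∈ y₃ ∷ y₂ ∷ [ y₁ ] → t ∈ R
          left⊆ (here e) = there (there (here e))
          left⊆ (there (here e)) = there (here e)
          left⊆ (there (there (here e))) = here e

          -- By `marks-on-hole` a vertex reached off the hole has no neighbour in D. The walk
          -- therefore has to avoid only its predecessor and f, the one vertex of the component that
          -- b sees.
          wander : ∀ k v K → n ≤ k + length K → State v K → ⊥
          wander k v K le st = continue k le
            where
            open State st
            ipL : Induced ((v ∷ K) ++ y₃ ∷ y₂ ∷ [ y₁ ])
            ipL = ip-with _ left⊆ inP nbL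
            ipR : Induced ((v ∷ K) ++ y₃ ∷ B)
            ipR = ip-with B (there ∘ there) inP nbR
            Cv : C v
            Cv = proj₁ (inP (here refl))
            v∉ : ¬ v ∈ f ∷ R
            v∉ (here eq) = v≢f eq
            v∉ (there (here refl)) = proj₁ (Induced-++-Anti (v ∷ K) ipL (here refl) (there (here refl))) refl
            v∉ (there (there (here refl))) = proj₁ (Induced-++-Anti (v ∷ K) ipL (here refl) (here refl)) refl
            v∉ (there (there (there (here refl)))) = Induced-≢ v (K ++ y₃ ∷ B) ipR (∈-++⁺ʳ K (here refl)) refl
            v∉ (there (there (there (there p)))) = proj₁ (Induced-++-Anti (v ∷ K) ipR (here refl) p) refl
            free-v : ∀ {u} → v ~ u → C u
            free-v v~u with nbr Cv v~u
            ... | inj₁ c = c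
            ... | inj₂ d = ⊥-elim (v∉ (marks-on-hole d (~-sym v~u) reach))
            continue : ∀ k → n ≤ k + length K → ⊥
            continue zero le = ℕ.<⇒≱ (Induced-length (v ∷ K) (Induced-++ˡ (v ∷ K) ipL)) le
            continue (suc k) le with deg≥3 Cv (previous K) f
            ... | u , v~u , u≢p , u≢f = wander k u (v ∷ K) (subst (n ≤_) (sym (ℕ.+-suc k (length K))) le) record
              { nbL = grow K _ v~u u≢p nbL ; nbR = grow K B v~u u≢p nbR
              ; inP = λ { (here refl) → Cu , (λ e → u≢f (sym (at-most-one Db b~f e reach-u))) ; (there p) → inP p }
              ; reach = reach-u ; v≢f = u≢f }
              where
              Cu = free-v v~u
              reach-u = reach-trans reach (step Cv v~u (stop Cu))

        -- The third path of an odd theta runs from f through b, X and c to y₃, or directly from b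
        -- to c if they are adjacent; b sees the hole only at f, and c only at y₃.
        no-mark-at-y₃ : ∀ {c} → D c → c ~ y₃ → ⊥
        no-mark-at-y₃ {c} Dc c~y with b ~? c
        ... | yes b~c = third-arm S (b ∷ [ c ]) (λ ())
            (~-sym b~f , f-non , b~c , (λ { (here refl) → D≢C Db (inC y₃∈) , b≁R y₃∈ }) , c~y , (λ ()) , tt)
            (λ p q → side (left⊆ (there p)) (λ { refl → Induced-distinct-y₃ p }) q) (λ p q → side (there (there (there p))) (λ { refl → right-distinct p }) q)
          where
          open Sector S using (m≁e; ipL; ipR)
          c-only : ∀ {t} → t ∈ f ∷ R → t ≢ y₃ → ¬ c ~ t
          c-only p t≢ e = t≢ (at-most-one Dc e c~y (reach₂ p (there y₃∈)))
          f-non : NonAll f (c ∷ [ y₃ ])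
          f-non (here refl) = C≢D Cf Dc , c-only (here refl) (f≢ y₃∈) ∘ ~-sym
          f-non (there (here refl)) = f≢ y₃∈ , m≁e ∘ ~-sym
          Induced-distinct-y₃ : ¬ y₃ ∈ y₂ ∷ [ y₁ ]
          Induced-distinct-y₃ p = Induced-≢ y₃ (y₂ ∷ [ y₁ ]) (Induced-++ˡ (y₃ ∷ y₂ ∷ [ y₁ ]) ipL) p refl
          right-distinct : ¬ y₃ ∈ B
          right-distinct p = Induced-≢ y₃ B (Induced-++ˡ (y₃ ∷ B) ipR) p refl
          side : ∀ {t q} → t ∈ R → t ≢ y₃ → q ∈ b ∷ [ c ] → Non t q
          side p _ (here refl) = C≢D (inC p) Db , b≁R p ∘ ~-sym
          side p ne (there (here refl)) = C≢D (inC p) Dc , c-only (there p) ne ∘ ~-sym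
        ... | no b≁c with link Db Dc (λ { refl → b≁R y₃∈ c~y }) b≁c
        ...   | X , ipX , sep = third-arm S (b ∷ X ++ [ c ]) (λ ())
            (~-sym b~f , f-non , subst (λ l → Induced (b ∷ l)) (sym (++-assoc X [ c ] [ y₃ ])) (Induced-++ (b ∷ X) [ y₃ ] ipX (c~y , (λ ()) , tt) b-X))
            (λ p q → side (left⊆ (there p)) (λ { refl → Induced-distinct-y₃ p }) q) (λ p q → side (there (there (there p))) (λ { refl → right-distinct p }) q)
          where
          open Sector S using (m≁e; ipL; ipR)
          c-only : ∀ {t} → t ∈ f ∷ R → t ≢ y₃ → ¬ c ~ t
          c-only p t≢ e = t≢ (at-most-one Dc e c~y (reach₂ p (there y₃∈)))
          b-X : Anti (b ∷ X) [ y₃ ]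
          b-X (here refl) (here refl) = D≢C Db (inC y₃∈) , b≁R y₃∈
          b-X (there p) (here refl) = sep p (inC y₃∈)
          f-non : NonAll f ((X ++ [ c ]) ++ [ y₃ ])
          f-non p with ∈-snoc (X ++ [ c ]) p
          ... | inj₂ refl = f≢ y₃∈ , m≁e ∘ ~-sym
          ... | inj₁ q with ∈-snoc X q
          ...   | inj₁ q′ = Non-sym (sep q′ Cf)
          ...   | inj₂ refl = C≢D Cf Dc , c-only (here refl) (f≢ y₃∈) ∘ ~-sym
          Induced-distinct-y₃ : ¬ y₃ ∈ y₂ ∷ [ y₁ ]
          Induced-distinct-y₃ p = Induced-≢ y₃ (y₂ ∷ [ y₁ ]) (Induced-++ˡ (y₃ ∷ y₂ ∷ [ y₁ ]) ipL) p refl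
          right-distinct : ¬ y₃ ∈ B
          right-distinct p = Induced-≢ y₃ B (Induced-++ˡ (y₃ ∷ B) ipR) p refl
          side : ∀ {t q} → t ∈ R → t ≢ y₃ → q ∈ b ∷ X ++ [ c ] → Non t q
          side p _ (here refl) = C≢D (inC p) Db , b≁R p ∘ ~-sym
          side p ne (there q) with ∈-snoc X q
          ... | inj₁ q′ = Non-sym (sep q′ (inC p))
          ... | inj₂ refl = C≢D (inC p) Dc , c-only (there p) ne ∘ ~-sym

        -- A third neighbour of y₃ lies neither in D, by `no-mark-at-y₃`, nor in C, by `wander`.
        hole-impossible : ⊥
        hole-impossible with deg≥3 (inC y₃∈) y₂ y₄
        ... | u , y₃~u , u≢y₂ , u≢y₄ with nbr (inC y₃∈) y₃~u
        ...   | inj₂ Du = no-mark-at-y₃ Du (~-sym y₃~u)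
        ...   | inj₁ Cu = wander n u [] (ℕ.m≤m+n n 0) record
          { nbL = ~-sym y₃~u , u≢y₂ , ~-sym (proj₁ (proj₂ (proj₂ ip))) , proj₁ y₁-y₃ ∘ sym , ~-sym (proj₁ ip)
          ; nbR = ~-sym y₃~u , u≢y₄ , Induced⇒NonBacktracking (y₃ ∷ B) (Induced-tail _ (Induced-tail _ ip))
          ; inP = λ { (here refl) → Cu , λ e → u≢f (sym (at-most-one Db b~f e reach-u)) }
          ; reach = reach-u ; v≢f = u≢f }
          where
          y₁-y₃ : Non y₁ y₃
          y₁-y₃ = proj₁ (proj₂ ip) (here refl)
          u≢f : u ≢ f
          u≢f refl = Sector.m≁e S y₃~u
          reach-u : Reach f u
          reach-u = reach-trans (reach-R (there y₃∈)) (step (inC y₃∈) y₃~u (stop Cu))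

      -- Rims of two, three or four vertices would give cycles of length 3, 4 or 5.
      no-rim : C f → ∀ R → Induced R → Rim f R → (∀ {t} → t ∈ R → C t) → ⊥
      no-rim Cf (y₁ ∷ y₂ ∷ []) (e , _) (f~y₁ , f~y₂) _ = three-colours (proper f~y₁) (proper f~y₂) (proper e)
      no-rim Cf (y₁ ∷ y₂ ∷ y₃ ∷ []) (e , nx , e′ , _) (f~y₁ , (f≢y₂ , _) , f~y₃) _ =
        no-4-cycle f≢y₂ (proj₁ (nx (here refl))) f~y₁ f~y₃ (~-sym e) e′
      no-rim Cf (y₁ ∷ y₂ ∷ y₃ ∷ y₄ ∷ []) (e , _ , e′ , _ , e″ , _) (f~y₁ , _ , _ , f~y₄) _ =
        proper e′ (two-colours (proper e) (λ q → proper e″ (trans (sym q) (same-colour f~y₁ f~y₄))))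
      no-rim Cf (y₁ ∷ y₂ ∷ y₃ ∷ y₄ ∷ y₅ ∷ rest) ip rim inC = Hole′.hole-impossible Cf y₁ y₂ y₃ y₄ y₅ rest ip rim inC

    no-core : ∀ {b} → D b → ∀ x T → (∀ {t} → t ∈ x ∷ T → C t) → Core (x ∷ T) → ⊥
    no-core {b} Db x T inC core with neighbour-in? b (x ∷ T)
    ... | no none = forest Db x T (λ p → inC p , λ e → none (_ , p , e)) core
    ... | yes (f , f∈ , b~f) with first-return Db b~f x T inC core f∈
    ...   | R , ip , rim , inC′ = no-rim Db b~f (inC f∈) R ip rim inC′

  -- Growing X from the root

  module Growth (free : OddThetaFree) where
    open OddThetaFree free
    open import Data.List.Membership.DecPropositional (_≟_ {n}) using (_∈?_)

    -- A connected set listed in an order of growth without repetitions, so that its size is at most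
    -- n and the growth ends.
    data Connected : List V → Set where
      single : ∀ x → Connected [ x ]
      grow   : ∀ {b x X} → ¬ b ∈ X → x ∈ X → b ~ x → Connected X → Connected (b ∷ X)

    Connected-lookup : ∀ {X} → Connected X → ∀ i j → toℕ i < toℕ j → lookup X i ≢ lookup X j
    Connected-lookup (grow b∉ _ _ _) zero (suc j) _ eq = b∉ (subst (_∈ _) (sym eq) (∈-lookup j))
    Connected-lookup (grow _ _ _ con) (suc i) (suc j) (s≤s lt) eq = Connected-lookup con i j lt eq
    Connected-lookup (single x) zero (suc ()) _ _

    Connected-length : ∀ {X} → Connected X → length X ≤ n
    Connected-length {X} con with ℕ.≤-<-connex (length X) n
    ... | inj₁ le = le
    ... | inj₂ lt with pigeonhole lt (lookup X)
    ...   | i , j , i<j , eq = ⊥-elim (Connected-lookup con i j i<j eq)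

    private
      Walk-join : ∀ l {y} m → Walk (l ++ [ y ]) → Walk (y ∷ m) → Walk (l ++ y ∷ m)
      Walk-join [] m _ wk = wk
      Walk-join (a ∷ []) m (e , _) wk = e , wk
      Walk-join (a ∷ b ∷ l) m (e , wk₁) wk = e , Walk-join (b ∷ l) m wk₁ wk

      Walk-reverse : ∀ {x y} l → Walk (x ∷ l ++ [ y ]) → Walk (y ∷ reverse l ++ [ x ])
      Walk-reverse {x} {y} l wk = subst Walk (reverse-ends x l y) (go (x ∷ l ++ [ y ]) wk)
        where
        push : ∀ a l → Walk l → (∀ {z m} → l ≡ z ∷ m → a ~ z) → Walk (a ∷ l)
        push a [] _ _ = tt
        push a (z ∷ l) wk e = e refl , wk
        rev : ∀ a l acc → Walk (a ∷ l) → Walk (a ∷ acc) → Walk (l ʳ++ (a ∷ acc))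
        rev a [] acc _ wk = wk
        rev a (z ∷ l) acc (e , wk₁) wk = rev z l (a ∷ acc) wk₁ (~-sym e , wk)
        go : ∀ l → Walk l → Walk (reverse l)
        go [] _ = tt
        go (a ∷ l) wk = rev a l [] wk tt

    Joined : List V → V → V → Set
    Joined X x y = x ≡ y ⊎ ∃ λ l → Walk (x ∷ l ++ [ y ]) × (∀ {t} → t ∈ l → t ∈ X)

    connected-joined : ∀ {X} → Connected X → ∀ {x y} → x ∈ X → y ∈ X → Joined X x y
    connected-joined (single _) (here refl) (here refl) = inj₁ refl
    connected-joined (grow _ _ _ _) (here refl) (here refl) = inj₁ refl
    connected-joined (grow {b} {x₀} {X} _ x₀∈ e con) = λ where
        (here refl) (here refl) → inj₁ refl
        (here refl) (there q) → inj₂ (out (connected-joined con x₀∈ q))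
        (there p) (here refl) → inj₂ (flip (out (connected-joined con x₀∈ p)))
        (there p) (there q) → weaken (connected-joined con p q)
      where
      out : ∀ {y} → Joined X x₀ y → ∃ λ l → Walk (b ∷ l ++ [ y ]) × (∀ {t} → t ∈ l → t ∈ b ∷ X)
      out (inj₁ refl) = [] , (e , tt) , λ ()
      out (inj₂ (l , wk , sub)) = x₀ ∷ l , (e , wk) , λ { (here refl) → there x₀∈ ; (there p) → there (sub p) }
      flip : ∀ {y} → (∃ λ l → Walk (b ∷ l ++ [ y ]) × (∀ {t} → t ∈ l → t ∈ b ∷ X)) → ∃ λ l → Walk (y ∷ l ++ [ b ]) × (∀ {t} → t ∈ l → t ∈ b ∷ X)
      flip (l , wk , sub) = reverse l , Walk-reverse l wk , λ p → sub (reverse⁻ p)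
      weaken : ∀ {x y} → Joined X x y → Joined (b ∷ X) x y
      weaken (inj₁ eq) = inj₁ eq
      weaken (inj₂ (l , wk , sub)) = inj₂ (l , wk , λ p → there (sub p))

    -- The degree condition concerns only vertices that have a neighbour; this allows an isolated
    -- vertex besides the root.
    module Rooted (ρ : V) (deg : ∀ {v} → v ≢ ρ → (∃ λ u → v ~ u) → ∀ p q → ∃ λ u → v ~ u × u ≢ p × u ≢ q) where

      data Linked : V → Set where
        root : Linked ρ
        edge : ∀ {u v} → Linked u → u ~ v → Linked v

      -- Restricting to vertices linked to ρ ensures that X has a neighbour by which it can grow
      -- whenever a far vertex exists, and that far vertices have a neighbour.
      Far : List V → V → Set
      Far X v = ¬ v ∈ X × (∀ {x} → x ∈ X → ¬ v ~ x) × Linked v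

      Near : List V → V → Set
      Near X v = ¬ v ∈ X × ∃ λ x → x ∈ X × v ~ x

      far-degree : ∀ {X v} → ρ ∈ X → Far X v → ∀ p q → ∃ λ u → v ~ u × u ≢ p × u ≢ q
      far-degree {v = v} ρ∈ (v∉ , _ , lk) = deg (λ { refl → v∉ ρ∈ }) (last-edge lk)
        where
        last-edge : Linked v → ∃ λ u → v ~ u
        last-edge root = ⊥-elim (v∉ ρ∈)
        last-edge (edge _ e) = _ , ~-sym e

      boundary : ∀ {X v} → ρ ∈ X → Linked v → v ∈ X ⊎ ∃ (Near X)
      boundary ρ∈ root = inj₁ ρ∈
      boundary {X} {v} ρ∈ (edge {u} lk e) with boundary ρ∈ lk
      ... | inj₂ near = inj₂ near
      ... | inj₁ u∈ with v ∈? X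
      ...   | yes v∈ = inj₁ v∈
      ...   | no v∉ = inj₂ (v , v∉ , u , u∈ , ~-sym e)

      splitting : ∀ {X} → ρ ∈ X → Connected X → (∀ {b} → Near X b → NoCore (λ v → Far X v × ¬ b ~ v)) → Split
      splitting {X} ρ∈ con forest = record
        { C = Far X ; D = Near X ; D? = near? ; C⇒¬D = λ { (_ , far , _) (_ , x , x∈ , e) → far x∈ e }
        ; nbr = classify ; deg≥3 = far-degree ρ∈ ; link = link ; forest = forest }
        where
        near? : ∀ v → Dec (Near X v)
        near? v = ¬? (v ∈? X) ×-dec neighbour-in? v X
        classify : ∀ {v u} → Far X v → v ~ u → Far X u ⊎ Near X u
        classify {v} {u} (v∉ , far , lk) e with neighbour-in? u X
        ... | yes near = inj₂ ((λ u∈ → far u∈ e) , near)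
        ... | no none = inj₁ ((λ u∈ → far u∈ e) , (λ x∈ e′ → none (_ , x∈ , e′)) , edge lk e)
        -- The walk from c into X, through X and out to e is shortened to an induced path; its
        -- interior stays in X, where no far vertex has a neighbour.
        link : ∀ {c e} → Near X c → Near X e → c ≢ e → ¬ c ~ e →
          ∃ λ R → Induced (c ∷ R ++ [ e ]) × (∀ {r v} → r ∈ R → Far X v → Non r v)
        link {c} {e} (_ , x , x∈ , c~x) (_ , y , y∈ , e~y) c≢e _ = through (connected-joined con x∈ y∈)
          where
          shorten : ∀ l → Walk (c ∷ l ++ [ e ]) → (∀ {t} → t ∈ l → t ∈ X) → ∃ λ R → Induced (c ∷ R ++ [ e ]) × (∀ {r v} → r ∈ R → Far X v → Non r v)
          shorten l wk sub with shortcut c l wk c≢e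
          ... | R , ip , sub′ , _ = R , ip , λ { r∈ (v∉ , far , _) → (λ { refl → v∉ (sub (sub′ r∈)) }) , far (sub (sub′ r∈)) ∘ ~-sym }
          through : Joined X x y → ∃ λ R → Induced (c ∷ R ++ [ e ]) × (∀ {r v} → r ∈ R → Far X v → Non r v)
          through (inj₁ refl) = shorten [ x ] (c~x , ~-sym e~y , tt) λ { (here refl) → x∈ }
          through (inj₂ (l , wk , sub)) = shorten (x ∷ l ++ [ y ])
            (c~x , subst Walk (cong (x ∷_) (sym (++-assoc l [ y ] [ e ]))) (Walk-join (x ∷ l) [ e ] wk (~-sym e~y , tt)))
            λ { (here refl) → x∈ ; (there p) → [ sub , (λ { refl → y∈ }) ]′ (∈-snoc l p) }

      -- The induction replaces the choice of a maximal X: a core far from X ∪ {b} is refuted first.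
      far-core-free : ∀ k {X} → n < k + length X → ρ ∈ X → Connected X → NoCore (Far X)
      far-core-free zero lt _ con = λ _ _ _ _ → ℕ.<⇒≱ lt (Connected-length con)
      far-core-free (suc k) {X} lt ρ∈ con x T far core with boundary ρ∈ (proj₂ (proj₂ (far (here refl))))
      ... | inj₁ x∈ = proj₁ (far (here refl)) x∈
      ... | inj₂ (_ , near) = Sectors.no-core free (splitting ρ∈ con forest) near x T far core
        where
        forest : ∀ {b} → Near X b → NoCore (λ v → Far X v × ¬ b ~ v)
        forest (b∉ , y , y∈ , e) x′ T′ inP = far-core-free k (subst (n <_) (sym (ℕ.+-suc k (length X))) lt) (there ρ∈) (grow b∉ y∈ e con) x′ T′
          λ p → extend (inP p)
          where
          extend : ∀ {v} → Far X v × ¬ _ ~ v → Far (_ ∷ X) v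
          extend ((v∉ , far , lk) , b≁v) = (λ { (here refl) → far y∈ e ; (there p) → v∉ p }) ,
            (λ { (here refl) e′ → b≁v (~-sym e′) ; (there p) → far p }) , lk

      private
        no-core : NoCore (Far [ ρ ])
        no-core = far-core-free n (ℕ.m<m+n n (s≤s z≤n)) (here refl) (single ρ)

        -- The vertices far from the root alone span a forest. A far vertex has at most one
        -- neighbour in common with ρ, so a walk can always avoid both its predecessor and the
        -- neighbours of ρ.
        endless : ∀ k a v K → n ≤ k + length K → NonBacktracking (v ∷ K) → (∀ {t} → t ∈ v ∷ K → Far [ ρ ] t) → ⊥
        endless k a v K le nb far = continue k le
          where
          previous : List V → V
          previous [] = a
          previous (d ∷ _) = d
          push : ∀ {u} K → v ~ u → u ≢ previous K → NonBacktracking (v ∷ K) → NonBacktracking (u ∷ v ∷ K)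
          push [] e _ _ = ~-sym e
          push (d ∷ K) e ne nb = ~-sym e , ne , nb
          v≁ρ : ¬ v ~ ρ
          v≁ρ = proj₁ (proj₂ (far (here refl))) (here refl)
          v≢ρ : v ≢ ρ
          v≢ρ eq = proj₁ (far (here refl)) (here eq)
          onward : ∃ λ u → v ~ u × u ≢ previous K × ¬ ρ ~ u
          onward with far-degree (here refl) (far (here refl)) (previous K) (previous K)
          ... | u , v~u , u≢p , _ with ρ ~? u
          ...   | no ρ≁u = u , v~u , u≢p , ρ≁u
          ...   | yes ρ~u with far-degree (here refl) (far (here refl)) (previous K) u
          ...     | u′ , v~u′ , u′≢p , u′≢u with ρ ~? u′
          ...       | no ρ≁u′ = u′ , v~u′ , u′≢p , ρ≁u′
          ...       | yes ρ~u′ = ⊥-elim (no-4-cycle v≢ρ (u′≢u ∘ sym) v~u v~u′ ρ~u ρ~u′)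
          continue : ∀ k → n ≤ k + length K → ⊥
          continue zero le = ℕ.<⇒≱ (Induced-length (v ∷ K) (NonBacktracking⇒Induced no-core (v ∷ K) far nb)) le
          continue (suc k) le with onward
          ... | u , v~u , u≢p , ρ≁u = endless k a u (v ∷ K) (subst (n ≤_) (sym (ℕ.+-suc k (length K))) le) (push K v~u u≢p nb)
            λ { (here refl) → (λ { (here refl) → v≁ρ v~u }) , (λ { (here refl) e → ρ≁u (~-sym e) }) , edge (proj₂ (proj₂ (far (here refl)))) v~u
              ; (there p) → far p }

      -- A neighbour a of ρ has a neighbour other than ρ, which is far from ρ by its colour, and the
      -- endless walk starts there.
      no-root-neighbour : ∀ {a} → ¬ ρ ~ a
      no-root-neighbour {a} ρ~a with deg (~⇒≢ ρ~a ∘ sym) (ρ , ~-sym ρ~a) ρ ρ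
      ... | v , a~v , v≢ρ , _ = endless n a v [] (ℕ.m≤m+n n 0) tt
        λ { (here refl) → (λ { (here refl) → v≢ρ refl }) , (λ { (here refl) e → proper e (two-colours (proper a~v) (proper (~-sym ρ~a))) }) , edge (edge root ρ~a) a~v }

-- From degrees to the theorem

no-three-among-two : ∀ {n} {p q : Fin n} (l : List (Fin n)) → Unique l → (∀ {u} → u ∈ l → u ≡ p ⊎ u ≡ q) → length l ≤ 2
no-three-among-two [] _ _ = z≤n
no-three-among-two (_ ∷ []) _ _ = s≤s z≤n
no-three-among-two (_ ∷ _ ∷ []) _ _ = s≤s (s≤s z≤n)
no-three-among-two (a ∷ b ∷ c ∷ _) ((a≢b All.∷ a≢c All.∷ _) AllPairs.∷ (b≢c All.∷ _) AllPairs.∷ _) sub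
  with sub (here refl) | sub (there (here refl)) | sub (there (there (here refl)))
... | inj₁ refl | inj₁ refl | _ = ⊥-elim (a≢b refl)
... | inj₁ refl | _ | inj₁ refl = ⊥-elim (a≢c refl)
... | _ | inj₁ refl | inj₁ refl = ⊥-elim (b≢c refl)
... | inj₂ refl | inj₂ refl | _ = ⊥-elim (a≢b refl)
... | inj₂ refl | _ | inj₂ refl = ⊥-elim (a≢c refl)
... | _ | inj₂ refl | inj₂ refl = ⊥-elim (b≢c refl)

third-neighbour : ∀ {n} (G : Graph n) v → ¬ degree G v ≤ 2 → ∀ p q → ∃ λ u → Edge G v u × u ≢ p × u ≢ q
third-neighbour {n} G v big p q with any? (λ u → (adj G v u Bool.≟ true) ×-dec ¬? (u ≟ p) ×-dec ¬? (u ≟ q))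
... | yes found = found
... | no none = ⊥-elim (big (no-three-among-two (filterᵇ (adj G v) (allFin n)) (Unique.filter⁺ (T? ∘ adj G v) (Unique.allFin⁺ n)) two))
  where
  T⇒≡ : ∀ {b} → T b → b ≡ true
  T⇒≡ {true} _ = refl
  two : ∀ {u} → u ∈ filterᵇ (adj G v) (allFin n) → u ≡ p ⊎ u ≡ q
  two {u} u∈ with u ≟ p | u ≟ q
  ... | yes eq | _ = inj₁ eq
  ... | no _ | yes eq = inj₂ eq
  ... | no u≢p | no u≢q = ⊥-elim (none (u , T⇒≡ (proj₂ (∈-filter⁻ (T? ∘ adj G v) {xs = allFin n} u∈)) , u≢p , u≢q))

oddThetaFree : ∀ {n} {G : Graph n} → LinearBalanceable G → Graphs.OddThetaFree G
oddThetaFree {G = G} (((col , proper) , σ , balanced) , noC4) = record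
  { col = col ; proper = proper _ _ ; no-4-cycle = Graphs.no-C4 G noC4 col proper
  ; theta = Graphs.Weights.no-odd-theta G σ balanced col proper }

another : ∀ {n} → 2 ≤ n → (r : Fin n) → ∃ λ v → v ≢ r
another (s≤s (s≤s _)) zero = suc zero , λ ()
another (s≤s (s≤s _)) (suc _) = zero , λ ()

-- If all other vertices had degree at least 3, r would be a root with a neighbour, or isolated.
-- When r is isolated any other vertex s serves as root, because r, having no neighbour, is exempt
-- from the degree condition of `Rooted`.
low-degree-elsewhere : ∀ {n} (G : Graph n) → 2 ≤ n → Graphs.OddThetaFree G → ∀ r → ∃ λ v → v ≢ r × degree G v ≤ 2
low-degree-elsewhere {n} G 2≤n free r with any? (λ v → ¬? (v ≟ r) ×-dec (degree G v ≤? 2))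
... | yes found = found
... | no none with any? (λ a → adj G r a Bool.≟ true)
...   | yes (a , r~a) = ⊥-elim (Graphs.Growth.Rooted.no-root-neighbour G free r (λ {v} v≢r _ → third-neighbour G v λ le → none (v , v≢r , le)) r~a)
...   | no isolated with another 2≤n r
...     | s , s≢r with third-neighbour G s (λ le → none (s , s≢r , le)) r r
...       | a , s~a , _ = ⊥-elim (Graphs.Growth.Rooted.no-root-neighbour G free s
            (λ { {v} _ (u , e) → third-neighbour G v λ le → none (v , (λ { refl → isolated (u , e) }) , le) }) s~a)

theorem4p2 : (n : ℕ) → (G : Graph n) → 2 ≤ n → LinearBalanceable G →
    Σ (Fin n) λ u → Σ (Fin n) λ v →
    u ≢ v × degree G u ≤ 2 × degree G v ≤ 2
theorem4p2 (suc n) G 2≤n lin =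
  let free = oddThetaFree lin
      u , _ , du = low-degree-elsewhere G 2≤n free zero
      v , v≢u , dv = low-degree-elsewhere G 2≤n free u
  in u , v , (λ eq → v≢u (sym eq)) , du , dv
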